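{- There is a constant amortized time (CAT) algorithm which, given integers $n\ge 1$ and $0\le k\le\frac{n(n-1)}{2}$, generates all permutations in $\mathfrak{S}_n$ with major index equal to $k$, each exactly once, in an order in which two consecutive generated permutations $\sigma,\tau$ differ by at most three transpositions (i.e. $\tau=\sigma\cdot\theta_1\cdots\theta_m$ with $m\le 3$ and $\theta_1,\ldots,\theta_m$ transpositions). That is, there is an absolute constant $C$ such that, for all such $n,k$, the total number of elementary operations performed is at most $C\,(N+n^2)$, where $N$ is the number of permutations in $\mathfrak{S}_n$ with major index $k$.
   Context: $\mathfrak{S}_n$ is the set of permutations of $\{1,\ldots,n\}$, with product $(\sigma\cdot\tau)(i)=\sigma(\tau(i))$. The major index of $\pi\in\mathfrak{S}_n$ is the sum of all $i$, $1\le i<n$, with $\pi_i>\pi_{i+1}$. Operations are counted in the unit-cost random access model (arithmetic, comparisons and array accesses on integers of size polynomial in $n$ cost one). The current permutation is stored in an array modified in place; "generating" a permutation means that the array contains it at a designated output instant, and the cost of printing the array is not counted. The term $n^2$ accounts for the pre-processing (tabulating functions such as $x\mapsto\min\{s:\frac{s(s-1)}{2}\ge x\}$ for $x\le\frac{n(n-1)}{2}$) and the initialization of the first permutation. -}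

module Defs where

open import Data.Bool.Base using (if_then_else_)
open import Data.Nat.Base using (ℕ; zero; suc; _+_; _∸_; _*_; _/_; _≤_; _<ᵇ_; _≡ᵇ_)
open import Data.Nat.Properties using (_≟_)
open import Data.Fin.Base using (Fin; zero; suc; toℕ; inject₁)
open import Data.Fin.Properties using (_<?_)
open import Data.Fin.Permutation using (Permutation′; _⟨$⟩ʳ_; _≈_; _∘ₚ_; id; insert; transpose)
open import Data.Fin.Permutation.Transposition.List using (TranspositionList)
open import Data.List.Base using (List; []; _∷_; _++_; map; filter; length; allFin; concatMap; foldl)
open import Data.Nat.ListAction using (sum)
open import Data.List.Relation.Binary.Pointwise using (Pointwise)
open import Data.List.Relation.Unary.All using (All)
open import Data.List.Relation.Unary.AllPairs using (AllPairs)
open import Data.List.Relation.Unary.Any using (Any)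
open import Data.Product.Base using (Σ-syntax; ∃-syntax; _×_; _,_; uncurry)
open import Data.Vec.Base using (Vec; lookup)
open import Function.Bundles using (_⇔_)
open import Relation.Binary.PropositionalEquality.Core using (_≡_; _≢_)
open import Relation.Nullary.Negation.Core using (¬_)

------------------------------------------------------------------------
-- The points 1, …, n are represented by Fin n: i stands for suc (toℕ i).

infixl 9 _·_

_·_ : ∀ {n} → Permutation′ n → Permutation′ n → Permutation′ n
σ · τ = τ ∘ₚ σ   -- _∘ₚ_ applies its left argument first

-- The position suc (toℕ i) ≤ n in a permutation of 1, …, n + 1 is inject₁ i
-- as a point, and i itself in the list of descents.
descents : ∀ {n} → Permutation′ (suc n) → List (Fin n)
descents {n} π = filter (λ i → (π ⟨$⟩ʳ suc i) <? (π ⟨$⟩ʳ inject₁ i)) (allFin n)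

maj : ∀ {n} → Permutation′ n → ℕ
maj {zero}  π = 0
maj {suc n} π = sum (map (λ i → suc (toℕ i)) (descents π))

-- A permutation of n + 1 points is a choice of its first value j together
-- with a permutation of the other n points.
permutations : ∀ n → List (Permutation′ n)
permutations zero    = id ∷ []
permutations (suc n) = concatMap (λ j → map (insert zero j) (permutations n)) (allFin (suc n))

majCount : ℕ → ℕ → ℕ
majCount n k = length (filter (λ π → maj π ≟ k) (permutations n))

record ListsMajorIndex {n} (k : ℕ) (πs : List (Permutation′ n)) : Set where
  field
    exactly  : ∀ π → Any (π ≈_) πs ⇔ (maj π ≡ k)
    distinct : AllPairs (λ π ρ → ¬ (π ≈ ρ)) πs

DifferByTranspositions : ∀ {n} → ℕ → Permutation′ n → Permutation′ n → Set
DifferByTranspositions {n} b σ τ =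
  Σ[ θs ∈ TranspositionList n ]
    length θs ≤ b ×
    All (uncurry _≢_) θs ×
    τ ≈ foldl (λ ρ (i , j) → ρ · transpose i j) σ θs

------------------------------------------------------------------------
-- A unit-cost random access machine in structured form: a program consists
-- of a main command and finitely many, possibly recursive, procedures
-- acting on global arrays of natural numbers, initially 0.  Local variables
-- and arrays are named by numbers fixed in the program text, so a program
-- uses finitely many of each.

Name : Set
Name = ℕ

data Op : Set where
  add sub mul div lt eq : Op

data Expr : Set where
  lit  : ℕ → Expr
  var  : Name → Expr
  cell : Name → Expr → Expr
  op   : Op → Expr → Expr → Expr

infix  6 _:=_
infixr 5 _⨾_

data Cmd (p : ℕ) : Set where
  skip    : Cmd p
  _:=_    : Name → Expr → Cmd p
  store   : Name → Expr → Expr → Cmd p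
  _⨾_     : Cmd p → Cmd p → Cmd p
  cond    : Expr → Cmd p → Cmd p → Cmd p
  while   : Expr → Cmd p → Cmd p
  call    : Fin p → List Expr → Cmd p
  output  : Cmd p

record Program : Set where
  field
    {size} : ℕ
    procs  : Vec (Cmd size) size
    main   : Cmd size

Contents : Set
Contents = ℕ → ℕ

record State : Set where
  constructor ⟨_,_⟩
  field
    locals : Name → ℕ
    arrays : Name → Contents

open State public

-- Subtraction is truncated, division rounds down and yields 0 for divisor
-- 0, comparisons yield 1 for true and 0 for false.
apply : Op → ℕ → ℕ → ℕ
apply add x y       = x + y
apply sub x y       = x ∸ y
apply mul x y       = x * y
apply div x zero    = 0
apply div x (suc y) = x / suc y
apply lt  x y       = if x <ᵇ y then 1 else 0
apply eq  x y       = if x ≡ᵇ y then 1 else 0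

eval : State → Expr → ℕ
eval s (lit c)     = c
eval s (var x)     = locals s x
eval s (cell a e)   = arrays s a (eval s e)
eval s (op o e e′) = apply o (eval s e) (eval s e′)

-- Every value met in the evaluation, addresses included, is at most W.
Fits : ℕ → State → Expr → Set
Fits W s (lit c)     = c ≤ W
Fits W s (var x)     = locals s x ≤ W
Fits W s (cell a e)   = Fits W s e × eval s (cell a e) ≤ W
Fits W s (op o e e′) = Fits W s e × Fits W s e′ × eval s (op o e e′) ≤ W

cost : Expr → ℕ
cost (lit c)     = 1
cost (var x)     = 1
cost (cell a e)   = suc (cost e)
cost (op o e e′) = suc (cost e + cost e′)

_[_↦_] : {A : Set} → (ℕ → A) → ℕ → A → ℕ → A
(f [ x ↦ v ]) y = if x ≡ᵇ y then v else f y

setLocal : State → Name → ℕ → State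
setLocal ⟨ l , m ⟩ x v = ⟨ l [ x ↦ v ] , m ⟩

setCell : State → Name → ℕ → ℕ → State
setCell ⟨ l , m ⟩ a i v = ⟨ l , m [ a ↦ m a [ i ↦ v ] ] ⟩

-- The locals of a called procedure: variables 0, 1, … hold the arguments,
-- the others hold 0.
frame : List ℕ → Name → ℕ
frame []       _       = 0
frame (v ∷ vs) zero    = v
frame (v ∷ vs) (suc x) = frame vs x

perm : Name
perm = 0

-- Exec W procs d c s s′ ts t: from state s the command c terminates in
-- state s′ after t elementary operations, every value met being at most W
-- and calls being nested at most d deep; ts lists the successive contents
-- of the array perm at the output instants.
-- An output counts as one operation, whatever the length of the array.
data Exec (W : ℕ) {p} (procs : Vec (Cmd p) p) :
          ℕ → Cmd p → State → State → List Contents → ℕ → Set where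

  skip : ∀ {d s} →
    Exec W procs d skip s s [] 1

  assign : ∀ {d s x e} →
    Fits W s e →
    Exec W procs d (x := e) s (setLocal s x (eval s e)) [] (suc (cost e))

  store : ∀ {d s a e e′} →
    Fits W s e → Fits W s e′ →
    Exec W procs d (store a e e′) s (setCell s a (eval s e) (eval s e′)) []
         (suc (cost e + cost e′))

  seq : ∀ {d c c′ s s′ s″ ts ts′ t t′} →
    Exec W procs d c s s′ ts t →
    Exec W procs d c′ s′ s″ ts′ t′ →
    Exec W procs d (c ⨾ c′) s s″ (ts ++ ts′) (t + t′)

  cond-true : ∀ {d e c c′ s s′ ts t} →
    Fits W s e → eval s e ≢ 0 →
    Exec W procs d c s s′ ts t →
    Exec W procs d (cond e c c′) s s′ ts (suc (cost e + t))

  cond-false : ∀ {d e c c′ s s′ ts t} →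
    Fits W s e → eval s e ≡ 0 →
    Exec W procs d c′ s s′ ts t →
    Exec W procs d (cond e c c′) s s′ ts (suc (cost e + t))

  while-true : ∀ {d e c s s′ s″ ts ts′ t t′} →
    Fits W s e → eval s e ≢ 0 →
    Exec W procs d c s s′ ts t →
    Exec W procs d (while e c) s′ s″ ts′ t′ →
    Exec W procs d (while e c) s s″ (ts ++ ts′) (suc (cost e + t + t′))

  while-false : ∀ {d e c s} →
    Fits W s e → eval s e ≡ 0 →
    Exec W procs d (while e c) s s [] (suc (cost e))

  call : ∀ {d f es s s′ ts t} →
    All (Fits W s) es →
    Exec W procs d (lookup procs f) ⟨ frame (map (eval s) es) , arrays s ⟩ s′ ts t →
    Exec W procs (suc d) (call f es) s ⟨ locals s , arrays s′ ⟩ ts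
         (suc (sum (map cost es) + t))

  output : ∀ {d s} →
    Exec W procs d output s s (arrays s perm ∷ []) 1

initial : List ℕ → State
initial inputs = ⟨ frame inputs , (λ _ _ → 0) ⟩

-- One-line notation at addresses 1, …, n.
Holds : ∀ {n} → Contents → Permutation′ n → Set
Holds a π = ∀ i → a (suc (toℕ i)) ≡ suc (toℕ (π ⟨$⟩ʳ i))

-- On the given inputs, with integers (and recursion depth) bounded by W,
-- the program generates the permutations πs in this order and terminates
-- after t elementary operations.
Generates : ∀ {n} → Program → (W : ℕ) → List ℕ → List (Permutation′ n) → ℕ → Set
Generates P W inputs πs t =
  ∃[ s ] ∃[ ts ] Exec W (Program.procs P) W (Program.main P) (initial inputs) s ts t
               × Pointwise Holds ts πs

module Submission where

{- A permutation of n points is encoded by a word t_n … t_1 with t_j < j: its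
last value lies t_n steps before n, and each further value, going left, t_j
steps before the cyclic predecessor of its right neighbour among the values
that are left.  The major index is the sum of the digits, and changing
(t_{j+1} , t_j) by (1 , -1) exchanges two values.

The words of sum m are listed recursively: the leading digit t first increases
in steps of 2 and then decreases in steps of 2, and the sublists are traversed
forwards on the way up and backwards on the way down.  Each list begins with the lowest word,
whose mass is in the lowest digits, and ends with one of two words that agree
with a lowest word below the leading digit; an end word of excess 1 or 2
matches the lowest word whose sum is smaller by 1 or 2.  So consecutive sublists
meet in words that differ by at most three unit moves near the top.  The
position of the value to be exchanged is computed from a table, as the
permutation of a lowest word is a product of two reversals.

A node with sum 0 or maximal sum is a leaf, at which the array already holds
the permutation, and every other node has at least two children, so the time
is linear in the number of leaves. -}

open import Defs
open import Data.Nat.Base using (ℕ; _+_; _*_; _∸_; _/_; _^_; _≤_)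
open import Data.Fin.Permutation using (Permutation′)
open import Data.List.Base using (List; []; _∷_)
open import Data.List.Relation.Unary.Linked using (Linked)
open import Data.Product.Base using (Σ-syntax; ∃-syntax; _×_)

open import Algebra.Properties.CommutativeSemigroup using (interchange)
open import Data.Bool.Base using (Bool; true; false; if_then_else_; T; not; _∧_)
open import Data.Empty using (⊥-elim)
open import Data.Fin using (#_)
open import Data.Fin.Base as Fin using (Fin; zero; suc; toℕ; fromℕ<; inject₁)
open import Data.Fin.Permutation using (_⟨$⟩ʳ_; _≈_; permutation; transpose; insert; remove; insert-remove)
open import Data.Fin.Properties using (toℕ<n; toℕ-fromℕ<; toℕ-injective; fromℕ<-toℕ; toℕ-inject₁; injective⇒≤)
  renaming (_<?_ to _<ᶠ?_; _≟_ to _≟ᶠ_)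
open import Data.List.Base using (_++_; map; reverse; length; lookup; filter; allFin; tabulate)
open import Data.List.Membership.Propositional using (_∈_)
open import Data.List.Membership.Propositional.Properties using (∈-++⁺ˡ; ∈-++⁺ʳ; ∈-map⁺; ∈-allFin; ∈-lookup)
open import Data.List.Properties
  using (reverse-++; unfold-reverse; reverse-involutive; reverse-map; map-∘; map-++; length-map; length-++; length-reverse)
open import Data.List.Relation.Binary.Disjoint.Propositional using (Disjoint)
open import Data.List.Relation.Binary.Permutation.Propositional using (↭-sym; ↭⇒↭ₛ)
open import Data.List.Relation.Binary.Permutation.Propositional.Properties using (↭-reverse; All-resp-↭)
open import Data.List.Relation.Binary.Permutation.Setoid.Properties using (Unique-resp-↭)
open import Data.List.Relation.Binary.Pointwise as Pointwise using (Pointwise; []; _∷_)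
open import Data.List.Relation.Unary.All as All using (All; []; _∷_)
import Data.List.Relation.Unary.All.Properties as All
open import Data.List.Relation.Unary.AllPairs using (AllPairs; []; _∷_)
open import Data.List.Relation.Unary.Any as Any using (Any; here; there)
import Data.List.Relation.Unary.Any.Properties as Any
open import Data.List.Relation.Unary.Linked using ([-]; _∷_)
open import Data.List.Relation.Unary.Unique.Propositional using (Unique)
import Data.List.Relation.Unary.Unique.Propositional.Properties as Unique
open import Data.Nat.Base
open import Data.Nat.DivMod using (m/n≤m; m*n/n≡m)
open import Data.Nat.ListAction using (sum)
open import Data.Nat.Properties
open import Data.Nat.Tactic.RingSolver using (solve-∀)
open import Data.Product.Base using (_,_; proj₁; proj₂)
open import Data.Sum.Base using (_⊎_; inj₁; inj₂)
open import Data.Unit.Base using (⊤; tt)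
open import Data.Vec.Base using (Vec; []; _∷_; head) renaming (sum to sumᵛ; lookup to lookupᵛ)
open import Data.Vec.Properties using (∷-injectiveʳ)
open import Function.Base using (_∘_)
open import Function.Bundles using (_⇔_; mk⇔; Injection; Equivalence)
open import Function.Properties.Inverse using (↔⇒↣)
open import Level using (0ℓ)
open import Relation.Binary.Core using (Rel)
open import Relation.Binary.Definitions using (Symmetric; tri<; tri≈; tri>)
open import Relation.Binary.PropositionalEquality
open import Relation.Nullary using (yes; no; does; Dec; ¬_)
open import Relation.Nullary.Decidable using (dec-true; dec-false)
open import Relation.Unary using (Pred; Decidable)

-- The sublists of neighbouring digits have sums that differ by 1 or 2, so a sublist must be left
-- close to where the next one is entered, and this at every level. Hence each list is an almost
-- closed loop: the digits of one parity upwards and those of the other parity downwards lead back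
-- to a word whose leading digit is one above that of the start. Only at the turn, at the greatest
-- digit, does the digit change by 1, and the sublist there needs another end than the rest; this
-- forces two types of end. If the least digit is 0 and an end of leading digit 2 is wanted, the
-- sublist of the digit 0 is put in front of the loop over the digits from 1 on.
--
-- The number three consists of two unit moves between the two highest digits and one exchange below
-- them, which occurs when the word under these digits changes between full and one unit less than
-- full.
--
-- Lists are also traversed backwards, so every transition is proved in both directions and every
-- recursive procedure that generates words exists twice, with the order of its calls inverted.

<ᵇ-true : ∀ {m n} → m < n → (m <ᵇ n) ≡ true
<ᵇ-true {m} {n} m<n = dec-true (m <? n) m<n

<ᵇ-false : ∀ {m n} → n ≤ m → (m <ᵇ n) ≡ false
<ᵇ-false {m} {n} n≤m = dec-false (m <? n) (≤⇒≯ n≤m)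

≡ᵇ-true : ∀ m → (m ≡ᵇ m) ≡ true
≡ᵇ-true m = dec-true (m ≟ m) refl

≡ᵇ-false : ∀ {m n} → m ≢ n → (m ≡ᵇ n) ≡ false
≡ᵇ-false {m} {n} m≢n = dec-false (m ≟ n) m≢n

-- Rotations of an initial segment (subtraction of `t` modulo `ℓ`) and the encoding by words

rot : ℕ → ℕ → ℕ → ℕ
rot ℓ t q = if q <ᵇ t then q + (ℓ ∸ t) else (if q <ᵇ ℓ then q ∸ t else q)

rot-lo : ∀ t u {q} → q < t → rot (t + u) t q ≡ q + u
rot-lo t u {q} q<t rewrite <ᵇ-true q<t | m+n∸m≡n t u = refl

rot-mid : ∀ t u {q} → q < u → rot (t + u) t (t + q) ≡ q
rot-mid t u {q} q<u
  rewrite <ᵇ-false (m≤m+n t q) | <ᵇ-true (+-monoʳ-< t q<u) = m+n∸m≡n t q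

rot-hi : ∀ {ℓ t q} → t ≤ ℓ → ℓ ≤ q → rot ℓ t q ≡ q
rot-hi t≤ℓ ℓ≤q rewrite <ᵇ-false (≤-trans t≤ℓ ℓ≤q) | <ᵇ-false ℓ≤q = refl

data RotView (t u : ℕ) : ℕ → Set where
  low  : ∀ {q} → q < t → RotView t u q
  middle : ∀ {q} → q < u → RotView t u (t + q)
  high  : ∀ {q} → t + u ≤ q → RotView t u q

rotView : ∀ t u q → RotView t u q
rotView t u q with q <? t
... | yes q<t = low q<t
... | no q≮t with q <? t + u
...   | no q≮t+u = high (≮⇒≥ q≮t+u)
...   | yes q<t+u = subst (RotView t u) (m+[n∸m]≡n t≤q)
                      (middle (+-cancelˡ-< t _ _ (subst (_< t + u) (sym (m+[n∸m]≡n t≤q)) q<t+u)))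
  where t≤q = ≮⇒≥ q≮t

-- Rotations by `t` and by `u` add up to a full turn of the `t + u` points, so the inverse of a
-- rotation is again one.
rot-inverse : ∀ t u q → rot (u + t) u (rot (t + u) t q) ≡ q
rot-inverse t u q with rotView t u q
... | low {q} q<t rewrite rot-lo t u q<t | +-comm q u = rot-mid u t q<t
... | middle {q} q<u rewrite rot-mid t u q<u | rot-lo u t q<u = +-comm q t
... | high t+u≤q rewrite rot-hi (m≤m+n t u) t+u≤q =
  rot-hi (m≤m+n u t) (subst (_≤ q) (+-comm t u) t+u≤q)

unrot-rot : ∀ {ℓ t} q → t ≤ ℓ → rot ℓ (ℓ ∸ t) (rot ℓ t q) ≡ q
unrot-rot {ℓ} {t} q t≤ℓ = subst (λ ℓ′ → rot ℓ′ (ℓ ∸ t) (rot ℓ t q) ≡ q) (m∸n+n≡m t≤ℓ)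
  (subst (λ ℓ′ → rot (ℓ ∸ t + t) (ℓ ∸ t) (rot ℓ′ t q) ≡ q) (m+[n∸m]≡n t≤ℓ) (rot-inverse t (ℓ ∸ t) q))

rot-unrot : ∀ {ℓ t} q → t ≤ ℓ → rot ℓ t (rot ℓ (ℓ ∸ t) q) ≡ q
rot-unrot {ℓ} {t} q t≤ℓ = subst (λ s → rot ℓ s (rot ℓ (ℓ ∸ t) q) ≡ q) (m∸[m∸n]≡n t≤ℓ)
  (unrot-rot q (m∸n≤m ℓ t))

rot-< : ∀ {ℓ t q} → t ≤ ℓ → q < ℓ → rot ℓ t q < ℓ
rot-< {ℓ} {t} {q} t≤ℓ q<ℓ = subst₂ (λ a b → rot a t q < b) ℓ≡ ℓ≡
    (go (rotView t (ℓ ∸ t) q) (subst (q <_) (sym ℓ≡) q<ℓ))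
  where
  ℓ≡ = m+[n∸m]≡n t≤ℓ
  go : ∀ {u q} → RotView t u q → q < t + u → rot (t + u) t q < t + u
  go {u} (low q<t) _ rewrite rot-lo t u q<t = +-monoˡ-< u q<t
  go {u} (middle q<u) _ rewrite rot-mid t u q<u = <-≤-trans q<u (m≤n+m u t)
  go (high t+u≤q) q< = ⊥-elim (<⇒≱ q< t+u≤q)

-- Words t_ℓ … t_1 of digits t_j < j are written from the highest digit down;
-- positions and values of permutations are counted from 0.

Word : ℕ → Set
Word = Vec ℕ

Valid : ∀ {ℓ} → Word ℓ → Set
Valid []              = ⊤
Valid {suc j} (t ∷ v) = t ≤ j × Valid v

decode : ∀ {ℓ} → Word ℓ → ℕ → ℕ
decode []            = λ q → q
decode {ℓ} (t ∷ v) = λ q → rot ℓ t (decode v q)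

-- The inverse function of `decode v`: the rotations are undone from the highest digit down, that of
-- `t` by the complementary one of `ℓ ∸ t`.
encodeInv : ∀ {ℓ} → Word ℓ → ℕ → ℕ
encodeInv []          q = q
encodeInv {ℓ} (t ∷ v) q = encodeInv v (rot ℓ (ℓ ∸ t) q)

decode-fix : ∀ {ℓ q} (v : Word ℓ) → Valid v → ℓ ≤ q → decode v q ≡ q
decode-fix [] _ _ = refl
decode-fix {suc j} {q} (t ∷ v) (t≤j , Vv) ℓ≤q
  rewrite decode-fix v Vv (≤-trans (n≤1+n j) ℓ≤q) = rot-hi (m≤n⇒m≤1+n t≤j) ℓ≤q

decode-< : ∀ {ℓ n q} (v : Word ℓ) → Valid v → ℓ ≤ n → q < n → decode v q < n
decode-< [] _ _ q<n = q<n
decode-< {suc j} {n} {q} (t ∷ v) (t≤j , Vv) ℓ≤n q<n with decode v q <? suc j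
... | yes p = <-≤-trans (rot-< (m≤n⇒m≤1+n t≤j) p) ℓ≤n
... | no ¬p = subst (_< n) (sym (rot-hi (m≤n⇒m≤1+n t≤j) (≮⇒≥ ¬p)))
                (decode-< v Vv (≤-trans (n≤1+n j) ℓ≤n) q<n)

encodeInv-decode : ∀ {ℓ} (v : Word ℓ) → Valid v → ∀ q → encodeInv v (decode v q) ≡ q
encodeInv-decode [] _ q = refl
encodeInv-decode (t ∷ v) (t≤j , Vv) q =
  trans (cong (encodeInv v) (unrot-rot (decode v q) (m≤n⇒m≤1+n t≤j))) (encodeInv-decode v Vv q)

decode-encodeInv : ∀ {ℓ} (v : Word ℓ) → Valid v → ∀ q → decode v (encodeInv v q) ≡ q
decode-encodeInv [] _ q = refl
decode-encodeInv {ℓ} (t ∷ v) (t≤j , Vv) q =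
  trans (cong (rot ℓ t) (decode-encodeInv v Vv (rot ℓ (ℓ ∸ t) q))) (rot-unrot q (m≤n⇒m≤1+n t≤j))

encodeInv-< : ∀ {ℓ q} (v : Word ℓ) → Valid v → q < ℓ → encodeInv v q < ℓ
encodeInv-< {ℓ} {q} v Vv q<ℓ with encodeInv v q <? ℓ
... | yes p = p
... | no ¬p = ⊥-elim (<⇒≱ q<ℓ (subst (ℓ ≤_)
  (trans (sym (decode-fix v Vv (≮⇒≥ ¬p))) (decode-encodeInv v Vv q)) (≮⇒≥ ¬p)))

rot-injective : ∀ {ℓ t q q′} → t ≤ ℓ → rot ℓ t q ≡ rot ℓ t q′ → q ≡ q′
rot-injective {ℓ} {t} t≤ℓ hyp =
  trans (sym (unrot-rot _ t≤ℓ)) (trans (cong (rot ℓ (ℓ ∸ t)) hyp) (unrot-rot _ t≤ℓ))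

rot-last : ∀ {j t} → t ≤ j → rot (suc j) t j ≡ j ∸ t
rot-last {j} {t} t≤j rewrite <ᵇ-false t≤j | <ᵇ-true (n<1+n j) = refl

decode-last : ∀ {j t} (v : Word j) → t ≤ j → Valid v → decode (t ∷ v) j ≡ j ∸ t
decode-last {j} {t} v t≤j Vv rewrite decode-fix v Vv ≤-refl = rot-last t≤j

-- The lower digits fix the last point `j`, so its image `j ∸ t` reveals the leading digit;
-- cancelling the common rotation leaves the claim for the tails.
decode-injective : ∀ {ℓ} (v w : Word ℓ) → Valid v → Valid w →
                   (∀ q → q < ℓ → decode v q ≡ decode w q) → v ≡ w
decode-injective [] [] _ _ _ = refl
decode-injective {suc j} (t ∷ v) (s ∷ w) (t≤j , Vv) (s≤j , Vw) hyp = cong₂ _∷_ t≡s (decode-injective v w Vv Vw tails)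
  where
  t≡s : t ≡ s
  t≡s = ∸-cancelˡ-≡ t≤j s≤j (trans (sym (decode-last v t≤j Vv)) (trans (hyp j ≤-refl) (decode-last w s≤j Vw)))
  tails : ∀ q → q < j → decode v q ≡ decode w q
  tails q q<j = rot-injective (m≤n⇒m≤1+n s≤j)
    (subst (λ r → rot (suc j) r (decode v q) ≡ rot (suc j) s (decode w q)) t≡s (hyp q (m≤n⇒m≤1+n q<j)))

-- The image of the last point `j` forces the leading digit. Once its rotation is undone, the
-- remaining function `g` fixes `j`, so by injectivity it maps the points below `j` to points below
-- `j`, and the recursion applies.
decode-surjective : ∀ ℓ (f : ℕ → ℕ) → (∀ q → q < ℓ → f q < ℓ) →
                    (∀ q q′ → q < ℓ → q′ < ℓ → f q ≡ f q′ → q ≡ q′) →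
                    Σ[ v ∈ Word ℓ ] Valid v × (∀ q → q < ℓ → decode v q ≡ f q)
decode-surjective zero f _ _ = [] , tt , λ _ ()
decode-surjective (suc j) f f< f-inj = t ∷ v , (t≤j , Vv) , agree
  where
  t = j ∸ f j
  t≤j : t ≤ j
  t≤j = m∸n≤m j (f j)
  t≤ℓ = m≤n⇒m≤1+n t≤j
  fj≤j = s≤s⁻¹ (f< j ≤-refl)
  g : ℕ → ℕ
  g q = rot (suc j) (suc j ∸ t) (f q)
  rot-g : ∀ q → rot (suc j) t (g q) ≡ f q
  rot-g q = rot-unrot (f q) t≤ℓ
  rot-j : rot (suc j) t j ≡ f j
  rot-j = trans (rot-last t≤j) (m∸[m∸n]≡n fj≤j)
  g-inj : ∀ q q′ → q < suc j → q′ < suc j → g q ≡ g q′ → q ≡ q′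
  g-inj q q′ q< q′< hyp = f-inj q q′ q< q′< (trans (sym (rot-g q)) (trans (cong (rot (suc j) t) hyp) (rot-g q′)))
  gj : g j ≡ j
  gj = rot-injective t≤ℓ (trans (rot-g j) (sym rot-j))
  g< : ∀ q → q < j → g q < j
  g< q q<j = ≤∧≢⇒< (s≤s⁻¹ (rot-< (m∸n≤m (suc j) t) (f< q (m≤n⇒m≤1+n q<j))))
    λ gq≡j → <⇒≢ q<j (g-inj q j (m≤n⇒m≤1+n q<j) ≤-refl (trans gq≡j (sym gj)))
  rec = decode-surjective j g g< (λ q q′ q< q′< → g-inj q q′ (m≤n⇒m≤1+n q<) (m≤n⇒m≤1+n q′<))
  v = proj₁ rec
  Vv = proj₁ (proj₂ rec)
  agree : ∀ q → q < suc j → decode (t ∷ v) q ≡ f q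
  agree q q<ℓ with m≤n⇒m<n∨m≡n (s≤s⁻¹ q<ℓ)
  ... | inj₁ q<j = trans (cong (rot (suc j) t) (proj₂ (proj₂ rec) q q<j)) (rot-g q)
  ... | inj₂ refl = trans (cong (rot (suc j) t) (decode-fix v Vv ≤-refl)) rot-j

-- Finite sums and their invariance under decoding

Σ< : ℕ → (ℕ → ℕ) → ℕ
Σ< zero    φ = 0
Σ< (suc n) φ = Σ< n φ + φ n

Σ<-cong : ∀ n {φ ψ} → (∀ q → q < n → φ q ≡ ψ q) → Σ< n φ ≡ Σ< n ψ
Σ<-cong zero    hyp = refl
Σ<-cong (suc n) hyp = cong₂ _+_ (Σ<-cong n (λ q q<n → hyp q (m≤n⇒m≤1+n q<n))) (hyp n ≤-refl)

Σ<-+ : ∀ m n φ → Σ< (m + n) φ ≡ Σ< m φ + Σ< n (λ q → φ (m + q))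
Σ<-+ m zero φ rewrite +-identityʳ m = sym (+-identityʳ _)
Σ<-+ m (suc n) φ rewrite +-suc m n | Σ<-+ m n φ = +-assoc (Σ< m φ) _ _

Σ<-head : ∀ n φ → Σ< (suc n) φ ≡ φ 0 + Σ< n (φ ∘ suc)
Σ<-head n φ = Σ<-+ 1 n φ

Σ<-rot : ∀ {ℓ t} φ → t ≤ ℓ → Σ< ℓ (φ ∘ rot ℓ t) ≡ Σ< ℓ φ
Σ<-rot {ℓ} {t} φ t≤ℓ = subst (λ ℓ → Σ< ℓ (φ ∘ rot ℓ t) ≡ Σ< ℓ φ) (m+[n∸m]≡n t≤ℓ) (begin
  Σ< (t + u) (φ ∘ rot (t + u) t)
    ≡⟨ Σ<-+ t u _ ⟩
  Σ< t (φ ∘ rot (t + u) t) + Σ< u (λ q → φ (rot (t + u) t (t + q)))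
    ≡⟨ cong₂ _+_ (Σ<-cong t λ q q<t → cong φ (trans (rot-lo t u q<t) (+-comm q u)))
                 (Σ<-cong u λ q q<u → cong φ (rot-mid t u q<u)) ⟩
  Σ< t (λ q → φ (u + q)) + Σ< u φ
    ≡⟨ +-comm (Σ< t _) _ ⟩
  Σ< u φ + Σ< t (λ q → φ (u + q))
    ≡⟨ Σ<-+ u t φ ⟨
  Σ< (u + t) φ
    ≡⟨ cong (λ ℓ → Σ< ℓ φ) (+-comm u t) ⟩
  Σ< (t + u) φ ∎)
  where
  open ≡-Reasoning
  u = ℓ ∸ t

Σ<-decode : ∀ {ℓ} (v : Word ℓ) φ → Valid v → Σ< ℓ (φ ∘ decode v) ≡ Σ< ℓ φ
Σ<-decode [] φ _ = refl
Σ<-decode {suc j} (t ∷ v) φ (t≤j , Vv) = begin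
  Σ< j (φ ∘ rot (suc j) t ∘ decode v) + φ (rot (suc j) t (decode v j))
    ≡⟨ cong₂ _+_ (Σ<-decode v (φ ∘ rot (suc j) t) Vv) (cong (φ ∘ rot (suc j) t) (decode-fix v Vv ≤-refl)) ⟩
  Σ< (suc j) (φ ∘ rot (suc j) t)
    ≡⟨ Σ<-rot φ (m≤n⇒m≤1+n t≤j) ⟩
  Σ< (suc j) φ ∎
  where
  open ≡-Reasoning

-- The major index

⟦_<_⟧ : ℕ → ℕ → ℕ
⟦ m < n ⟧ = if m <ᵇ n then 1 else 0

⟦<⟧-true : ∀ {m n} → m < n → ⟦ m < n ⟧ ≡ 1
⟦<⟧-true m<n rewrite <ᵇ-true m<n = refl

⟦<⟧-false : ∀ {m n} → n ≤ m → ⟦ m < n ⟧ ≡ 0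
⟦<⟧-false n≤m rewrite <ᵇ-false n≤m = refl

⟦<⟧-+ : ∀ t m n → ⟦ t + m < t + n ⟧ ≡ ⟦ m < n ⟧
⟦<⟧-+ zero    m n = refl
⟦<⟧-+ (suc t) m n = ⟦<⟧-+ t m n

Σ<-⟦<⟧ : ∀ n t → t ≤ n → Σ< n ⟦_< t ⟧ ≡ t
Σ<-⟦<⟧ n t t≤n = subst (λ n → Σ< n ⟦_< t ⟧ ≡ t) (m+[n∸m]≡n t≤n)
  (trans (Σ<-+ t (n ∸ t) _) (trans (cong₂ _+_ (ones t ≤-refl) (zeros (n ∸ t))) (+-identityʳ t)))
  where
  ones : ∀ m → m ≤ t → Σ< m ⟦_< t ⟧ ≡ m
  ones zero _ = refl
  ones (suc m) m<t rewrite ones m (≤-trans (n≤1+n m) m<t) | ⟦<⟧-true m<t = +-comm m 1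
  zeros : ∀ m → Σ< m (λ q → ⟦ t + q < t ⟧) ≡ 0
  zeros zero = refl
  zeros (suc m) rewrite zeros m = ⟦<⟧-false (m≤m+n t m)

majOf : ℕ → (ℕ → ℕ) → ℕ
majOf N f = Σ< N (λ i → suc i * ⟦ f (suc i) < f i ⟧)

-- Going from a to b, the rotation gains a descent exactly if a wraps
-- around and b does not, and loses one in the opposite case.
rot-descent : ∀ {ℓ t a b} → t ≤ ℓ → a < ℓ → b < ℓ →
              ⟦ rot ℓ t b < rot ℓ t a ⟧ + ⟦ b < t ⟧ ≡ ⟦ b < a ⟧ + ⟦ a < t ⟧
rot-descent {ℓ} {t} {a} {b} t≤ℓ a<ℓ b<ℓ =
  subst (λ ℓ → ⟦ rot ℓ t b < rot ℓ t a ⟧ + ⟦ b < t ⟧ ≡ ⟦ b < a ⟧ + ⟦ a < t ⟧) ℓ≡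
    (go (rotView t u a) (rotView t u b) (subst (a <_) (sym ℓ≡) a<ℓ) (subst (b <_) (sym ℓ≡) b<ℓ))
  where
  u = ℓ ∸ t
  ℓ≡ = m+[n∸m]≡n t≤ℓ
  go : ∀ {u a b} → RotView t u a → RotView t u b → a < t + u → b < t + u →
       ⟦ rot (t + u) t b < rot (t + u) t a ⟧ + ⟦ b < t ⟧ ≡ ⟦ b < a ⟧ + ⟦ a < t ⟧
  go (high p) _ a< _ = ⊥-elim (<⇒≱ a< p)
  go _ (high p) _ b< = ⊥-elim (<⇒≱ b< p)
  go {u} {a} {b} (low a<t) (low b<t) _ _
    rewrite rot-lo t u a<t | rot-lo t u b<t | +-comm a u | +-comm b u | ⟦<⟧-+ u b a
          | ⟦<⟧-true a<t | ⟦<⟧-true b<t = refl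
  go {u} {a} (low a<t) (middle {q} q<u) _ _
    rewrite rot-lo t u a<t | rot-mid t u q<u | ⟦<⟧-true (<-≤-trans q<u (m≤n+m u a))
          | ⟦<⟧-true a<t | ⟦<⟧-false {t + q} {t} (m≤m+n t q)
          | ⟦<⟧-false {t + q} {a} (≤-trans (<⇒≤ a<t) (m≤m+n t q)) = refl
  go {u} {_} {b} (middle {q} q<u) (low b<t) _ _
    rewrite rot-lo t u b<t | rot-mid t u q<u | ⟦<⟧-false {b + u} {q} (≤-trans (<⇒≤ q<u) (m≤n+m u b))
          | ⟦<⟧-true b<t | ⟦<⟧-false {t + q} {t} (m≤m+n t q)
          | ⟦<⟧-true {b} {t + q} (<-≤-trans b<t (m≤m+n t q)) = refl
  go {u} (middle {a} a<u) (middle {b} b<u) _ _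
    rewrite rot-mid t u a<u | rot-mid t u b<u | ⟦<⟧-+ t b a
          | ⟦<⟧-false {t + a} {t} (m≤m+n t a) | ⟦<⟧-false {t + b} {t} (m≤m+n t b) = refl

-- Abel summation of rot-descent.
majOf-rot : ∀ {ℓ t} (g : ℕ → ℕ) N → t ≤ ℓ → (∀ q → q ≤ N → g q < ℓ) →
            majOf N (rot ℓ t ∘ g) + N * ⟦ g N < t ⟧ ≡ majOf N g + Σ< N (λ i → ⟦ g i < t ⟧)
majOf-rot g zero _ _ = refl
majOf-rot {ℓ} {t} g (suc N) t≤ℓ g< = begin
  (S′ + suc N * d′) + suc N * e′ ≡⟨ regroup S′ (suc N) d′ e′ ⟩
  S′ + suc N * (d′ + e′)         ≡⟨ cong (λ x → S′ + suc N * x) (rot-descent t≤ℓ (g< N (n≤1+n N)) (g< (suc N) ≤-refl)) ⟩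
  S′ + suc N * (d + e)           ≡⟨ expand S′ N d e ⟩
  (S′ + N * e) + (suc N * d + e) ≡⟨ cong (_+ (suc N * d + e)) (majOf-rot g N t≤ℓ (λ q q≤N → g< q (m≤n⇒m≤1+n q≤N))) ⟩
  (S + E) + (suc N * d + e)      ≡⟨ interchange +-commutativeSemigroup S E (suc N * d) e ⟩
  (S + suc N * d) + (E + e)      ∎
  where
  open ≡-Reasoning
  S′ = majOf N (rot ℓ t ∘ g)
  S = majOf N g
  E = Σ< N (λ i → ⟦ g i < t ⟧)
  d′ = ⟦ rot ℓ t (g (suc N)) < rot ℓ t (g N) ⟧
  d = ⟦ g (suc N) < g N ⟧
  e′ = ⟦ g (suc N) < t ⟧
  e = ⟦ g N < t ⟧
  regroup : ∀ S n d e → (S + n * d) + n * e ≡ S + n * (d + e)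
  regroup = solve-∀
  expand : ∀ S N d e → S + (d + e + N * (d + e)) ≡ (S + N * e) + ((d + N * d) + e)
  expand = solve-∀

-- The correction term of `majOf-rot` vanishes, because the last position holds the value `j`, which
-- is not below `t`. The gain is the number of earlier values below `t`; as these values are all the
-- numbers below `j`, it is exactly `t`.
majOf-decode : ∀ {ℓ} (v : Word ℓ) → Valid v → majOf (ℓ ∸ 1) (decode v) ≡ sumᵛ v
majOf-decode [] _ = refl
majOf-decode {suc j} (t ∷ v) (t≤j , Vv) = begin
  majOf j (rot (suc j) t ∘ g)
    ≡⟨ +-identityʳ _ ⟨
  majOf j (rot (suc j) t ∘ g) + 0
    ≡⟨ cong (majOf j (rot (suc j) t ∘ g) +_) (*-zeroʳ j) ⟨
  majOf j (rot (suc j) t ∘ g) + j * 0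
    ≡⟨ cong (λ x → majOf j (rot (suc j) t ∘ g) + j * x)
         (⟦<⟧-false (subst (t ≤_) (sym (decode-fix v Vv ≤-refl)) t≤j)) ⟨
  majOf j (rot (suc j) t ∘ g) + j * ⟦ g j < t ⟧
    ≡⟨ majOf-rot g j (m≤n⇒m≤1+n t≤j) (λ q q≤j → decode-< v Vv (n≤1+n j) (s≤s q≤j)) ⟩
  majOf j g + Σ< j (λ i → ⟦ g i < t ⟧)
    ≡⟨ cong₂ _+_ (trans (last-ascent v Vv) (majOf-decode v Vv)) (trans (Σ<-decode v ⟦_< t ⟧ Vv) (Σ<-⟦<⟧ j t t≤j)) ⟩
  sumᵛ v + t
    ≡⟨ +-comm (sumᵛ v) t ⟩
  t + sumᵛ v ∎
  where
  open ≡-Reasoning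
  g = decode v
  -- The lower word fixes the point after its segment, so that point is greater than its left
  -- neighbour.
  last-ascent : ∀ {j} (v : Word j) → Valid v → majOf j (decode v) ≡ majOf (j ∸ 1) (decode v)
  last-ascent {zero} _ _ = refl
  last-ascent {suc i} v Vv
    rewrite ⟦<⟧-false {decode v (suc i)} {decode v i}
              (subst (decode v i ≤_) (sym (decode-fix v Vv ≤-refl)) (<⇒≤ (decode-< v Vv ≤-refl ≤-refl)))
          | *-zeroʳ i = +-identityʳ _

sum-filter : ∀ {A : Set} {P : Pred A 0ℓ} (P? : Decidable P) (φ : A → ℕ) xs →
             sum (map φ (filter P? xs)) ≡ sum (map (λ x → φ x * (if does (P? x) then 1 else 0)) xs)
sum-filter P? φ [] = refl
sum-filter P? φ (x ∷ xs) with does (P? x)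
... | true  = cong₂ _+_ (sym (*-identityʳ (φ x))) (sum-filter P? φ xs)
... | false rewrite *-zeroʳ (φ x) = sum-filter P? φ xs

sum-tabulate : ∀ {A : Set} n (h : Fin n → A) (φ : A → ℕ) (ψ : ℕ → ℕ) → (∀ i → φ (h i) ≡ ψ (toℕ i)) →
               sum (map φ (tabulate h)) ≡ Σ< n ψ
sum-tabulate zero h φ ψ hyp = refl
sum-tabulate (suc n) h φ ψ hyp = trans
  (cong₂ _+_ (hyp zero) (sum-tabulate n (h ∘ suc) φ (ψ ∘ suc) (hyp ∘ suc)))
  (sym (Σ<-head n ψ))

Represents : ∀ {n} → Permutation′ n → (ℕ → ℕ) → Set
Represents π f = ∀ i → toℕ (π ⟨$⟩ʳ i) ≡ f (toℕ i)

maj-majOf : ∀ {n} (π : Permutation′ n) f → Represents π f → maj π ≡ majOf (n ∸ 1) f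
maj-majOf {zero} π f _ = refl
maj-majOf {suc n} π f πf = trans
  (sum-filter (λ i → (π ⟨$⟩ʳ suc i) <ᶠ? (π ⟨$⟩ʳ inject₁ i)) (λ i → suc (toℕ i)) (allFin n))
  (sum-tabulate n (λ i → i) _ _ (λ i → cong (suc (toℕ i) *_)
    (cong₂ ⟦_<_⟧ (πf (suc i)) (trans (πf (inject₁ i)) (cong f (toℕ-inject₁ i))))))

module _ {n} (v : Word n) (Vv : Valid v) where

  private
    to : Fin n → Fin n
    to i = fromℕ< (decode-< v Vv ≤-refl (toℕ<n i))

    from : Fin n → Fin n
    from i = fromℕ< (encodeInv-< v Vv (toℕ<n i))

  toPermutation : Permutation′ n
  toPermutation = permutation to from
    (λ i → toℕ-injective (trans (toℕ-fromℕ< _)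
      (trans (cong (decode v) (toℕ-fromℕ< _)) (decode-encodeInv v Vv (toℕ i)))))
    (λ i → toℕ-injective (trans (toℕ-fromℕ< _)
      (trans (cong (encodeInv v) (toℕ-fromℕ< _)) (encodeInv-decode v Vv (toℕ i)))))

  toPermutation-represents : Represents toPermutation (decode v)
  toPermutation-represents i = toℕ-fromℕ< _

  maj-toPermutation : maj toPermutation ≡ sumᵛ v
  maj-toPermutation = trans (maj-majOf toPermutation (decode v) toPermutation-represents) (majOf-decode v Vv)

-- Lowest words and the reflections that they encode

cap : ℕ → ℕ
cap zero    = 0
cap (suc i) = i + cap i

-- The word of sum m that fills the digits from t_1 upwards.
lowest : ∀ ℓ → ℕ → Word ℓ
lowest zero    m = []
lowest (suc i) m = (m ∸ cap i) ∷ lowest i (m ⊓ cap i)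

-- The points p and g of the reflection encoded by the lowest word of sum r, as
-- shown in decode-lowest.
nextTable : ℕ × ℕ → ℕ × ℕ
nextTable (p , zero)  = suc p , p ∸ 1
nextTable (p , suc g) = p , g

table : ℕ → ℕ × ℕ
table zero    = 1 , 0
table (suc r) = nextTable (table r)

tableP tableG : ℕ → ℕ
tableP r = proj₁ (table r)
tableG r = proj₂ (table r)

-- A joint induction along the table. At a capacity the whole segment is one reversed block; the
-- next unit opens the following digit and cuts this block in two, and each further unit lowers the
-- cut `g` by one until it reaches 0 at the next capacity.
table-cap : ∀ i → table (cap (suc i)) ≡ (suc i , 0)
table-above : ∀ i t → t ≤ i → table (suc t + cap (suc i)) ≡ (suc (suc i) , i ∸ t)

table-cap zero    = refl
table-cap (suc i) = trans (table-above i i ≤-refl) (cong (suc (suc i) ,_) (n∸n≡0 i))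

table-above i zero    _   rewrite table-cap i = refl
table-above i (suc t) t<i rewrite table-above i t (<⇒≤ t<i) | +-∸-assoc 1 t<i = refl

-- For g ≤ p, reverses the order of the points below g and that of the points
-- from g to p ∸ 1.
reflect : ℕ → ℕ → ℕ → ℕ
reflect p g q = if q <ᵇ g then g ∸ suc q else (if q <ᵇ p then g + p ∸ suc q else q)

ρ : ℕ → ℕ → ℕ
ρ r = reflect (tableP r) (tableG r)

reflect-below : ∀ {p g q} → q < g → reflect p g q ≡ g ∸ suc q
reflect-below q<g rewrite <ᵇ-true q<g = refl

reflect-mid : ∀ {p g q} → g ≤ q → q < p → reflect p g q ≡ g + p ∸ suc q
reflect-mid g≤q q<p rewrite <ᵇ-false g≤q | <ᵇ-true q<p = refl

reflect-above : ∀ {p g q} → g ≤ q → p ≤ q → reflect p g q ≡ q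
reflect-above g≤q p≤q rewrite <ᵇ-false g≤q | <ᵇ-false p≤q = refl

n∸[1+[n∸[1+m]]] : ∀ {m n} → m < n → n ∸ suc (n ∸ suc m) ≡ m
n∸[1+[n∸[1+m]]] {m} {n} m<n = trans (cong (n ∸_) (sym (+-∸-assoc 1 m<n))) (m∸[m∸n]≡n (<⇒≤ m<n))

reflect-involutive : ∀ p g q → reflect p g (reflect p g q) ≡ q
reflect-involutive p g q with q <? g
... | yes q<g rewrite reflect-below {p} q<g
                    | reflect-below {p} {g} {g ∸ suc q} (∸-monoʳ-< {g} {suc q} {0} z<s q<g) = n∸[1+[n∸[1+m]]] q<g
... | no q≮g with q <? p
...   | no q≮p rewrite reflect-above (≮⇒≥ q≮g) (≮⇒≥ q≮p) = reflect-above (≮⇒≥ q≮g) (≮⇒≥ q≮p)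
...   | yes q<p rewrite reflect-mid (≮⇒≥ q≮g) q<p = trans (reflect-mid ge lt′) (n∸[1+[n∸[1+m]]] (<-≤-trans q<p (m≤n+m p g)))
  where
  ge : g ≤ g + p ∸ suc q
  ge = subst (g ≤_) (sym (+-∸-assoc g q<p)) (m≤m+n g _)
  lt′ : g + p ∸ suc q < p
  lt′ = +-cancelʳ-< (suc q) _ _ (subst (_< p + suc q) (sym (m∸n+n≡m (≤-trans q<p (m≤n+m p g))))
          (subst (g + p <_) (+-comm (suc q) p) (+-monoˡ-< p (s≤s (≮⇒≥ q≮g)))))

-- As `ρ r` is its own inverse, the table also yields the position of a given value, and the machine
-- keeps no inverse permutation.
ρ-involutive : ∀ r q → ρ r (ρ r q) ≡ q
ρ-involutive r = reflect-involutive (tableP r) (tableG r)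

ρ-zero : ∀ q → ρ 0 q ≡ q
ρ-zero zero    = refl
ρ-zero (suc q) = refl

rot-zero : ∀ ℓ q → rot ℓ 0 q ≡ q
rot-zero ℓ q with q <ᵇ ℓ
... | true  = refl
... | false = refl

∸-+-suc : ∀ t g e → e ≤ t → (t ∸ e) + suc g ≡ suc t + g ∸ e
∸-+-suc t g e e≤t = begin
  (t ∸ e) + suc g ≡⟨ +-suc (t ∸ e) g ⟩
  suc (t ∸ e + g) ≡⟨ cong suc (sym (+-∸-comm g e≤t)) ⟩
  suc (t + g ∸ e) ≡⟨ +-∸-assoc 1 (≤-trans e≤t (m≤m+n t g)) ⟨
  suc t + g ∸ e   ∎
  where
  open ≡-Reasoning

-- Under a full reversal the values too small for the subtraction of `suc t` stand at the positions
-- from `g` on. They wrap around and form one decreasing block, which the point `i` joins at its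
-- end; the values before them form the other.
rot-reversal : ∀ t g q → let i = suc t + g in
               rot (suc i) (suc t) (reflect i 0 q) ≡ reflect (suc i) g q
rot-reversal t g q with q <? suc t + g
... | no q≮i with m≤n⇒m<n∨m≡n (≮⇒≥ q≮i)
...   | inj₁ i<q rewrite reflect-above {suc t + g} {0} z≤n (≮⇒≥ q≮i)
                       | reflect-above {suc (suc t + g)} {g} {q} (≤-trans (m≤n+m g (suc t)) (<⇒≤ i<q)) i<q
                       = rot-hi {suc (suc t + g)} (s≤s (m≤n⇒m≤1+n (m≤m+n t g))) i<q
...   | inj₂ refl rewrite reflect-above {suc t + g} {0} z≤n ≤-refl
                        | reflect-mid {suc (suc t + g)} {g} (m≤n+m g (suc t)) ≤-refl
                        | m+n∸n≡m g (suc (suc t + g)) =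
  trans (cong (λ ℓ → rot (suc ℓ) (suc t) (suc t + g)) (sym (+-suc t g))) (rot-mid (suc t) (suc g) ≤-refl)
rot-reversal t g q | yes q<i with q <? g
... | yes q<g rewrite reflect-mid {suc t + g} {0} z≤n q<i | reflect-below {suc (suc t + g)} q<g
                    | +-∸-assoc (suc t) q<g =
  trans (cong (λ ℓ → rot (suc ℓ) (suc t) (suc t + (g ∸ suc q))) (sym (+-suc t g))) (rot-mid (suc t) (suc g) (s≤s (m∸n≤m g (suc q))))
... | no q≮g with m≤n⇒∃[o]m+o≡n (≮⇒≥ q≮g)
...   | e , refl rewrite reflect-mid {suc t + g} {0} z≤n q<i
                       | reflect-mid {suc (suc t + g)} {g} (≮⇒≥ q≮g) (m≤n⇒m≤1+n q<i) = begin
    rot (suc (suc t + g)) (suc t) (t + g ∸ (g + e))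
      ≡⟨ cong₂ (λ ℓ z → rot (suc ℓ) (suc t) z) (sym (+-suc t g)) eq₁ ⟩
    rot (suc t + suc g) (suc t) (t ∸ e)
      ≡⟨ rot-lo (suc t) (suc g) (s≤s (m∸n≤m t e)) ⟩
    t ∸ e + suc g
      ≡⟨ ∸-+-suc t g e e≤t ⟩
    suc t + g ∸ e
      ≡⟨ [m+n]∸[m+o]≡n∸o (suc g) (suc t + g) e ⟨
    suc g + (suc t + g) ∸ suc (g + e)
      ≡⟨ cong (_∸ suc (g + e)) (+-suc g (suc t + g)) ⟨
    g + suc (suc t + g) ∸ suc (g + e) ∎
  where
  open ≡-Reasoning
  eq₁ : t + g ∸ (g + e) ≡ t ∸ e
  eq₁ = trans (cong (_∸ (g + e)) (+-comm t g)) ([m+n]∸[m+o]≡n∸o g t e)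
  e≤t : e ≤ t
  e≤t = s≤s⁻¹ (+-cancelˡ-< g _ _ (subst (g + e <_) (+-comm (suc t) g) q<i))

lowest-above : ∀ i t → lowest (suc i) (t + cap i) ≡ t ∷ lowest i (cap i)
lowest-above i t = cong₂ (λ x y → x ∷ lowest i y) (m+n∸n≡m t (cap i)) (m≥n⇒m⊓n≡n (m≤n+m (cap i) t))

-- If `r` fits below the leading digit, that digit is 0 and its rotation is the identity. Otherwise
-- a positive digit stands above a full word, which by `table-cap` is a reversal of the whole
-- segment, and `rot-reversal` applies.
decode-lowest : ∀ ℓ r q → r ≤ cap ℓ → decode (lowest ℓ r) q ≡ ρ r q
decode-lowest zero zero q _ = sym (ρ-zero q)
decode-lowest (suc i) r q r≤ with r ≤? cap i
... | yes r≤c rewrite m≤n⇒m∸n≡0 r≤c | m≤n⇒m⊓n≡m r≤c = trans (rot-zero (suc i) _) (decode-lowest i r q r≤c)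
... | no r≰c = go i r≤ (m≤n⇒∃[o]m+o≡n (≰⇒> r≰c))
  where
  go : ∀ i → r ≤ i + cap i → (Σ[ t ∈ ℕ ] suc (cap i) + t ≡ r) → decode (lowest (suc i) r) q ≡ ρ r q
  go zero r≤ (t , refl) with () ← r≤
  go (suc i) r≤ (t , refl) = begin
    decode (lowest (suc (suc i)) (suc (cap (suc i) + t))) q
      ≡⟨ cong (λ r → decode (lowest (suc (suc i)) (suc r)) q) (+-comm (cap (suc i)) t) ⟩
    decode (lowest (suc (suc i)) (suc t + cap (suc i))) q
      ≡⟨ cong (λ w → decode w q) (lowest-above (suc i) (suc t)) ⟩
    rot (suc (suc i)) (suc t) (decode (lowest (suc i) (cap (suc i))) q)
      ≡⟨ cong (rot (suc (suc i)) (suc t)) (trans (decode-lowest (suc i) _ q ≤-refl) (cong (λ pg → reflect (proj₁ pg) (proj₂ pg) q) (table-cap i))) ⟩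
    rot (suc (suc i)) (suc t) (reflect (suc i) 0 q)
      ≡⟨ subst (λ i′ → rot (suc (suc i′)) (suc t) (reflect (suc i′) 0 q) ≡ reflect (suc (suc i′)) (i ∸ t) q)
           (m+[n∸m]≡n t≤i) (rot-reversal t (i ∸ t) q) ⟩
    reflect (suc (suc i)) (i ∸ t) q
      ≡⟨ cong (λ pg → reflect (proj₁ pg) (proj₂ pg) q) (table-above i t t≤i) ⟨
    ρ (suc t + cap (suc i)) q
      ≡⟨ cong (λ r → ρ (suc r) q) (+-comm t (cap (suc i))) ⟩
    ρ (suc (cap (suc i) + t)) q ∎
    where
    open ≡-Reasoning
    t≤i : t ≤ i
    t≤i = s≤s⁻¹ (+-cancelʳ-≤ (cap (suc i)) _ _ (subst (_≤ suc i + cap (suc i)) (cong suc (+-comm (cap (suc i)) t)) r≤))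

lowest-valid : ∀ ℓ r → r ≤ cap ℓ → Valid (lowest ℓ r)
lowest-valid zero r _ = tt
lowest-valid (suc i) r r≤ =
  subst (r ∸ cap i ≤_) (m+n∸n≡m i (cap i)) (∸-monoˡ-≤ (cap i) r≤) , lowest-valid i _ (m⊓n≤n r (cap i))

ρ-fix : ∀ {i r q} → r ≤ cap i → i ≤ q → ρ r q ≡ q
ρ-fix {i} {r} {q} r≤ i≤q = trans (sym (decode-lowest i r q r≤)) (decode-fix (lowest i r) (lowest-valid i r r≤) i≤q)

ρ-< : ∀ {i r q} → r ≤ cap i → q < i → ρ r q < i
ρ-< {i} {r} {q} r≤ q<i = subst (_< i) (decode-lowest i r q r≤) (decode-< (lowest i r) (lowest-valid i r r≤) ≤-refl q<i)

-- Unit moves between adjacent digits as transpositions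

swap : ℕ → ℕ → ℕ → ℕ
swap x y q = if q ≡ᵇ x then y else (if q ≡ᵇ y then x else q)

swap-fst : ∀ x y → swap x y x ≡ y
swap-fst x y rewrite ≡ᵇ-true x = refl

swap-snd : ∀ x y → swap x y y ≡ x
swap-snd x y with y ≟ x
... | yes refl rewrite ≡ᵇ-true x = refl
... | no y≢x rewrite ≡ᵇ-false y≢x | ≡ᵇ-true y = refl

swap-other : ∀ {x y q} → q ≢ x → q ≢ y → swap x y q ≡ q
swap-other q≢x q≢y rewrite ≡ᵇ-false q≢x | ≡ᵇ-false q≢y = refl

swap-involutive : ∀ x y q → swap x y (swap x y q) ≡ q
swap-involutive x y q with q ≟ x
... | yes refl rewrite swap-fst q y = swap-snd q y
... | no q≢x with q ≟ y
...   | yes refl rewrite swap-snd x q = swap-fst x q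
...   | no q≢y rewrite swap-other q≢x q≢y = swap-other q≢x q≢y

involutive-swap : ∀ (f : ℕ → ℕ) → (∀ q → f (f q) ≡ q) → ∀ x y q → f (swap (f x) (f y) q) ≡ swap x y (f q)
involutive-swap f ff x y q with q ≟ f x
... | yes refl rewrite swap-fst (f x) (f y) | ff x | ff y = sym (swap-fst x y)
... | no q≢fx with q ≟ f y
...   | yes refl rewrite swap-snd (f x) (f y) | ff x | ff y = sym (swap-snd x y)
...   | no q≢fy rewrite swap-other q≢fx q≢fy = sym (swap-other (λ e → q≢fx (trans (sym (ff q)) (cong f e)))
                                                               (λ e → q≢fy (trans (sym (ff q)) (cong f e))))

rot-suc : ∀ {i t y} → t ≤ i → y ≤ i → rot (suc (suc i)) (suc t) (suc y) ≡ rot (suc (suc i)) t y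
rot-suc {i} {t} {y} t≤i y≤i with y <ᵇ t
... | true = trans (sym (+-suc y (suc i ∸ t))) (cong (y +_) (sym (+-∸-assoc 1 (m≤n⇒m≤1+n t≤i))))
... | false rewrite <ᵇ-true (s≤s y≤i) | <ᵇ-true (m≤n⇒m≤1+n (s≤s y≤i)) = refl

rot-below : ∀ {ℓ t q} → q < t → rot ℓ t q ≡ q + (ℓ ∸ t)
rot-below q<t rewrite <ᵇ-true q<t = refl

rot-above : ∀ {ℓ t q} → t ≤ q → q < ℓ → rot ℓ t q ≡ q ∸ t
rot-above t≤q q<ℓ rewrite <ᵇ-false t≤q | <ᵇ-true q<ℓ = refl

-- For `z` below `suc i` and other than `s`, increasing the inner digit lowers the inner value by
-- exactly one, which makes up for the unit lost by the outer rotation (`rot-suc`). At `s` the inner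
-- value wraps from 0 to `i` instead, and `suc i` is beyond the inner rotation; these two
-- exceptional points trade places.
rot-rot-swap : ∀ {i t s} → t ≤ i → s < i → ∀ z →
               rot (suc (suc i)) (suc t) (rot (suc i) s z) ≡ rot (suc (suc i)) t (rot (suc i) (suc s) (swap (suc i) s z))
rot-rot-swap {i} {t} {s} t≤i s<i z with <-cmp z s
... | tri< zs _ _ rewrite swap-other {suc i} {s} {z} (<⇒≢ (<-trans zs (m≤n⇒m≤1+n s<i))) (<⇒≢ zs)
                         | rot-below {suc i} zs | rot-below {suc i} (m≤n⇒m≤1+n zs) =
  trans (cong (rot (suc (suc i)) (suc t)) (trans (cong (z +_) (+-∸-assoc 1 (<⇒≤ s<i))) (+-suc z (i ∸ s))))
        (rot-suc t≤i (subst (z + (i ∸ s) ≤_) (m+[n∸m]≡n (<⇒≤ s<i)) (+-monoˡ-≤ (i ∸ s) (<⇒≤ zs))))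
... | tri≈ _ refl _ rewrite swap-snd (suc i) s | rot-above {suc i} {s} ≤-refl (m≤n⇒m≤1+n s<i) | n∸n≡0 s
                          | rot-hi {suc i} {suc s} {suc i} (m≤n⇒m≤1+n s<i) ≤-refl = sym (rot-last (m≤n⇒m≤1+n t≤i))
... | tri> _ _ sz with <-cmp z (suc i)
...   | tri< z<1+i _ _ rewrite swap-other {suc i} {s} {z} (<⇒≢ z<1+i) (>⇒≢ sz)
                             | rot-above {suc i} {s} (<⇒≤ sz) z<1+i | rot-above {suc i} {suc s} sz z<1+i =
  trans (cong (rot (suc (suc i)) (suc t)) (+-∸-assoc 1 sz))
        (rot-suc t≤i (≤-trans (m∸n≤m z (suc s)) (s≤s⁻¹ z<1+i)))
...   | tri≈ _ refl _ rewrite swap-fst (suc i) s | rot-hi {suc i} {s} {suc i} (m≤n⇒m≤1+n (<⇒≤ s<i)) ≤-refl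
                            | rot-below {suc i} {suc s} ≤-refl | m+[n∸m]≡n (<⇒≤ s<i) =
  trans (rot-last (s≤s t≤i)) (sym (rot-above t≤i (n≤1+n (suc i))))
...   | tri> _ _ 1+i<z rewrite swap-other {suc i} {s} {z} (>⇒≢ 1+i<z) (>⇒≢ sz)
                             | rot-hi {suc i} {s} {z} (m≤n⇒m≤1+n (<⇒≤ s<i)) (<⇒≤ 1+i<z)
                             | rot-hi {suc i} {suc s} {z} (m≤n⇒m≤1+n s<i) (<⇒≤ 1+i<z)
                             = trans (rot-hi (s≤s (m≤n⇒m≤1+n t≤i)) 1+i<z) (sym (rot-hi (m≤n⇒m≤1+n (m≤n⇒m≤1+n t≤i)) 1+i<z))

-- Moving one unit between adjacent digits exchanges a value with its cyclic
-- predecessor among the values not further right.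
decode-unit : ∀ {i t s r} → t ≤ i → s < i → r ≤ cap i → ∀ q →
              decode (suc t ∷ s ∷ lowest i r) q ≡ decode (t ∷ suc s ∷ lowest i r) (swap (suc i) (ρ r s) q)
decode-unit {i} {t} {s} {r} t≤i s<i r≤ q = begin
  rot (suc (suc i)) (suc t) (rot (suc i) s (decode (lowest i r) q))
    ≡⟨ cong (λ z → rot (suc (suc i)) (suc t) (rot (suc i) s z)) (decode-lowest i r q r≤) ⟩
  rot (suc (suc i)) (suc t) (rot (suc i) s (ρ r q))
    ≡⟨ rot-rot-swap t≤i s<i (ρ r q) ⟩
  rot (suc (suc i)) t (rot (suc i) (suc s) (swap (suc i) s (ρ r q)))
    ≡⟨ cong (λ z → rot (suc (suc i)) t (rot (suc i) (suc s) z)) eq₁ ⟨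
  rot (suc (suc i)) t (rot (suc i) (suc s) (decode (lowest i r) (swap (suc i) (ρ r s) q))) ∎
  where
  open ≡-Reasoning
  eq₁ : decode (lowest i r) (swap (suc i) (ρ r s) q) ≡ swap (suc i) s (ρ r q)
  eq₁ = trans (decode-lowest i r _ r≤) (trans
    (cong (λ x → ρ r (swap x (ρ r s) q)) (sym (ρ-fix {i} {r} r≤ (n≤1+n i))))
    (involutive-swap (ρ r) (ρ-involutive r) (suc i) s q))

-- If r + 1 is the capacity, lowest i r and lowest i (r + 1) differ in the
-- leading digit only.
decode-fill : ∀ {i s r} → 2 ≤ i → suc r ≡ cap i → s < i → ∀ q →
              decode (suc s ∷ lowest i r) q ≡ decode (s ∷ lowest i (suc r)) (swap i 0 q)
decode-fill {suc (suc u)} {s} {r} _ full s<i q = begin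
  decode (suc s ∷ lowest (suc (suc u)) r) q
    ≡⟨ cong (λ w → decode (suc s ∷ w) q) (trans (cong (lowest (suc (suc u))) (cong pred full)) (lowest-above (suc u) u)) ⟩
  decode (suc s ∷ u ∷ lowest (suc u) (cap (suc u))) q
    ≡⟨ decode-unit (s≤s⁻¹ s<i) ≤-refl ≤-refl q ⟩
  decode (s ∷ suc u ∷ lowest (suc u) (cap (suc u))) (swap (suc (suc u)) (ρ (cap (suc u)) u) q)
    ≡⟨ cong (λ y → decode (s ∷ suc u ∷ lowest (suc u) (cap (suc u))) (swap (suc (suc u)) y q)) ρ≡0 ⟩
  decode (s ∷ suc u ∷ lowest (suc u) (cap (suc u))) (swap (suc (suc u)) 0 q)
    ≡⟨ cong (λ w → decode (s ∷ w) (swap (suc (suc u)) 0 q)) (trans (cong (lowest (suc (suc u))) full) (lowest-above (suc u) (suc u))) ⟨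
  decode (s ∷ lowest (suc (suc u)) (suc r)) (swap (suc (suc u)) 0 q) ∎
  where
  open ≡-Reasoning
  -- The full word on `suc u` points is their reversal, which takes the last one, `u`, to 0.
  ρ≡0 : ρ (cap (suc u)) u ≡ 0
  ρ≡0 = trans (cong (λ pg → reflect (proj₁ pg) (proj₂ pg) u) (table-cap u))
              (trans (reflect-mid {suc u} {0} z≤n ≤-refl) (n∸n≡0 u))

-- End words and the transitions between them

-- The minimum as the machine can compute it.
min′ : ℕ → ℕ → ℕ
min′ x y = x ∸ (x ∸ y)

min′-≤ : ∀ {x y} → x ≤ y → min′ x y ≡ x
min′-≤ {x} x≤y = cong (x ∸_) (m≤n⇒m∸n≡0 x≤y)

min′-≥ : ∀ {x y} → y ≤ x → min′ x y ≡ y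
min′-≥ = m∸[m∸n]≡n

min′≡⊓ : ∀ x y → min′ x y ≡ x ⊓ y
min′≡⊓ x y with ≤-total x y
... | inj₁ x≤y = trans (min′-≤ x≤y) (sym (m≤n⇒m⊓n≡m x≤y))
... | inj₂ y≤x = trans (min′-≥ y≤x) (sym (m≥n⇒m⊓n≡n y≤x))

-- The maximum of `min′ σ 1 + l` and `σ`, in operations of the machine. For `σ` = 0, 1, 2 it is `l`,
-- `suc l` and the maximum of `suc l` and 2.
bump : ℕ → ℕ → ℕ
bump l σ = (min′ σ 1 + l) + (σ ∸ (min′ σ 1 + l))

bump-0 : ∀ l → bump l 0 ≡ l
bump-0 l = trans (cong (l +_) (0∸n≡0 l)) (+-identityʳ l)

bump-1 : ∀ l → bump l 1 ≡ suc l
bump-1 l = cong suc (trans (cong (l +_) (0∸n≡0 l)) (+-identityʳ l))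

bump-2 : ∀ l → bump (suc l) 2 ≡ suc (suc l)
bump-2 l = cong (λ x → suc (suc x)) (trans (cong (l +_) (0∸n≡0 l)) (+-identityʳ l))

-- The paths through the words of level i + 1 and sum q start at the lowest
-- word (σ = 0) and end at one of two words near it (σ = 1, 2); top is the
-- leading digit of these words, for c = cap i.
top : ℕ → ℕ → ℕ → ℕ → ℕ
top i c q σ = min′ (bump (q ∸ c) σ) (min′ i q)

top-bump : ∀ {i c q σ b} → bump (q ∸ c) σ ≡ b → b ≤ i → b ≤ q → top i c q σ ≡ b
top-bump {i} {q = q} refl b≤i b≤q = min′-≤ (subst (_ ≤_) (sym (min′≡⊓ i q)) (⊓-glb b≤i b≤q))

top-max : ∀ {i c q σ h} → min′ i q ≡ h → h ≤ bump (q ∸ c) σ → top i c q σ ≡ h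
top-max refl = min′-≥

endWord : ∀ i → ℕ → ℕ → Word (suc i)
endWord i q σ = top i (cap i) q σ ∷ lowest i (q ∸ top i (cap i) q σ)

-- Changes of the two highest digits t , s above the lowest word of sum r.

data Walk (i r : ℕ) : (t s t′ s′ n : ℕ) → Set where
  stop : ∀ {t s} → Walk i r t s t s 0
  -- The bound on `s′` keeps the walk monotone, so that the machine finds its direction by comparing
  -- the current digit with the target.
  down : ∀ {t s t′ s′ n} → t ≤ i → s < i → s′ ≤ s → Walk i r (suc t) s t′ s′ n → Walk i r t (suc s) t′ s′ (suc n)
  up   : ∀ {t s t′ s′ n} → t ≤ i → s < i → suc s ≤ s′ → Walk i r t (suc s) t′ s′ n → Walk i r (suc t) s t′ s′ (suc n)

-- The lower sum may change only between full and one less. `decode-fill` makes this change a single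
-- exchange, placed before the walk if the sum grows and after it if the sum shrinks, so that the
-- walk itself always runs above the full word.
data Transition (i : ℕ) : (t s r t′ s′ r′ : ℕ) → Set where
  walk  : ∀ {t s r t′ s′ n} → r ≤ cap i → Walk i r t s t′ s′ n → n ≤ 2 →
          Transition i t s r t′ s′ r
  fill  : ∀ {t s r t′ s′ n} → 2 ≤ i → suc r ≡ cap i → s < i → Walk i (suc r) t s t′ s′ n → n ≤ 2 →
          Transition i t (suc s) r t′ s′ (suc r)
  spill : ∀ {t s r t′ s′ n} → 2 ≤ i → suc r ≡ cap i → s′ < i → Walk i (suc r) t s t′ s′ n → n ≤ 2 →
          Transition i t s (suc r) t′ (suc s′) r

Both : (i t s r t′ s′ r′ : ℕ) → Set
Both i t s r t′ s′ r′ = Transition i t s r t′ s′ r′ × Transition i t′ s′ r′ t s r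

module _ {i t s r : ℕ} (t≤i : t ≤ i) where

  same₁ : s < i → r ≤ cap i → Both i t (suc s) r (suc t) s r
  same₁ s<i r≤ = walk r≤ (down t≤i s<i ≤-refl stop) (s≤s z≤n)
               , walk r≤ (up t≤i s<i ≤-refl stop) (s≤s z≤n)

  fill₁ : suc s < i → suc r ≡ cap i → Both i t (suc (suc s)) r (suc t) s (suc r)
  fill₁ s<i full = fill (≤-trans (s≤s (s≤s z≤n)) s<i) full s<i (down t≤i (<⇒≤ s<i) ≤-refl stop) (s≤s z≤n)
                 , spill (≤-trans (s≤s (s≤s z≤n)) s<i) full s<i (up t≤i (<⇒≤ s<i) ≤-refl stop) (s≤s z≤n)

  spill₁ : 2 ≤ i → s < i → suc r ≡ cap i → Both i t (suc s) (suc r) (suc t) (suc s) r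
  spill₁ 2≤i s<i full = spill 2≤i full s<i (down t≤i s<i ≤-refl stop) (s≤s z≤n)
                      , fill 2≤i full s<i (up t≤i s<i ≤-refl stop) (s≤s z≤n)

module _ {i t s r : ℕ} (t<i : suc t ≤ i) where

  private t≤i = <⇒≤ t<i

  same₂ : suc s < i → r ≤ cap i → Both i t (suc (suc s)) r (suc (suc t)) s r
  same₂ s<i r≤ = walk r≤ (down t≤i s<i (n≤1+n s) (down t<i (<⇒≤ s<i) ≤-refl stop)) ≤-refl
               , walk r≤ (up t<i (<⇒≤ s<i) (n≤1+n (suc s)) (up t≤i s<i ≤-refl stop)) ≤-refl

  fill₂ : suc (suc s) < i → suc r ≡ cap i → Both i t (suc (suc (suc s))) r (suc (suc t)) s (suc r)
  fill₂ s<i full = fill (≤-trans (s≤s (s≤s z≤n)) s<i) full s<i (down t≤i (<⇒≤ s<i) (n≤1+n s) (down t<i (<⇒≤ (<⇒≤ s<i)) ≤-refl stop)) ≤-refl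
                 , spill (≤-trans (s≤s (s≤s z≤n)) s<i) full s<i (up t<i (<⇒≤ (<⇒≤ s<i)) (n≤1+n (suc s)) (up t≤i (<⇒≤ s<i) ≤-refl stop)) ≤-refl

Link : (i t q σ t′ q′ σ′ : ℕ) → Set
Link i t q σ t′ q′ σ′ =
  let s = top i (cap i) q σ; s′ = top i (cap i) q′ σ′ in Transition i t s (q ∸ s) t′ s′ (q′ ∸ s′)

record Linked₂ (i t q σ t′ q′ σ′ : ℕ) : Set where
  constructor links
  field
    forth : Link i t q σ t′ q′ σ′
    back  : Link i t′ q′ σ′ t q σ

open Linked₂ public

linked : ∀ {i t q σ t′ q′ σ′ s r s′ r′} →
         top i (cap i) q σ ≡ s → q ∸ s ≡ r → top i (cap i) q′ σ′ ≡ s′ → q′ ∸ s′ ≡ r′ →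
         Both i t s r t′ s′ r′ → Linked₂ i t q σ t′ q′ σ′
linked refl refl refl refl (f , b) = links f b

cap>0⇒i≥2 : ∀ {i} → 1 ≤ cap i → 2 ≤ i
cap>0⇒i≥2 {suc (suc i)} _ = s≤s (s≤s z≤n)

i≥2⇒cap>0 : ∀ {i} → 2 ≤ i → 1 ≤ cap i
i≥2⇒cap>0 {suc (suc i)} _ = s≤s z≤n
i≥2⇒cap>0 {suc zero} (s≤s ())

top-0-low : ∀ i {q} → q ≤ cap i → top i (cap i) q 0 ≡ 0
top-0-low i {q} q≤c = top-bump {i} {cap i} {q} {0} (cong (λ l → bump l 0) (m≤n⇒m∸n≡0 q≤c)) z≤n z≤n

top-0-high : ∀ {i} l → l ≤ i → top i (cap i) (l + cap i) 0 ≡ l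
top-0-high {i} l l≤i = top-bump {i} {cap i} {l + cap i} {0} (trans (cong (λ l → bump l 0) (m+n∸n≡m l (cap i))) (bump-0 l)) l≤i (m≤m+n l _)

top-1-low : ∀ i {q} → 1 ≤ i → suc q ≤ cap i → top i (cap i) (suc q) 1 ≡ 1
top-1-low i {q} 1≤i q<c = top-bump {i} {cap i} {suc q} {1} (cong (λ l → bump l 1) (m≤n⇒m∸n≡0 q<c)) 1≤i (s≤s z≤n)

top-1-high : ∀ {i} l → suc l ≤ i → suc l ≤ l + cap i → top i (cap i) (l + cap i) 1 ≡ suc l
top-1-high {i} l l<i l<q = top-bump {i} {cap i} {l + cap i} {1} (trans (cong (λ l → bump l 1) (m+n∸n≡m l (cap i))) (bump-1 l)) l<i l<q

top-2-low : ∀ i {q} → 2 ≤ i → suc q ≤ cap i → top i (cap i) (suc (suc q)) 2 ≡ 2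
top-2-low i {q} 2≤i q<c = top-bump {i} {cap i} {suc (suc q)} {2} (lemma (m≤n⇒m<n∨m≡n q<c)) 2≤i (s≤s (s≤s z≤n))
  where
  lemma : suc q < cap i ⊎ suc q ≡ cap i → bump (suc (suc q) ∸ cap i) 2 ≡ 2
  lemma (inj₁ q+2≤c) = cong (λ l → bump l 2) (m≤n⇒m∸n≡0 q+2≤c)
  lemma (inj₂ q+1≡c) = cong (λ l → bump l 2) (trans (cong (suc (suc q) ∸_) (sym q+1≡c)) (m+n∸n≡m 1 (suc q)))

top-2-high : ∀ {i} l → suc (suc l) ≤ i → suc (suc l) ≤ suc l + cap i → top i (cap i) (suc l + cap i) 2 ≡ suc (suc l)
top-2-high {i} l l<i l<q = top-bump {i} {cap i} {suc l + cap i} {2} (trans (cong (λ l → bump l 2) (m+n∸n≡m (suc l) (cap i))) (bump-2 l)) l<i l<q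

l≤bump : ∀ l σ → l ≤ bump l σ
l≤bump l σ = ≤-trans (m≤n+m l (min′ σ 1)) (m≤m+n _ _)

top-full : ∀ i σ → top i (cap i) (i + cap i) σ ≡ i
top-full i σ = top-max {i} {cap i} {i + cap i} {σ} (min′-≤ (m≤m+n i (cap i)))
  (subst (λ l → i ≤ bump l σ) (sym (m+n∸n≡m i (cap i))) (l≤bump i σ))

data Excess (c q : ℕ) : Set where
  below : suc q ≤ c → Excess c q
  above : ∀ l → q ≡ l + c → Excess c q

excess : ∀ c q → Excess c q
excess c q with suc q ≤? c
... | yes p = below p
... | no ¬p = above (q ∸ c) (sym (m∸n+n≡m (≮⇒≥ ¬p)))

l+1+c∸1+l : ∀ l {c r} → suc r ≡ c → l + c ∸ suc l ≡ r
l+1+c∸1+l l {r = r} refl = trans (cong (_∸ suc l) (+-suc l r)) (m+n∸m≡n l r)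

positive : ∀ {c} → 1 ≤ c → ∃[ r ] suc r ≡ c
positive {suc r} _ = r , refl

-- If `q` is below the capacity, the digits 2 and 0 stand above the same lower word. Otherwise the
-- digit falls by three, of which two units go to `t` and one fills the lower word (`fill₂`), except
-- when the end is cut off at the maximal digit `i`: then both lower words are full and the digit
-- falls by two.
link₂₀ : ∀ i t q → suc t ≤ i → suc (suc q) ≤ cap (suc i) → Linked₂ i t (suc (suc q)) 2 (suc (suc t)) q 0
link₂₀ i t q t<i q≤ with excess (cap i) q
... | below q<c = linked (top-2-low i 2≤i q<c) refl (top-0-low i (<⇒≤ q<c)) refl (same₂ t<i 2≤i (<⇒≤ q<c))
  where 2≤i = cap>0⇒i≥2 (≤-trans (s≤s z≤n) q<c)
... | above l refl with m≤n⇒m<n∨m≡n (+-cancelʳ-≤ (cap i) (suc (suc l)) i q≤)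
...   | inj₂ refl = linked (top-full i 2) (m+n∸m≡n i (cap i)) (top-0-high {i} l (≤-trans (n≤1+n l) (n≤1+n _))) (m+n∸m≡n l (cap i))
                      (same₂ t<i ≤-refl ≤-refl)
...   | inj₁ l<i with positive (i≥2⇒cap>0 {i} (≤-trans (s≤s (s≤s z≤n)) l<i))
...     | r , full = linked (top-2-high {i} (suc l) l<i (subst (λ c → suc (suc (suc l)) ≤ suc (suc l) + c) full (subst (suc (suc (suc l)) ≤_) (sym (+-suc (suc (suc l)) r)) (m≤m+n _ r))))
                       (l+1+c∸1+l (suc (suc l)) full)
                       (top-0-high {i} l (≤-trans (n≤1+n l) (≤-trans (n≤1+n _) (<⇒≤ l<i)))) (trans (m+n∸m≡n l (cap i)) (sym full))
                       (fill₂ t<i l<i full)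

link₁₀ : ∀ i t q → t ≤ i → suc q ≤ cap (suc i) → Linked₂ i t (suc q) 1 (suc t) q 0
link₁₀ i t q t≤i q≤ with excess (cap i) q
... | below q<c = linked (top-1-low i 1≤i q<c) refl (top-0-low i (<⇒≤ q<c)) refl (same₁ t≤i 1≤i (<⇒≤ q<c))
  where 1≤i = <⇒≤ (cap>0⇒i≥2 (≤-trans (s≤s z≤n) q<c))
... | above l refl with m≤n⇒m<n∨m≡n (+-cancelʳ-≤ (cap i) (suc l) i q≤)
...   | inj₂ refl = linked (top-full i 1) (m+n∸m≡n i (cap i)) (top-0-high {i} l (n≤1+n l)) (m+n∸m≡n l (cap i))
                      (same₁ t≤i ≤-refl ≤-refl)
...   | inj₁ l<i with positive (i≥2⇒cap>0 {i} (≤-trans (s≤s (s≤s z≤n)) l<i))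
...     | r , full = linked (top-1-high {i} (suc l) l<i (subst (λ c → suc (suc l) ≤ suc l + c) full (subst (suc (suc l) ≤_) (sym (+-suc (suc l) r)) (m≤m+n _ r))))
                       (l+1+c∸1+l (suc l) full)
                       (top-0-high {i} l (≤-trans (n≤1+n l) (<⇒≤ l<i))) (trans (m+n∸m≡n l (cap i)) (sym full))
                       (fill₁ t≤i l<i full)

top-q≡0 : ∀ i c σ → top i c 0 σ ≡ 0
top-q≡0 i c σ = top-max {i} {c} {0} {σ} (min′-≥ {i} z≤n) z≤n

-- The situation at the turn, where both words are ends. They share their lower word, except when
-- the end of type 2 is cut off at the maximal digit: its lower word is then full and the other one
-- lacks a unit, whence `spill₁`.
link₂₁ : ∀ i t q → t ≤ i → suc q ≤ cap (suc i) → Linked₂ i t (suc q) 2 (suc t) q 1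
link₂₁ zero    t q t≤i ()
link₂₁ (suc i) t zero t≤i q≤ = linked (top-max {suc i} {cap (suc i)} {1} {2} (min′-≥ {suc i} (s≤s z≤n)) (s≤s z≤n)) refl
  (top-q≡0 (suc i) (cap (suc i)) 1) refl (same₁ t≤i (s≤s z≤n) z≤n)
link₂₁ i@(suc _) t (suc q) t≤i q≤ with excess (cap i) q
... | below q<c = linked (top-2-low i 2≤i q<c) refl (top-1-low i (<⇒≤ 2≤i) q<c) refl (same₁ t≤i 2≤i (<⇒≤ q<c))
  where 2≤i = cap>0⇒i≥2 (≤-trans (s≤s z≤n) q<c)
... | above l refl with +-cancelʳ-≤ (cap i) (suc (suc l)) i q≤
...   | 2+l≤i with positive (i≥2⇒cap>0 {i} (≤-trans (s≤s (s≤s z≤n)) 2+l≤i))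
...     | r , full with m≤n⇒m<n∨m≡n 2+l≤i
...       | inj₂ refl = linked (top-full i 2) (trans (m+n∸m≡n i (cap i)) (sym full))
                          (top-1-high {i} (suc l) ≤-refl (subst (λ c → suc (suc l) ≤ suc l + c) full (subst (suc (suc l) ≤_) (sym (+-suc (suc l) r)) (m≤m+n _ r))))
                          (l+1+c∸1+l (suc l) full)
                          (spill₁ t≤i (s≤s (s≤s z≤n)) ≤-refl full)
...       | inj₁ l<i = linked (top-2-high {i} (suc l) l<i (subst (λ c → suc (suc (suc l)) ≤ suc (suc l) + c) full (subst (suc (suc (suc l)) ≤_) (sym (+-suc (suc (suc l)) r)) (m≤m+n _ r))))
                         (l+1+c∸1+l (suc (suc l)) full)
                         (top-1-high {i} (suc l) (<⇒≤ l<i) (subst (λ c → suc (suc l) ≤ suc l + c) full (subst (suc (suc l) ≤_) (sym (+-suc (suc l) r)) (m≤m+n _ r))))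
                         (l+1+c∸1+l (suc l) full)
                         (same₁ t≤i l<i (subst (r ≤_) full (n≤1+n r)))

-- Transitions as sequences of at most three exchanges

data Swaps (n : ℕ) : ℕ → (f g : ℕ → ℕ) → Set where
  done : ∀ {f g} → (∀ q → g q ≡ f q) → Swaps n 0 f g
  step : ∀ {k f f′ g x y} → x < n → y < n → x ≢ y → (∀ q → f′ q ≡ f (swap x y q)) →
         Swaps n k f′ g → Swaps n (suc k) f g

-- Exchanges act on positions, whereas higher digits act on values afterwards; so a transition
-- inside a sublist uses the same exchanges at every higher level.
Swaps-map : ∀ {n k f g} (c : ℕ → ℕ) → Swaps n k f g → Swaps n k (c ∘ f) (c ∘ g)
Swaps-map c (done p) = done (λ q → cong c (p q))
Swaps-map c (step x< y< x≢y p ss) = step x< y< x≢y (λ q → cong c (p q)) (Swaps-map c ss)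

decode-unit′ : ∀ {i t s r} → t ≤ i → s < i → r ≤ cap i → ∀ q →
               decode (t ∷ suc s ∷ lowest i r) q ≡ decode (suc t ∷ s ∷ lowest i r) (swap (suc i) (ρ r s) q)
decode-unit′ {i} {t} {s} {r} t≤i s<i r≤ q = sym (trans (decode-unit t≤i s<i r≤ _)
  (cong (decode (t ∷ suc s ∷ lowest i r)) (swap-involutive (suc i) (ρ r s) q)))

decode-fill′ : ∀ {i s r} → 2 ≤ i → suc r ≡ cap i → s < i → ∀ q →
               decode (s ∷ lowest i (suc r)) q ≡ decode (suc s ∷ lowest i r) (swap i 0 q)
decode-fill′ {i} {s} {r} 2≤i full s<i q = sym (trans (decode-fill 2≤i full s<i _)
  (cong (decode (s ∷ lowest i (suc r))) (swap-involutive i 0 q)))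

module _ {n i : ℕ} (i<n : suc i < n) where

  Walk⇒Swaps : ∀ {r t s t′ s′ m k g} → r ≤ cap i → Walk i r t s t′ s′ m →
               Swaps n k (decode (t′ ∷ s′ ∷ lowest i r)) g →
               Swaps n (m + k) (decode (t ∷ s ∷ lowest i r)) g
  Walk⇒Swaps r≤ stop ss = ss
  Walk⇒Swaps {r} r≤ (down {s = s} t≤i s<i _ w) ss =
    step i<n (<-trans (ρ-< {i} r≤ s<i) (<⇒≤ i<n)) (>⇒≢ (m≤n⇒m≤1+n (ρ-< {i} r≤ s<i))) (decode-unit t≤i s<i r≤) (Walk⇒Swaps r≤ w ss)
  Walk⇒Swaps {r} r≤ (up {s = s} t≤i s<i _ w) ss =
    step i<n (<-trans (ρ-< {i} r≤ s<i) (<⇒≤ i<n)) (>⇒≢ (m≤n⇒m≤1+n (ρ-< {i} r≤ s<i))) (decode-unit′ t≤i s<i r≤) (Walk⇒Swaps r≤ w ss)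

  Transition⇒Swaps : ∀ {t s r t′ s′ r′} → Transition i t s r t′ s′ r′ →
    ∃[ k ] k ≤ 3 × Swaps n k (decode (t ∷ s ∷ lowest i r)) (decode (t′ ∷ s′ ∷ lowest i r′))
  Transition⇒Swaps (walk {n = m} r≤ w m≤2) =
    m + 0 , ≤-trans (≤-reflexive (+-identityʳ m)) (m≤n⇒m≤1+n m≤2) , Walk⇒Swaps r≤ w (done (λ _ → refl))
  Transition⇒Swaps (fill {t = t} {n = m} 2≤i full s<i w m≤2) =
    suc (m + 0) , s≤s (≤-trans (≤-reflexive (+-identityʳ m)) m≤2) ,
    step (<⇒≤ i<n) (≤-trans z<s (<⇒≤ i<n)) (>⇒≢ (<⇒≤ 2≤i)) (λ q → cong (rot (suc (suc i)) t) (decode-fill′ 2≤i full s<i q))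
      (Walk⇒Swaps (≤-reflexive full) w (done (λ _ → refl)))
  Transition⇒Swaps (spill {t′ = t′} {n = m} 2≤i full s<i w m≤2) =
    m + 1 , ≤-trans (≤-reflexive (+-comm m 1)) (s≤s m≤2) ,
    Walk⇒Swaps (≤-reflexive full) w
      (step (<⇒≤ i<n) (≤-trans z<s (<⇒≤ i<n)) (>⇒≢ (<⇒≤ 2≤i)) (λ q → cong (rot (suc (suc i)) t′) (decode-fill 2≤i full s<i q))
        (done (λ _ → refl)))

-- The list of all words of a given sum

data End : ℕ → Set where
  one : End 1
  two : End 2

-- The order `a`, `a + 2`, ..., `a + 3`, `a + 1` is built from the outside, by peeling off the two
-- least digits as the first and the last. The greatest digit `a + b` is the turn, and only its
-- sublist has an end of type 1.
zigzag : ∀ {A : Set} → (ℕ → ℕ → List A) → ℕ → ℕ → List A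
zigzag F a 0             = F a 1
zigzag F a 1             = F a 2 ++ reverse (F (suc a) 1)
zigzag F a (suc (suc b)) = F a 2 ++ zigzag F (suc (suc a)) b ++ reverse (F (suc a) 2)

-- A zigzag ends with the branch of leading digit finalT, at the end word of
-- type finalσ.
finalT finalσ : ℕ → ℕ → ℕ
finalT a zero    = a
finalT a (suc b) = suc a
finalσ a zero    = 1
finalσ a (suc b) = 0

-- A nonzero `d` stands for an end whose leading digit exceeds `suc lo`; this happens only for `lo`
-- equal to 0. The loop then starts at the digit 1, so that it ends at the digit 2.
branches : ∀ {A : Set} → (ℕ → ℕ → List A) → (lo h d : ℕ) → List A
branches F lo h zero    = zigzag F lo (h ∸ lo)
branches F lo h (suc _) = F 0 1 ++ zigzag F 1 (h ∸ 1)

words : ∀ i → ℕ → ℕ → List (Word (suc i))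
words zero    m σ = endWord 0 m 0 ∷ []
words (suc i) m σ =
  if m ≡ᵇ 0 then endWord (suc i) m 0 ∷ [] else
  if m ≡ᵇ cap (suc (suc i)) then endWord (suc i) m 0 ∷ [] else
  branches (λ t τ → map (t ∷_) (words i (m ∸ t) τ))
           (m ∸ cap (suc i)) (min′ (suc i) m) (top (suc i) (cap (suc i)) m σ ∸ suc (m ∸ cap (suc i)))

endWord-0 : ∀ i {q} → q ≤ cap (suc i) → endWord i q 0 ≡ lowest (suc i) q
endWord-0 i {q} q≤ = cong₂ _∷_ top≡ (cong (lowest i) (trans (cong (q ∸_) top≡) (min′≡⊓ q (cap i))))
  where
  top≡ : top i (cap i) q 0 ≡ q ∸ cap i
  top≡ = top-bump {i} {cap i} {q} {0} (bump-0 (q ∸ cap i))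
    (subst (q ∸ cap i ≤_) (m+n∸n≡m i (cap i)) (∸-monoˡ-≤ (cap i) q≤)) (m∸n≤m q (cap i))

endWord-zero : ∀ i σ → endWord i 0 σ ≡ endWord i 0 0
endWord-zero i σ = cong₂ (λ s r → s ∷ lowest i (0 ∸ r)) eq₁ eq₁
  where eq₁ = trans (top-q≡0 i (cap i) σ) (sym (top-q≡0 i (cap i) 0))

endWord-full : ∀ i σ → endWord i (cap (suc i)) σ ≡ endWord i (cap (suc i)) 0
endWord-full i σ = cong₂ (λ s r → s ∷ lowest i (cap (suc i) ∸ r)) eq₁ eq₁
  where eq₁ = trans (top-full i σ) (sym (top-full i 0))

record Inner (i m : ℕ) : Set where
  field
    m>0 : 0 < m
    m<  : m < cap (suc (suc i))

  j c lo h : ℕ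
  j = suc i
  c = cap (suc i)
  lo = m ∸ c
  h = min′ j m

  1≤i : 1 ≤ i
  1≤i = lemma i m>0 m<
    where
    lemma : ∀ i → 0 < m → m < cap (suc (suc i)) → 1 ≤ i
    lemma zero    p q = ⊥-elim (<⇒≱ p (s≤s⁻¹ q))
    lemma (suc i) _ _ = s≤s z≤n

  c>0 : 0 < c
  c>0 = i≥2⇒cap>0 (s≤s 1≤i)

  lo<j : lo < j
  lo<j with m ≤? c
  ... | yes m≤c rewrite m≤n⇒m∸n≡0 m≤c = s≤s z≤n
  ... | no m≰c = +-cancelʳ-< c lo j (subst (_< j + c) (sym (m∸n+n≡m (≰⇒≥ m≰c))) m<)

  lo<m : lo < m
  lo<m with c ≤? m
  ... | yes c≤m = ∸-monoʳ-< {m} {c} {0} c>0 c≤m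
  ... | no c≰m rewrite m≤n⇒m∸n≡0 (<⇒≤ (≰⇒> c≰m)) = m>0

  -- Strictness is what gives an inner node two children: `lo` and `h` are the least and the
  -- greatest leading digit of a word of sum `m`.
  lo<h : lo < h
  lo<h = subst (lo <_) (sym (min′≡⊓ j m)) (⊓-glb lo<j lo<m)

  h≤j : h ≤ j
  h≤j = subst (_≤ j) (sym (min′≡⊓ j m)) (m⊓n≤m j m)

  h≤m : h ≤ m
  h≤m = subst (_≤ m) (sym (min′≡⊓ j m)) (m⊓n≤n j m)

  m∸t≤c : ∀ {t} → lo ≤ t → m ∸ t ≤ c
  m∸t≤c {t} lo≤t = m≤n+o⇒m∸n≤o m t (≤-trans (m≤n+m∸n m c)
    (≤-trans (+-monoʳ-≤ c lo≤t) (≤-reflexive (+-comm c t))))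

  hop₂₀ : ∀ {t} → lo ≤ t → suc (suc t) ≤ h → Linked₂ i t (m ∸ t) 2 (suc (suc t)) (m ∸ suc (suc t)) 0
  hop₂₀ {t} lo≤t t≤h = subst (λ q → Linked₂ i t q 2 (suc (suc t)) (m ∸ suc (suc t)) 0) (sym eq₁)
    (link₂₀ i t _ (s≤s⁻¹ (≤-trans t≤h h≤j)) (subst (_≤ c) eq₁ (m∸t≤c lo≤t)))
    where eq₁ = +-∸-assoc 2 (≤-trans t≤h h≤m)

  hop₂₁ : ∀ {t} → lo ≤ t → suc t ≤ h → Linked₂ i t (m ∸ t) 2 (suc t) (m ∸ suc t) 1
  hop₂₁ {t} lo≤t t≤h = subst (λ q → Linked₂ i t q 2 (suc t) (m ∸ suc t) 1) (sym eq₁)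
    (link₂₁ i t _ (s≤s⁻¹ (≤-trans t≤h h≤j)) (subst (_≤ c) eq₁ (m∸t≤c lo≤t)))
    where eq₁ = +-∸-assoc 1 (≤-trans t≤h h≤m)

  hop₁₀ : ∀ {t} → lo ≤ t → suc t ≤ h → Linked₂ i t (m ∸ t) 1 (suc t) (m ∸ suc t) 0
  hop₁₀ {t} lo≤t t≤h = subst (λ q → Linked₂ i t q 1 (suc t) (m ∸ suc t) 0) (sym eq₁)
    (link₁₀ i t _ (s≤s⁻¹ (≤-trans t≤h h≤j)) (subst (_≤ c) eq₁ (m∸t≤c lo≤t)))
    where eq₁ = +-∸-assoc 1 (≤-trans t≤h h≤m)

  -- The way back into the sublist of `suc a`. For `b` equal to 0 the inner zigzag is just the turn
  -- and stops at an end of type 1; otherwise it stops at the lowest word of the digit `a + 3`. The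
  -- link is stated from the smaller digit to the larger one.
  hopFinal : ∀ {a} b → lo ≤ a → suc (suc a) + b ≡ h →
             Linked₂ i (suc a) (m ∸ suc a) 2 (finalT (suc (suc a)) b) (m ∸ finalT (suc (suc a)) b) (finalσ (suc (suc a)) b)
  hopFinal {a} zero    lo≤a sum≡h = hop₂₁ (m≤n⇒m≤1+n lo≤a) (≤-reflexive (trans (sym (+-identityʳ _)) sum≡h))
  hopFinal {a} (suc b) lo≤a sum≡h = hop₂₀ (m≤n⇒m≤1+n lo≤a)
    (subst (suc (suc (suc a)) ≤_) (trans (sym (+-suc (suc (suc a)) b)) sum≡h) (m≤m+n _ b))

  top-0 : top j c m 0 ≡ lo
  top-0 = top-bump {j} {c} {m} {0} (bump-0 lo) (<⇒≤ lo<j) (<⇒≤ lo<m)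

  -- Type 2 asks for a digit of at least 2, which differs from `suc lo` only if `lo` is 0. If
  -- moreover no word has leading digit 2, the cut-off at `h` brings it back to 1.
  shape : ∀ {σ} → End σ → top j c m σ ≡ suc lo ⊎ (lo ≡ 0 × top j c m σ ≡ 2 × 2 ≤ h)
  shape one = inj₁ (trans (cong (λ b → min′ b h) (bump-1 lo)) (min′-≤ lo<h))
  shape two with lo in lo≡ | lo<h
  ... | suc l | l<h = inj₁ (trans (cong (λ b → min′ b h) (bump-2 l)) (min′-≤ l<h))
  ... | zero | 0<h with 2 ≤? h
  ...   | yes 2≤h = inj₂ (refl , min′-≤ 2≤h , 2≤h)
  ...   | no 2≰h = inj₁ (trans (min′-≥ (≰⇒≥ 2≰h)) (≤-antisym (s≤s⁻¹ (≰⇒> 2≰h)) 0<h))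

data Kind (i m : ℕ) : Set where
  empty : m ≡ 0 → Kind i m
  filled : m ≡ cap (suc (suc i)) → Kind i m
  inner : Inner i m → Kind i m

kind : ∀ i {m} → m ≤ cap (suc (suc i)) → Kind i m
kind i {zero} _ = empty refl
kind i {suc m} m≤ with m≤n⇒m<n∨m≡n m≤
... | inj₁ m< = inner (record { m>0 = z<s ; m< = m< })
... | inj₂ m≡ = filled m≡

child : ∀ i m t σ → List (Word (suc (suc i)))
child i m t σ = map (t ∷_) (words i (m ∸ t) σ)

words-empty : ∀ i σ → words i 0 σ ≡ endWord i 0 0 ∷ []
words-empty zero    σ = refl
words-empty (suc i) σ = refl

words-full : ∀ i σ → words i (cap (suc i)) σ ≡ endWord i (cap (suc i)) 0 ∷ []
words-full zero    σ = refl
words-full (suc i) σ rewrite ≡ᵇ-true (cap (suc (suc i))) = refl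

module _ {i m} (x : Inner i m) where

  open Inner x

  words-inner : ∀ σ → words (suc i) m σ ≡ branches (child i m) lo h (top j c m σ ∸ suc lo)
  words-inner σ rewrite ≡ᵇ-false (>⇒≢ m>0) | ≡ᵇ-false (<⇒≢ m<) = refl

  data Branches (σ : ℕ) (ws : List (Word (suc (suc i)))) : Set where
    plain : top j c m σ ≡ suc lo → ws ≡ zigzag (child i m) lo (h ∸ lo) → Branches σ ws
    extra : lo ≡ 0 → top j c m σ ≡ 2 → 2 ≤ h → ws ≡ child i m 0 1 ++ zigzag (child i m) 1 (h ∸ 1) → Branches σ ws

  words-branches : ∀ {σ} → End σ → Branches σ (words (suc i) m σ)
  words-branches {σ} e with shape e
  ... | inj₁ top≡ = plain top≡ (trans (words-inner σ)
    (cong (branches (child i m) lo h) (trans (cong (_∸ suc lo) top≡) (n∸n≡0 (suc lo)))))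
  ... | inj₂ (lo≡0 , top≡ , 2≤h) = extra lo≡0 top≡ 2≤h (trans (words-inner σ)
    (cong (branches (child i m) lo h) (cong₂ (λ s l → s ∸ suc l) top≡ lo≡0)))

-- Paths of close words

data Path {A : Set} (R : Rel A 0ℓ) : A → A → List A → Set where
  [-] : ∀ {x} → Path R x x (x ∷ [])
  _∷_ : ∀ {x y z xs} → R x y → Path R y z xs → Path R x z (x ∷ xs)

module _ {A : Set} {R : Rel A 0ℓ} where

  join : ∀ {x y z u xs ys} → Path R x y xs → R y z → Path R z u ys → Path R x u (xs ++ ys)
  join [-]     r q = r ∷ q
  join (s ∷ p) r q = s ∷ join p r q

  reversePath : Symmetric R → ∀ {x y xs} → Path R x y xs → Path R y x (reverse xs)
  reversePath R-sym [-] = [-]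
  reversePath R-sym {x} (_∷_ {xs = xs} r p) = subst (Path R _ x) (sym (unfold-reverse x xs))
    (join (reversePath R-sym p) (R-sym r) [-])

mapPath : ∀ {A B : Set} {R : Rel A 0ℓ} {S : Rel B 0ℓ} {f : A → B} → (∀ {x y} → R x y → S (f x) (f y)) →
          ∀ {x y xs} → Path R x y xs → Path S (f x) (f y) (map f xs)
mapPath g [-]     = [-]
mapPath g (r ∷ p) = g r ∷ mapPath g p

module _ (n : ℕ) where

  Near : (f g : ℕ → ℕ) → Set
  Near f g = ∃[ k ] k ≤ 3 × Swaps n k f g

  -- With both directions in the relation it is symmetric, and reversing a sublist keeps its
  -- neighbours close.
  record Close {ℓ} (v w : Word ℓ) : Set where
    constructor close
    field
      forwards  : Near (decode v) (decode w)
      backwards : Near (decode w) (decode v)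

  Close-∷ : ∀ {ℓ} t {v w : Word ℓ} → Close v w → Close (t ∷ v) (t ∷ w)
  Close-∷ {ℓ} t (close (k , k≤3 , ss) (k′ , k′≤3 , ss′)) =
    close (k , k≤3 , Swaps-map (rot (suc ℓ) t) ss) (k′ , k′≤3 , Swaps-map (rot (suc ℓ) t) ss′)

  Close-sym : ∀ {ℓ} → Symmetric (Close {ℓ})
  Close-sym (close r s) = close s r

  Linked₂⇒Close : ∀ {i t q σ t′ q′ σ′} → suc (suc i) ≤ n → Linked₂ i t q σ t′ q′ σ′ →
                  Close (t ∷ endWord i q σ) (t′ ∷ endWord i q′ σ′)
  Linked₂⇒Close i<n l = close (Transition⇒Swaps i<n (forth l)) (Transition⇒Swaps i<n (back l))

  module _ {i m} (x : Inner i m) (i<n : suc (suc i) ≤ n) where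
    open Inner x

    point : ℕ → ℕ → Word (suc (suc i))
    point t σ = t ∷ endWord i (m ∸ t) σ

    -- This closes the recursion: an end word of this level is the lowest word of one of its own
    -- branches, which is where a zigzag over at least two digits stops.
    endWord-point : ∀ σ {s} → lo ≤ s → top j c m σ ≡ s → endWord (suc i) m σ ≡ point s 0
    endWord-point σ {s} lo≤s top≡ = trans (cong (λ s → s ∷ lowest (suc i) (m ∸ s)) top≡)
      (cong (s ∷_) (sym (endWord-0 i (m∸t≤c lo≤s))))

    module _ (child-path : ∀ {t σ} → End σ → lo ≤ t → t ≤ h → Path Close (point t 0) (point t σ) (child i m t σ)) where

      zigzag-path : ∀ a b → lo ≤ a → a + b ≡ h →
                    Path Close (point a 0) (point (finalT a b) (finalσ a b)) (zigzag (child i m) a b)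
      zigzag-path a zero lo≤a a≡h = child-path one lo≤a (≤-reflexive (trans (sym (+-identityʳ a)) a≡h))
      zigzag-path a (suc zero) lo≤a a+1≡h = join (child-path two lo≤a (<⇒≤ a<h)) (Linked₂⇒Close i<n (hop₂₁ lo≤a a<h))
        (reversePath Close-sym (child-path one (m≤n⇒m≤1+n lo≤a) a<h))
        where
        a<h : suc a ≤ h
        a<h = ≤-reflexive (trans (+-comm 1 a) a+1≡h)
      zigzag-path a (suc (suc b)) lo≤a sum≡h =
        join (child-path two lo≤a (<⇒≤ (<⇒≤ a<h))) (Linked₂⇒Close i<n (hop₂₀ lo≤a a<h))
          (join (zigzag-path (suc (suc a)) b (m≤n⇒m≤1+n (m≤n⇒m≤1+n lo≤a)) sum≡h′)
            (Close-sym (Linked₂⇒Close i<n (hopFinal b lo≤a sum≡h′)))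
            (reversePath Close-sym (child-path two (m≤n⇒m≤1+n lo≤a) (<⇒≤ a<h))))
        where
        sum≡h′ : suc (suc a) + b ≡ h
        sum≡h′ = trans (sym (trans (+-suc a (suc b)) (cong suc (+-suc a b)))) sum≡h
        a<h : suc (suc a) ≤ h
        a<h = subst (suc (suc a) ≤_) sum≡h′ (m≤m+n _ b)

  words-path : ∀ i {m σ} → suc i ≤ n → End σ → m ≤ cap (suc i) →
               Path Close (endWord i m 0) (endWord i m σ) (words i m σ)
  words-path zero {zero} {σ} _ _ _ = subst (λ w → Path Close (endWord 0 0 0) w (words 0 0 σ)) (sym (endWord-zero 0 σ)) [-]
  words-path (suc i) {m} {σ} i<n e m≤ with kind i m≤
  ... | empty refl = subst₂ (Path Close (endWord (suc i) 0 0)) (sym (endWord-zero (suc i) σ)) (sym (words-empty (suc i) σ)) [-]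
  ... | filled refl = subst₂ (Path Close (endWord (suc i) m 0)) (sym (endWord-full (suc i) σ)) (sym (words-full (suc i) σ)) [-]
  ... | inner x with words-branches x e
  ...   | plain top≡ ws≡ = subst₂ (Path Close (endWord (suc i) m 0)) (sym (endWord-point x i<n σ (n≤1+n lo) top≡)) (sym ws≡)
      (subst₂ (λ v w → Path Close v w (zigzag (child i m) lo (h ∸ lo)))
        (sym (endWord-point x i<n 0 ≤-refl top-0))
        (lemma (h ∸ lo) (m<n⇒0<n∸m lo<h))
        (zigzag-path x i<n child-path lo (h ∸ lo) ≤-refl (m+[n∸m]≡n (<⇒≤ lo<h))))
    where
    open Inner x
    child-path : ∀ {t σ} → End σ → lo ≤ t → t ≤ h → Path Close (point x i<n t 0) (point x i<n t σ) (child i m t σ)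
    child-path {t} e lo≤t _ = mapPath (Close-∷ t) (words-path i (<⇒≤ i<n) e (m∸t≤c lo≤t))
    lemma : ∀ b → 0 < b → point x i<n (finalT lo b) (finalσ lo b) ≡ point x i<n (suc lo) 0
    lemma (suc b) _ = refl
  ...   | extra lo≡0 top≡ 2≤h ws≡ = subst₂ (Path Close (endWord (suc i) m 0)) (sym (endWord-point x i<n σ (subst (_≤ 2) (sym lo≡0) z≤n) top≡)) (sym ws≡)
      (subst₂ (λ v w → Path Close v w (child i m 0 1 ++ zigzag (child i m) 1 (h ∸ 1)))
        (sym (endWord-point x i<n 0 (≤-reflexive lo≡0) (trans top-0 lo≡0)))
        (lemma (h ∸ 1) (m<n⇒0<n∸m 2≤h))
        (join (child-path one (≤-reflexive lo≡0) z≤n)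
          (Linked₂⇒Close i<n (hop₁₀ (≤-reflexive lo≡0) (<⇒≤ 2≤h)))
          (zigzag-path x i<n child-path 1 (h ∸ 1) (subst (_≤ 1) (sym lo≡0) z≤n) (m+[n∸m]≡n (<⇒≤ 2≤h)))))
    where
    open Inner x
    child-path : ∀ {t σ} → End σ → lo ≤ t → t ≤ h → Path Close (point x i<n t 0) (point x i<n t σ) (child i m t σ)
    child-path {t} e lo≤t _ = mapPath (Close-∷ t) (words-path i (<⇒≤ i<n) e (m∸t≤c lo≤t))
    lemma : ∀ b → 0 < b → point x i<n (finalT 1 b) (finalσ 1 b) ≡ point x i<n 2 0
    lemma (suc b) _ = refl

-- Every word of the given sum occurs exactly once

sum≤cap : ∀ {ℓ} (v : Word ℓ) → Valid v → sumᵛ v ≤ cap ℓ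
sum≤cap [] _ = z≤n
sum≤cap (t ∷ v) (t≤j , Vv) = +-mono-≤ t≤j (sum≤cap v Vv)

sum-lowest : ∀ ℓ r → r ≤ cap ℓ → sumᵛ (lowest ℓ r) ≡ r
sum-lowest zero zero _ = refl
sum-lowest (suc i) r _ rewrite sum-lowest i (r ⊓ cap i) (m⊓n≤n r (cap i)) | ⊓-comm r (cap i) =
  trans (+-comm (r ∸ cap i) _) (m⊓n+n∸m≡n (cap i) r)

sum≡0⇒lowest : ∀ {ℓ} (v : Word ℓ) → Valid v → sumᵛ v ≡ 0 → v ≡ lowest ℓ 0
sum≡0⇒lowest [] _ _ = refl
sum≡0⇒lowest {suc j} (t ∷ v) (_ , Vv) s≡0 =
  cong₂ _∷_ (trans (m+n≡0⇒m≡0 t s≡0) (sym (0∸n≡0 (cap j)))) (sum≡0⇒lowest v Vv (m+n≡0⇒n≡0 t s≡0))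

sum≡cap⇒lowest : ∀ {ℓ} (v : Word ℓ) → Valid v → sumᵛ v ≡ cap ℓ → v ≡ lowest ℓ (cap ℓ)
sum≡cap⇒lowest [] _ _ = refl
sum≡cap⇒lowest {suc j} (t ∷ v) (t≤j , Vv) s≡c = trans (cong₂ _∷_ t≡j (sum≡cap⇒lowest v Vv s′≡c)) (sym (lowest-above j j))
  where
  t≡j : t ≡ j
  t≡j = ≤-antisym t≤j (+-cancelʳ-≤ (cap j) j t (≤-trans (≤-reflexive (sym s≡c)) (+-monoʳ-≤ t (sum≤cap v Vv))))
  s′≡c : sumᵛ v ≡ cap j
  s′≡c = +-cancelˡ-≡ j _ _ (trans (cong (_+ sumᵛ v) (sym t≡j)) s≡c)

module _ {A : Set} {F : ℕ → ℕ → List A} where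

  zigzag-All : ∀ {P : Pred A 0ℓ} a b → (∀ {t σ} → End σ → a ≤ t → t ≤ a + b → All P (F t σ)) → All P (zigzag F a b)
  zigzag-All a zero p = p one ≤-refl (m≤m+n a 0)
  zigzag-All a (suc zero) p =
    All.++⁺ (p two ≤-refl (m≤m+n a 1))
            (All-resp-↭ (↭-sym (↭-reverse _)) (p one (n≤1+n a) (≤-reflexive (+-comm 1 a))))
  zigzag-All a (suc (suc b)) p =
    All.++⁺ (p two ≤-refl (m≤m+n a _)) (All.++⁺
      (zigzag-All (suc (suc a)) b λ e l u → p e (≤-trans (n≤1+n a) (≤-trans (n≤1+n _) l)) (≤-trans u (≤-reflexive shift)))
      (All-resp-↭ (↭-sym (↭-reverse _)) (p two (n≤1+n a) (≤-trans (≤-trans (n≤1+n _) (m≤m+n _ b)) (≤-reflexive shift)))))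
    where
    shift : suc (suc a) + b ≡ a + suc (suc b)
    shift = sym (trans (+-suc a (suc b)) (cong suc (+-suc a b)))

  zigzag-∈ : ∀ {x} a b {t} → a ≤ t → t ≤ a + b → (∀ {σ} → End σ → x ∈ F t σ) → x ∈ zigzag F a b
  zigzag-∈ {x} a zero {t} a≤t t≤ p = subst (λ t → x ∈ F t 1) (≤-antisym (subst (t ≤_) (+-identityʳ a) t≤) a≤t) (p one)
  zigzag-∈ {x} a (suc zero) {t} a≤t t≤ p with m≤n⇒m<n∨m≡n a≤t
  ... | inj₂ refl = ∈-++⁺ˡ (p two)
  ... | inj₁ a<t = ∈-++⁺ʳ (F a 2) (Any.reverse⁺
    (subst (λ t → x ∈ F t 1) (≤-antisym (subst (t ≤_) (+-comm a 1) t≤) a<t) (p one)))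
  zigzag-∈ {x} a (suc (suc b)) {t} a≤t t≤ p with m≤n⇒m<n∨m≡n a≤t
  ... | inj₂ refl = ∈-++⁺ˡ (p two)
  ... | inj₁ a<t with m≤n⇒m<n∨m≡n a<t
  ...   | inj₂ refl = ∈-++⁺ʳ (F a 2) (∈-++⁺ʳ (zigzag F (suc (suc a)) b) (Any.reverse⁺ (p two)))
  ...   | inj₁ a+1<t = ∈-++⁺ʳ (F a 2) (∈-++⁺ˡ (zigzag-∈ (suc (suc a)) b a+1<t
    (≤-trans t≤ (≤-reflexive (trans (+-suc a (suc b)) (cong suc (+-suc a b))))) p))

  module _ (index : A → ℕ) where

    disjoint : ∀ {xs ys k} → All (λ x → index x ≤ k) xs → All (λ x → k < index x) ys → Disjoint xs ys
    disjoint ≤k k< (x∈xs , x∈ys) = <⇒≱ (All.lookup k< x∈ys) (All.lookup ≤k x∈xs)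

    unique-reverse : ∀ {xs : List A} → Unique xs → Unique (reverse xs)
    unique-reverse = Unique-resp-↭ (setoid A) (↭⇒↭ₛ (↭-sym (↭-reverse _)))

    module _ (F-index : ∀ t σ → All (λ x → index x ≡ t) (F t σ)) where

      F-≤ : ∀ {t k} σ → t ≤ k → All (λ x → index x ≤ k) (F t σ)
      F-≤ {t} σ t≤k = All.map (λ i≡t → ≤-trans (≤-reflexive i≡t) t≤k) (F-index t σ)

      F-≥ : ∀ {t k} σ → k ≤ t → All (λ x → k ≤ index x) (F t σ)
      F-≥ {t} σ k≤t = All.map (λ i≡t → ≤-trans k≤t (≤-reflexive (sym i≡t))) (F-index t σ)

      zigzag-≥ : ∀ a b → All (λ x → a ≤ index x) (zigzag F a b)
      zigzag-≥ a b = zigzag-All a b (λ {t} {σ} _ a≤t _ → F-≥ σ a≤t)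

      -- The sublists are separated by `index`, later taken to be the leading digit: it is `a` on
      -- the first one, `suc a` on the last one and greater on everything between.
      zigzag-unique : ∀ a b → (∀ {t σ} → End σ → a ≤ t → t ≤ a + b → Unique (F t σ)) → Unique (zigzag F a b)
      zigzag-unique a zero u = u one ≤-refl (m≤m+n a 0)
      zigzag-unique a (suc zero) u = Unique.++⁺
        (u two ≤-refl (m≤m+n a 1)) (unique-reverse (u one (n≤1+n a) (≤-reflexive (+-comm 1 a))))
        (disjoint (F-≤ 2 ≤-refl) (All-resp-↭ (↭-sym (↭-reverse _)) (F-≥ 1 ≤-refl)))
      zigzag-unique a (suc (suc b)) u = Unique.++⁺ (u two ≤-refl (m≤m+n a _))
        (Unique.++⁺
          (zigzag-unique (suc (suc a)) b λ e l h → u e (≤-trans (n≤1+n a) (≤-trans (n≤1+n _) l)) (≤-trans h (≤-reflexive shift)))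
          (unique-reverse (u two (n≤1+n a) (≤-trans (≤-trans (n≤1+n _) (m≤m+n _ b)) (≤-reflexive shift))))
          λ (p , q) → disjoint (All-resp-↭ (↭-sym (↭-reverse _)) (F-≤ 2 ≤-refl)) (zigzag-≥ (suc (suc a)) b) (q , p))
        (disjoint (F-≤ 2 ≤-refl) (All.++⁺
          (All.map (≤-trans (n≤1+n _)) (zigzag-≥ (suc (suc a)) b))
          (All-resp-↭ (↭-sym (↭-reverse _)) (F-≥ 2 ≤-refl))))
        where
        shift : suc (suc a) + b ≡ a + suc (suc b)
        shift = sym (trans (+-suc a (suc b)) (cong suc (+-suc a b)))

IsWord : ∀ {ℓ} → ℕ → Word ℓ → Set
IsWord m v = Valid v × sumᵛ v ≡ m

endWord-isWord : ∀ i {m} → m ≤ cap (suc i) → IsWord m (endWord i m 0)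
endWord-isWord i {m} m≤ = subst (IsWord m) (sym (endWord-0 i m≤)) (lowest-valid (suc i) m m≤ , sum-lowest (suc i) m m≤)

words-sound : ∀ i {m σ} → End σ → m ≤ cap (suc i) → All (IsWord m) (words i m σ)
words-sound zero {zero} _ _ = endWord-isWord 0 z≤n ∷ []
words-sound (suc i) {m} {σ} e m≤ with kind i m≤
... | empty refl = subst (All (IsWord 0)) (sym (words-empty (suc i) σ)) (endWord-isWord (suc i) m≤ ∷ [])
... | filled refl = subst (All (IsWord m)) (sym (words-full (suc i) σ)) (endWord-isWord (suc i) m≤ ∷ [])
... | inner x = branch (words-branches x e)
  where
  open Inner x
  child-sound : ∀ {t σ} → End σ → lo ≤ t → t ≤ h → All (IsWord m) (child i m t σ)
  child-sound {t} e lo≤t t≤h = All.map⁺ (All.map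
    (λ (Vv , s≡) → (≤-trans t≤h h≤j , Vv) , trans (cong (t +_) s≡) (m+[n∸m]≡n (≤-trans t≤h h≤m)))
    (words-sound i e (m∸t≤c lo≤t)))
  branch : ∀ {ws} → Branches x σ ws → All (IsWord m) ws
  branch (plain _ refl) = zigzag-All lo (h ∸ lo) λ {t} e l u → child-sound e l (subst (t ≤_) (m+[n∸m]≡n (<⇒≤ lo<h)) u)
  branch (extra lo≡0 _ 2≤h refl) = All.++⁺ (child-sound one (≤-reflexive lo≡0) z≤n)
    (zigzag-All 1 (h ∸ 1) λ {t} e l u → child-sound e (≤-trans (≤-reflexive lo≡0) z≤n) (subst (t ≤_) (m+[n∸m]≡n (<⇒≤ 2≤h)) u))

words-complete : ∀ i {m σ} → End σ → m ≤ cap (suc i) → ∀ w → IsWord m w → w ∈ words i m σ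
words-complete zero {zero} _ _ (zero ∷ []) _ = here refl
words-complete zero {zero} _ _ (suc _ ∷ []) (_ , ())
words-complete (suc i) {m} {σ} e m≤ w (Vw , w≡) with kind i m≤
... | empty refl = subst (w ∈_) (sym (words-empty (suc i) σ))
  (here (trans (sum≡0⇒lowest w Vw w≡) (sym (endWord-0 (suc i) m≤))))
... | filled refl = subst (w ∈_) (sym (words-full (suc i) σ))
  (here (trans (sum≡cap⇒lowest w Vw w≡) (sym (endWord-0 (suc i) m≤))))
words-complete (suc i) {m} {σ} e m≤ (t ∷ v) ((t≤j , Vv) , w≡) | inner x = branch (words-branches x e)
  where
  open Inner x
  t≤m : t ≤ m
  t≤m = subst (t ≤_) w≡ (m≤m+n t (sumᵛ v))
  -- The lower digits hold at most `c`, so the rest of the sum rests on the leading one.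
  lo≤t : lo ≤ t
  lo≤t = m≤n+o⇒m∸n≤o m c (subst₂ _≤_ w≡ (+-comm t c) (+-monoʳ-≤ t (sum≤cap v Vv)))
  t≤h : t ≤ h
  t≤h = subst (t ≤_) (sym (min′≡⊓ j m)) (⊓-glb t≤j t≤m)
  child-complete : ∀ {σ} → End σ → (t ∷ v) ∈ child i m t σ
  child-complete e = ∈-map⁺ (t ∷_) (words-complete i e (m∸t≤c lo≤t) v
    (Vv , sym (trans (cong (_∸ t) (sym w≡)) (m+n∸m≡n t (sumᵛ v)))))
  branch : ∀ {ws} → Branches x σ ws → (t ∷ v) ∈ ws
  branch (plain _ refl) = zigzag-∈ lo (h ∸ lo) lo≤t (subst (t ≤_) (sym (m+[n∸m]≡n (<⇒≤ lo<h))) t≤h) child-complete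
  branch (extra lo≡0 _ 2≤h refl) = lemma t t≤h child-complete
    where
    lemma : ∀ t′ → t′ ≤ h → (∀ {σ} → End σ → (t ∷ v) ∈ child i m t′ σ) → (t ∷ v) ∈ child i m 0 1 ++ zigzag (child i m) 1 (h ∸ 1)
    lemma zero     _   p = ∈-++⁺ˡ (p one)
    lemma (suc t′) t≤h p = ∈-++⁺ʳ (child i m 0 1) (zigzag-∈ 1 (h ∸ 1) (s≤s z≤n) (subst (suc t′ ≤_) (sym (m+[n∸m]≡n (<⇒≤ 2≤h))) t≤h) p)

words-unique : ∀ i {m σ} → End σ → m ≤ cap (suc i) → Unique (words i m σ)
words-unique zero {zero} _ _ = [] ∷ []
words-unique (suc i) {m} {σ} e m≤ with kind i m≤
... | empty refl = subst Unique (sym (words-empty (suc i) σ)) ([] ∷ [])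
... | filled refl = subst Unique (sym (words-full (suc i) σ)) ([] ∷ [])
... | inner x = branch (words-branches x e)
  where
  open Inner x
  child-index : ∀ t σ → All (λ w → head w ≡ t) (child i m t σ)
  child-index t σ = All.map⁺ (All.universal (λ _ → refl) _)
  child-unique : ∀ {t σ} → End σ → lo ≤ t → t ≤ h → Unique (child i m t σ)
  child-unique {t} e lo≤t _ = Unique.map⁺ ∷-injectiveʳ (words-unique i e (m∸t≤c lo≤t))
  branch : ∀ {ws} → Branches x σ ws → Unique ws
  branch (plain _ refl) = zigzag-unique head child-index lo (h ∸ lo) λ {t} e l u → child-unique e l (subst (t ≤_) (m+[n∸m]≡n (<⇒≤ lo<h)) u)
  branch (extra lo≡0 _ 2≤h refl) = Unique.++⁺ (child-unique one (≤-reflexive lo≡0) z≤n)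
    (zigzag-unique head child-index 1 (h ∸ 1) λ {t} e l u → child-unique e (≤-trans (≤-reflexive lo≡0) z≤n) (subst (t ≤_) (m+[n∸m]≡n (<⇒≤ 2≤h)) u))
    (disjoint {F = child i m} head (F-≤ head child-index 1 z≤n) (zigzag-≥ head child-index 1 (h ∸ 1)))

-- From words to permutations

toℕ-transpose : ∀ {n} (i j q : Fin n) → toℕ (transpose i j ⟨$⟩ʳ q) ≡ swap (toℕ i) (toℕ j) (toℕ q)
toℕ-transpose i j q with q ≟ᶠ i
... | yes refl = sym (swap-fst (toℕ q) (toℕ j))
... | no q≢i with q ≟ᶠ j
...   | yes refl = sym (swap-snd (toℕ i) (toℕ q))
...   | no q≢j = sym (swap-other (q≢i ∘ toℕ-injective) (q≢j ∘ toℕ-injective))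

represents-unique : ∀ {n f} {π ρ : Permutation′ n} → Represents π f → Represents ρ f → π ≈ ρ
represents-unique πf ρf i = toℕ-injective (trans (πf i) (sym (ρf i)))

Swaps⇒DifferByTranspositions : ∀ {n k f g} {π ρ : Permutation′ n} → Represents π f → Represents ρ g →
                               Swaps n k f g → DifferByTranspositions k π ρ
Swaps⇒DifferByTranspositions {f = f} {π = π} {ρ} πf ρg (done g≡f) =
  [] , z≤n , [] , represents-unique {f = f} {ρ} {π} (λ i → trans (ρg i) (g≡f (toℕ i))) πf
Swaps⇒DifferByTranspositions {π = π} {ρ} πf ρg (step {f = f} {f′} {x = x} {y} x<n y<n x≢y f′≡ ss)
  with Swaps⇒DifferByTranspositions {π = π · transpose (fromℕ< x<n) (fromℕ< y<n)} {ρ} π·f ρg ss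
  where
  π·f : Represents (π · transpose (fromℕ< x<n) (fromℕ< y<n)) f′
  π·f i = trans (πf _) (trans (cong f (trans (toℕ-transpose (fromℕ< x<n) (fromℕ< y<n) i)
    (cong₂ (λ x y → swap x y (toℕ i)) (toℕ-fromℕ< x<n) (toℕ-fromℕ< y<n)))) (sym (f′≡ (toℕ i))))
... | θs , len , distinct , ρ≈ = (fromℕ< x<n , fromℕ< y<n) ∷ θs , s≤s len ,
  (λ e → x≢y (trans (sym (toℕ-fromℕ< x<n)) (trans (cong toℕ e) (toℕ-fromℕ< y<n)))) ∷ distinct , ρ≈

extend : ∀ {n} → Permutation′ n → ℕ → ℕ
extend {n} π q with q <? n
... | yes q<n = toℕ (π ⟨$⟩ʳ fromℕ< q<n)
... | no _    = q

extend-represents : ∀ {n} (π : Permutation′ n) → Represents π (extend π)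
extend-represents {n} π i with toℕ i <? n
... | yes i<n = cong (toℕ ∘ (π ⟨$⟩ʳ_)) (sym (fromℕ<-toℕ i i<n))
... | no i≮n = ⊥-elim (i≮n (toℕ<n i))

toPermutation-surjective : ∀ {n} (π : Permutation′ n) → Σ[ v ∈ Word n ] Valid v × Represents π (decode v)
toPermutation-surjective {n} π with decode-surjective n (extend π) f< f-injective
  where
  f< : ∀ q → q < n → extend π q < n
  f< q q<n with q <? n
  ... | yes _ = toℕ<n _
  ... | no q≮n = ⊥-elim (q≮n q<n)
  f-injective : ∀ q q′ → q < n → q′ < n → extend π q ≡ extend π q′ → q ≡ q′
  f-injective q q′ q<n q′<n e with q <? n | q′ <? n
  ... | yes p | yes p′ = trans (sym (toℕ-fromℕ< p)) (trans
    (cong toℕ (Injection.injective (↔⇒↣ π) (toℕ-injective e))) (toℕ-fromℕ< p′))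
  ... | no q≮n | _ = ⊥-elim (q≮n q<n)
  ... | yes _ | no q′≮n = ⊥-elim (q′≮n q′<n)
... | v , Vv , v≡ = v , Vv , λ i → trans (extend-represents π i) (sym (v≡ (toℕ i) (toℕ<n i)))

maj-cong : ∀ {n} {π ρ : Permutation′ n} → π ≈ ρ → maj π ≡ maj ρ
maj-cong {n} {π} {ρ} π≈ρ = trans (maj-majOf π (extend ρ) (λ i → trans (cong toℕ (π≈ρ i)) (extend-represents ρ i)))
                                 (sym (maj-majOf ρ (extend ρ) (extend-represents ρ)))

toPermutations : ∀ {n k} {ws : List (Word n)} → All (IsWord k) ws → List (Permutation′ n)
toPermutations = All.reduce (λ {v} (Vv , _) → toPermutation v Vv)

toPermutations-exactly : ∀ {n k} {ws : List (Word n)} (ok : All (IsWord k) ws) → (∀ w → IsWord k w → w ∈ ws) →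
                         ∀ π → Any (π ≈_) (toPermutations ok) ⇔ (maj π ≡ k)
toPermutations-exactly {n} {k} {ws} ok complete π = mk⇔ (sound ok) λ maj≡k → build maj≡k
  where
  sound : ∀ {ws} (ok : All (IsWord k) ws) → Any (π ≈_) (toPermutations ok) → maj π ≡ k
  sound (_∷_ {x = v} (Vv , s≡k) _) (here π≈) =
    trans (maj-cong {π = π} {toPermutation v Vv} π≈) (trans (maj-toPermutation v Vv) s≡k)
  sound (_ ∷ ok) (there p) = sound ok p
  find : ∀ {ws v} (ok : All (IsWord k) ws) → Represents π (decode v) → v ∈ ws → Any (π ≈_) (toPermutations ok)
  find {v = v} ((Vv , _) ∷ _) πv (here refl) =
    here (represents-unique {f = decode v} {π} {toPermutation v Vv} πv (toPermutation-represents v Vv))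
  find (_ ∷ ok) πv (there v∈) = there (find ok πv v∈)
  build : maj π ≡ k → Any (π ≈_) (toPermutations ok)
  build maj≡k with toPermutation-surjective π
  ... | v , Vv , πv = find ok πv (complete v (Vv ,
    trans (sym (trans (maj-majOf π (decode v) πv) (majOf-decode v Vv))) maj≡k))

toPermutations-distinct : ∀ {n k} {ws : List (Word n)} (ok : All (IsWord k) ws) → Unique ws →
                          AllPairs (λ π ρ → ¬ (π ≈ ρ)) (toPermutations ok)
toPermutations-distinct [] [] = []
toPermutations-distinct {n} {k} (_∷_ {x = v} (Vv , _) ok) (v∉ ∷ u) = different ok v∉ ∷ toPermutations-distinct ok u
  where
  different : ∀ {ws} (ok : All (IsWord k) ws) → All (v ≢_) ws →
              All (λ ρ → ¬ (toPermutation v Vv ≈ ρ)) (toPermutations ok)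
  different [] [] = []
  different (_∷_ {x = w} (Vw , _) ok) (v≢w ∷ v∉) = (λ v≈w → v≢w (decode-injective v w Vv Vw λ q q<n →
      let i = fromℕ< q<n in
      subst (λ q → decode v q ≡ decode w q) (toℕ-fromℕ< q<n)
        (trans (sym (toPermutation-represents v Vv i)) (trans (cong toℕ (v≈w i)) (toPermutation-represents w Vw i)))))
    ∷ different ok v∉

toPermutations-linked : ∀ {n k v w} {ws : List (Word n)} (ok : All (IsWord k) ws) → Path (Close n) v w ws →
                        Linked (DifferByTranspositions 3) (toPermutations ok)
toPermutations-linked (_ ∷ []) [-] = [-]
toPermutations-linked {n} (_∷_ {x = v} (Vv , _) ok) (close near _ ∷ p) = prepend ok p near
  where
  differ : ∀ {w} (Vw : Valid w) → Near n (decode v) (decode w) → DifferByTranspositions 3 (toPermutation v Vv) (toPermutation w Vw)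
  differ {w} Vw (k , k≤3 , ss) with Swaps⇒DifferByTranspositions {π = toPermutation v Vv} {toPermutation w Vw}
                                      (toPermutation-represents v Vv) (toPermutation-represents w Vw) ss
  ... | θs , len , rest = θs , ≤-trans len k≤3 , rest
  prepend : ∀ {w z ws} (ok : All (IsWord _) ws) → Path (Close n) w z ws → Near n (decode v) (decode w) →
            Linked (DifferByTranspositions 3) (toPermutation v Vv ∷ toPermutations ok)
  prepend ok@((Vw , _) ∷ _) p@[-]     near = differ Vw near ∷ toPermutations-linked ok p
  prepend ok@((Vw , _) ∷ _) p@(_ ∷ _) near = differ Vw near ∷ toPermutations-linked ok p

length-toPermutations : ∀ {n k} {ws : List (Word n)} (ok : All (IsWord k) ws) → length (toPermutations ok) ≡ length ws
length-toPermutations [] = refl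
length-toPermutations (_ ∷ ok) = cong suc (length-toPermutations ok)

-- The number of outputs against `majCount`

≈-sym : ∀ {n} {π ρ : Permutation′ n} → π ≈ ρ → ρ ≈ π
≈-sym π≈ρ i = sym (π≈ρ i)

≈-trans : ∀ {n} {π ρ τ : Permutation′ n} → π ≈ ρ → ρ ≈ τ → π ≈ τ
≈-trans π≈ρ ρ≈τ i = trans (π≈ρ i) (ρ≈τ i)

distinct-lookup : ∀ {n} {xs : List (Permutation′ n)} → AllPairs (λ π ρ → ¬ (π ≈ ρ)) xs →
                  ∀ i j → lookup xs i ≈ lookup xs j → i ≡ j
distinct-lookup (_ ∷ _) zero zero _ = refl
distinct-lookup {xs = x ∷ xs} (x∉ ∷ _) zero (suc j) x≈ = ⊥-elim (All.lookup x∉ (∈-lookup j) x≈)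
distinct-lookup {xs = x ∷ xs} (x∉ ∷ _) (suc i) zero ≈x = ⊥-elim (All.lookup x∉ (∈-lookup i) (≈-sym {π = lookup xs i} {x} ≈x))
distinct-lookup (_ ∷ d) (suc i) (suc j) e = cong suc (distinct-lookup d i j e)

-- Pigeonhole principle: two entries found at the same index of `ys` are equivalent, hence in the
-- same place of `xs`, so the choice of indices is injective.
distinct⇒length≤ : ∀ {n} {xs ys : List (Permutation′ n)} → AllPairs (λ π ρ → ¬ (π ≈ ρ)) xs →
                   (∀ i → Any (lookup xs i ≈_) ys) → length xs ≤ length ys
distinct⇒length≤ {xs = xs} {ys} d find = injective⇒≤ {f = λ i → Any.index (find i)} λ {i} {j} i≡j →
  distinct-lookup d i j (≈-trans {π = lookup xs i} {lookup ys (Any.index (find i))} {lookup xs j} (Any.lookup-index (find i))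
    (subst (λ l → lookup ys l ≈ lookup xs j) (sym i≡j)
      (≈-sym {π = lookup xs j} {lookup ys (Any.index (find j))} (Any.lookup-index (find j)))))

insert-cong : ∀ {n} j {π ρ : Permutation′ n} → π ≈ ρ → insert zero j π ≈ insert zero j ρ
insert-cong j π≈ρ zero    = refl
insert-cong j π≈ρ (suc i) = cong (Fin.punchIn j) (π≈ρ i)

permutations-complete : ∀ n (π : Permutation′ n) → Any (π ≈_) (permutations n)
permutations-complete zero π = here λ ()
permutations-complete (suc n) π = Any.concat⁺ (Any.map⁺
  (Any.map here′ (∈-allFin (π ⟨$⟩ʳ zero))))
  where
  here′ : ∀ {j} → π ⟨$⟩ʳ zero ≡ j → Any (π ≈_) (map (insert zero j) (permutations n))
  here′ refl = Any.map⁺ (Any.map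
    (λ {ρ} π′≈ρ i → trans (sym (insert-remove zero π i)) (insert-cong (π ⟨$⟩ʳ zero) {remove zero π} {ρ} π′≈ρ i))
    (permutations-complete n (remove zero π)))

-- Turns a bound on the time per generated permutation into one by the counting function of the
-- theorem.
length≤majCount : ∀ {n k} {πs : List (Permutation′ n)} → ListsMajorIndex k πs → length πs ≤ majCount n k
length≤majCount {n} {k} {πs} lists = distinct⇒length≤ distinct λ i → find (lookup πs i) (member πs i)
  where
  open ListsMajorIndex lists
  member : ∀ πs i → Any (lookup πs i ≈_) πs
  member (π ∷ πs) zero    = here λ _ → refl
  member (π ∷ πs) (suc i) = there (member πs i)
  find : ∀ π → Any (π ≈_) πs → Any (π ≈_) (filter (λ π → maj π ≟ k) (permutations n))
  find π π∈ with Any.filter⁺ (λ π → maj π ≟ k) (permutations-complete n π)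
  ... | inj₁ p = p
  ... | inj₂ maj≢k = ⊥-elim (maj≢k (trans
    (sym (maj-cong {π = π} {Any.lookup (permutations-complete n π)} (Any.lookup-result (permutations-complete n π))))
    (Equivalence.to (exactly π) π∈)))

-- The machine program

infixl 6 _⊕_ _⊖_

_⊕_ _⊖_ : Expr → Expr → Expr
_⊕_ = op add
_⊖_ = op sub

minᵉ : Expr → Expr → Expr
minᵉ x y = x ⊖ (x ⊖ y)

topᵉ : (i c q σ : Expr) → Expr
topᵉ i c q σ = minᵉ b (minᵉ i q)
  where
  x = minᵉ σ (lit 1) ⊕ (q ⊖ c)
  b = x ⊕ (σ ⊖ x)

Proc : Set
Proc = Fin 16

Code : Set
Code = Cmd 16

exchange₂ᵖ exchangeᵖ move₂ᵖ moveᵖ walkᵖ shiftᵖ hop₂ᵖ hopᵖ fillTableᵖ fillPermᵖ : Proc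
exchange₂ᵖ = # 0
exchangeᵖ = # 1
move₂ᵖ = # 2
moveᵖ = # 3
walkᵖ = # 4
shiftᵖ = # 5
hop₂ᵖ = # 6
hopᵖ = # 7
fillTableᵖ = # 14
fillPermᵖ = # 15

zigzagᵖ nodeᵖ generateᵖ : Bool → Proc
zigzagᵖ true = # 8
zigzagᵖ false = # 9
nodeᵖ true = # 10
nodeᵖ false = # 11
generateᵖ true = # 12
generateᵖ false = # 13

exchange₂ᶜ exchangeᶜ move₂ᶜ moveᶜ walkᶜ shiftᶜ hop₂ᶜ hopᶜ fillTableᶜ fillPermᶜ : Code

-- Both values arrive as parameters, hence are read before either cell is overwritten. The whole
-- program passes data by parameters and never assigns to a local variable.
exchange₂ᶜ = store perm (var 0) (var 3) ⨾ store perm (var 1) (var 2)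

exchangeᶜ = call exchange₂ᵖ (var 0 ∷ var 1 ∷ cell perm (var 0) ∷ cell perm (var 1) ∷ [])

-- Parameters level, u, p, g: exchange the positions level and reflect p g u.
move₂ᶜ = cond (op lt (var 1) (var 3)) (call exchangeᵖ (var 0 ∷ var 3 ⊖ var 1 ∷ []))
        (cond (op lt (var 1) (var 2)) (call exchangeᵖ (var 0 ∷ var 3 ⊕ var 2 ⊖ var 1 ∷ []))
                                      (call exchangeᵖ (var 0 ∷ lit 1 ⊕ var 1 ∷ [])))

-- Parameters level, r, u.
moveᶜ = call move₂ᵖ (var 0 ∷ var 2 ∷ cell 1 (var 1) ∷ cell 2 (var 1) ∷ [])

-- Parameters level, r, s, s′.
walkᶜ = cond (op lt (var 3) (var 2))
          (call moveᵖ (var 0 ∷ var 1 ∷ var 2 ⊖ lit 1 ∷ []) ⨾ call walkᵖ (var 0 ∷ var 1 ∷ var 2 ⊖ lit 1 ∷ var 3 ∷ []))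
       (cond (op lt (var 2) (var 3))
          (call moveᵖ (var 0 ∷ var 1 ∷ var 2 ∷ []) ⨾ call walkᵖ (var 0 ∷ var 1 ∷ lit 1 ⊕ var 2 ∷ var 3 ∷ []))
          skip)

-- Parameters j, r, s, r′, s′.
shiftᶜ = cond (op lt (var 1) (var 3)) (call exchangeᵖ (var 0 ∷ lit 1 ∷ [])) skip
       -- The second argument is the maximum of `r` and `r′`. The truncated differences, 0 or 1,
       -- take off the unit that the exchange before or after the walk accounts for.
       ⨾ call walkᵖ (lit 1 ⊕ var 0 ∷ var 1 ⊕ (var 3 ⊖ var 1) ∷ var 2 ⊖ (var 3 ⊖ var 1) ∷ var 4 ⊖ (var 1 ⊖ var 3) ∷ [])
       ⨾ cond (op lt (var 3) (var 1)) (call exchangeᵖ (var 0 ∷ lit 1 ∷ [])) skip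

-- Parameters j, q, s, q′, s′.
hop₂ᶜ = call shiftᵖ (var 0 ∷ var 1 ⊖ var 2 ∷ var 2 ∷ var 3 ⊖ var 4 ∷ var 4 ∷ [])

-- Parameters j, cap (j ∸ 1), q, σ, q′, σ′.
hopᶜ = call hop₂ᵖ (var 0 ∷ var 2 ∷ topᵉ (var 0 ⊖ lit 1) (var 1) (var 2) (var 3)
                        ∷ var 4 ∷ topᵉ (var 0 ⊖ lit 1) (var 1) (var 4) (var 5) ∷ [])

-- The direction is true for a list of words and false for its reversal.
_⨾[_]_ : Code → Bool → Code → Code
c ⨾[ true ] c′  = c ⨾ c′
c ⨾[ false ] c′ = c′ ⨾ c

generateAt : Bool → (t σ : Expr) → Code
generateAt d t σ = call (generateᵖ d) (var 0 ∷ var 1 ⊖ t ∷ var 2 ∷ σ ∷ [])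

hopAt : Bool → (t σ t′ σ′ : Expr) → Code
-- Subtracting `j ∸ 1` from `cap j` gives the capacity one level below, by the recursion of `cap`.
hopAt true  t σ t′ σ′ = call hopᵖ (var 0 ∷ var 2 ⊖ (var 0 ⊖ lit 1) ∷ var 1 ⊖ t ∷ σ ∷ var 1 ⊖ t′ ∷ σ′ ∷ [])
hopAt false t σ t′ σ′ = call hopᵖ (var 0 ∷ var 2 ⊖ (var 0 ⊖ lit 1) ∷ var 1 ⊖ t′ ∷ σ′ ∷ var 1 ⊖ t ∷ σ ∷ [])

zigzagᶜ nodeᶜ generateᶜ : Bool → Code

-- Parameters j, m, cap j, a, b.
zigzagᶜ d =
  cond (op eq (var 4) (lit 0)) (generateAt d (var 3) (lit 1))
 (cond (op eq (var 4) (lit 1))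
    (generateAt d (var 3) (lit 2) ⨾[ d ]
      (hopAt d (var 3) (lit 2) (lit 1 ⊕ var 3) (lit 1) ⨾[ d ]
        generateAt (not d) (lit 1 ⊕ var 3) (lit 1)))
    (generateAt d (var 3) (lit 2) ⨾[ d ]
      (hopAt d (var 3) (lit 2) (lit 2 ⊕ var 3) (lit 0) ⨾[ d ]
        (call (zigzagᵖ d) (var 0 ∷ var 1 ∷ var 2 ∷ lit 2 ⊕ var 3 ∷ var 4 ⊖ lit 2 ∷ []) ⨾[ d ]
          -- The comparisons compute `finalT` and `finalσ` of the inner zigzag, whose range has
          -- length `b ∸ 2`.
          (hopAt d (op lt (lit 2) (var 4) ⊕ (lit 2 ⊕ var 3)) (op eq (var 4) (lit 2)) (lit 1 ⊕ var 3) (lit 2) ⨾[ d ]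
            generateAt (not d) (lit 1 ⊕ var 3) (lit 2))))))

-- Parameters j, m, cap j, σ.
nodeᶜ d =
  -- The test value is the last argument of `branches`: nonzero exactly if the digit 0 has to be put
  -- in front.
  cond (topᵉ (var 0) (var 2) (var 1) (var 3) ⊖ (lit 1 ⊕ (var 1 ⊖ var 2)))
    (generateAt d (lit 0) (lit 1) ⨾[ d ]
      (hopAt d (lit 0) (lit 1) (lit 1) (lit 0) ⨾[ d ]
        call (zigzagᵖ d) (var 0 ∷ var 1 ∷ var 2 ∷ lit 1 ∷ minᵉ (var 0) (var 1) ⊖ lit 1 ∷ [])))
    (call (zigzagᵖ d) (var 0 ∷ var 1 ∷ var 2 ∷ var 1 ⊖ var 2 ∷ minᵉ (var 0) (var 1) ⊖ (var 1 ⊖ var 2) ∷ []))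

-- Parameters level, m, cap level, σ.
generateᶜ d =
  cond (op eq (var 1) (lit 0)) output
 (cond (op eq (var 1) (var 2)) output
   (call (nodeᵖ d) (var 0 ⊖ lit 1 ∷ var 1 ∷ var 2 ⊖ (var 0 ⊖ lit 1) ∷ var 3 ∷ [])))

-- Parameters r, p, g and the number of entries left.
fillTableᶜ = store 1 (var 0) (var 1) ⨾ store 2 (var 0) (var 2) ⨾
  cond (op eq (var 3) (lit 0)) skip
 (cond (op eq (var 2) (lit 0))
   (call fillTableᵖ (lit 1 ⊕ var 0 ∷ lit 1 ⊕ var 1 ∷ var 1 ⊖ lit 1 ∷ var 3 ⊖ lit 1 ∷ []))
   (call fillTableᵖ (lit 1 ⊕ var 0 ∷ var 1 ∷ var 2 ⊖ lit 1 ∷ var 3 ⊖ lit 1 ∷ [])))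

-- Parameters u, p, g and the number of entries left.
fillPermᶜ =
  cond (op lt (var 0) (var 2)) (store perm (lit 1 ⊕ var 0) (var 2 ⊖ var 0))
 (cond (op lt (var 0) (var 1)) (store perm (lit 1 ⊕ var 0) (var 2 ⊕ var 1 ⊖ var 0))
                               (store perm (lit 1 ⊕ var 0) (lit 1 ⊕ var 0))) ⨾
  cond (op eq (var 3) (lit 0)) skip
   (call fillPermᵖ (lit 1 ⊕ var 0 ∷ var 1 ∷ var 2 ∷ var 3 ⊖ lit 1 ∷ []))

capᵉ : Expr
capᵉ = op div (op mul (var 0) (var 0 ⊖ lit 1)) (lit 2)

program : Program
program = record
  { procs = exchange₂ᶜ ∷ exchangeᶜ ∷ move₂ᶜ ∷ moveᶜ ∷ walkᶜ ∷ shiftᶜ ∷ hop₂ᶜ ∷ hopᶜ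
          ∷ zigzagᶜ true ∷ zigzagᶜ false ∷ nodeᶜ true ∷ nodeᶜ false ∷ generateᶜ true ∷ generateᶜ false
          ∷ fillTableᶜ ∷ fillPermᶜ ∷ []
  ; main = call fillTableᵖ (lit 0 ∷ lit 1 ∷ lit 0 ∷ capᵉ ∷ [])
         -- The table entries for `k` describe the reflection `ρ k`, which is the first permutation.
         ⨾ call fillPermᵖ (lit 0 ∷ cell 1 (var 1) ∷ cell 2 (var 1) ∷ var 0 ⊖ lit 1 ∷ [])
         ⨾ call (generateᵖ true) (var 0 ∷ var 1 ∷ capᵉ ∷ lit 1 ∷ [])
  }

procs : Vec Code 16
procs = Program.procs program

-- Nesting depth and size of the integers

Exec-mono : ∀ {W d d′ s s′ ts t} {c : Code} → d ≤ d′ → Exec W procs d c s s′ ts t → Exec W procs d′ c s s′ ts t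
Exec-mono d≤ skip = skip
Exec-mono d≤ (assign f) = assign f
Exec-mono d≤ (store f f′) = store f f′
Exec-mono d≤ (seq x y) = seq (Exec-mono d≤ x) (Exec-mono d≤ y)
Exec-mono d≤ (cond-true f e x) = cond-true f e (Exec-mono d≤ x)
Exec-mono d≤ (cond-false f e x) = cond-false f e (Exec-mono d≤ x)
Exec-mono d≤ (while-true f e x y) = while-true f e (Exec-mono d≤ x) (Exec-mono d≤ y)
Exec-mono d≤ (while-false f e) = while-false f e
Exec-mono (s≤s d≤) (call f x) = call f (Exec-mono d≤ x)
Exec-mono d≤ output = output

size : Expr → ℕ
size (lit c)    = 1
size (var x)    = 1
size (cell a e) = suc (size e)
size (op o e e′) = suc (size e + size e′)

-- A common bound on the sizes of the expressions of the program, verified for each of them by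
-- evaluating `small`. It is the exponent of the word size.
maxSize : ℕ
maxSize = 64

smallLits : Expr → Bool
smallLits (lit c)    = c ≤ᵇ 2
smallLits (var x)    = true
smallLits (cell a e) = smallLits e
smallLits (op o e e′) = smallLits e ∧ smallLits e′

small : Expr → Bool
small e = smallLits e ∧ (size e ≤ᵇ maxSize)

smalls : List Expr → Bool
smalls []       = true
smalls (e ∷ es) = small e ∧ smalls es

∧-fst : ∀ {x y} → T (x ∧ y) → T x
∧-fst {true} _ = tt

∧-snd : ∀ {x y} → T (x ∧ y) → T y
∧-snd {true} p = p

module _ (B : ℕ) (4≤B : 4 ≤ B) where

  private
    instance
      B≢0 : NonZero B
      B≢0 = >-nonZero (≤-trans (s≤s z≤n) 4≤B)

  record Bounded (s : State) : Set where
    constructor bounded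
    field
      locals≤ : ∀ x → locals s x ≤ B
      arrays≤ : ∀ a i → arrays s a i ≤ B
  open Bounded

  B^-mono : ∀ {a b} → a ≤ b → B ^ a ≤ B ^ b
  B^-mono = ^-monoʳ-≤ B

  1≤B^ : ∀ a → 1 ≤ B ^ a
  1≤B^ a = m^n>0 B a

  B≤B^suc : ∀ a → B ≤ B ^ suc a
  B≤B^suc a = ≤-trans (≤-reflexive (sym (*-identityʳ B))) (*-monoʳ-≤ B (1≤B^ a))

  x+y≤4xy : ∀ {x y} → 1 ≤ x → 1 ≤ y → x + y ≤ 4 * (x * y)
  x+y≤4xy {suc x} {suc y} _ _ = subst (suc x + suc y ≤_) (sym (expand x y)) (m≤m+n _ _)
    where
    expand : ∀ x y → 4 * (suc x * suc y) ≡ (suc x + suc y) + (2 + 3 * x + 3 * y + 4 * (x * y))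
    expand = solve-∀

  -- An operation costs one further factor `B`, which absorbs the constant in `x+y≤4xy`. By
  -- induction an expression has a value of at most `B` to the power of its size.
  B^-combine : ∀ {x y} a b → x ≤ B ^ a → y ≤ B ^ b → x + y ≤ B ^ suc (a + b) × x * y ≤ B ^ suc (a + b)
  B^-combine {x} {y} a b x≤ y≤ =
    ≤-trans (+-mono-≤ x≤ y≤) (≤-trans (x+y≤4xy (1≤B^ a) (1≤B^ b))
      (≤-trans (*-monoˡ-≤ (B ^ a * B ^ b) 4≤B) (≤-reflexive (cong (B *_) (sym (^-distribˡ-+-* B a b)))))) ,
    ≤-trans (*-mono-≤ x≤ y≤) (≤-trans (≤-reflexive (sym (^-distribˡ-+-* B a b))) (B^-mono {a + b} {suc (a + b)} (n≤1+n (a + b))))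

  if-≤1 : ∀ b → (if b then 1 else 0) ≤ 1
  if-≤1 true  = ≤-refl
  if-≤1 false = z≤n

  eval≤ : ∀ {s} → Bounded s → ∀ e → T (smallLits e) → eval s e ≤ B ^ size e
  eval≤ bd (lit c) ok = ≤-trans (≤-trans (≤ᵇ⇒≤ c 2 ok) (≤-trans (s≤s (s≤s z≤n)) 4≤B)) (B≤B^suc 0)
  eval≤ bd (var x) ok = ≤-trans (locals≤ bd x) (B≤B^suc 0)
  eval≤ bd (cell a e) ok = ≤-trans (arrays≤ bd a _) (B≤B^suc (size e))
  eval≤ {s} bd (op o e e′) ok = lemma o (eval≤ bd e (∧-fst ok)) (eval≤ bd e′ (∧-snd {smallLits e} ok))
    where
    a = size e
    b = size e′
    weak : ∀ {x} → x ≤ B ^ a → x ≤ B ^ suc (a + b)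
    weak x≤ = ≤-trans x≤ (B^-mono {a} {suc (a + b)} (≤-trans (m≤m+n a b) (n≤1+n _)))
    lemma : ∀ o {x y} → x ≤ B ^ a → y ≤ B ^ b → apply o x y ≤ B ^ suc (a + b)
    lemma add x≤ y≤ = proj₁ (B^-combine a b x≤ y≤)
    lemma sub {x} {y} x≤ _ = weak (≤-trans (m∸n≤m x y) x≤)
    lemma mul x≤ y≤ = proj₂ (B^-combine a b x≤ y≤)
    lemma div {x} {zero} _ _ = z≤n
    lemma div {x} {suc y} x≤ _ = weak (≤-trans (m/n≤m x (suc y)) x≤)
    lemma lt {x} {y} _ _ = ≤-trans (if-≤1 (x <ᵇ y)) (1≤B^ (suc (a + b)))
    lemma eq {x} {y} _ _ = ≤-trans (if-≤1 (x ≡ᵇ y)) (1≤B^ (suc (a + b)))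

  fits′ : ∀ {s} → Bounded s → ∀ e → T (smallLits e) → size e ≤ maxSize → Fits (B ^ maxSize) s e
  fits′ bd e@(lit c) ok sz = ≤-trans (eval≤ bd e ok) (B^-mono {size e} {maxSize} sz)
  fits′ bd e@(var x) ok sz = ≤-trans (eval≤ bd e ok) (B^-mono {size e} {maxSize} sz)
  fits′ bd e@(cell a e₁) ok sz = fits′ bd e₁ ok (≤-trans (n≤1+n _) sz) , ≤-trans (eval≤ bd e ok) (B^-mono {size e} {maxSize} sz)
  fits′ bd e@(op o e₁ e₂) ok sz =
    fits′ bd e₁ (∧-fst ok) (≤-trans (≤-trans (m≤m+n _ _) (n≤1+n _)) sz) ,
    fits′ bd e₂ (∧-snd {smallLits e₁} ok) (≤-trans (≤-trans (m≤n+m _ _) (n≤1+n _)) sz) ,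
    ≤-trans (eval≤ bd e ok) (B^-mono {size e} {maxSize} sz)

  fits : ∀ {s} → Bounded s → ∀ e {ok : T (small e)} → Fits (B ^ maxSize) s e
  fits bd e {ok} = fits′ bd e (∧-fst ok) (≤ᵇ⇒≤ _ _ (∧-snd {smallLits e} ok))

  all-fits : ∀ {s} → Bounded s → ∀ es {ok : T (smalls es)} → All (Fits (B ^ maxSize) s) es
  all-fits bd [] = []
  all-fits bd (e ∷ es) {ok} = fits bd e {∧-fst ok} ∷ all-fits bd es {∧-snd {small e} ok}

  frame-≤ : ∀ {vs} → All (_≤ B) vs → ∀ x → frame vs x ≤ B
  frame-≤ []       x       = z≤n
  frame-≤ (p ∷ ps) zero    = p
  frame-≤ (p ∷ ps) (suc x) = frame-≤ ps x

cap-mono : ∀ {i j} → i ≤ j → cap i ≤ cap j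
cap-mono {zero}          _         = z≤n
cap-mono {suc i} {suc j} (s≤s i≤j) = +-mono-≤ i≤j (cap-mono i≤j)

cap≤n² : ∀ n → cap n ≤ n ^ 2
cap≤n² zero = z≤n
cap≤n² (suc n) = ≤-trans (+-monoʳ-≤ n (cap≤n² n)) (subst (n + n ^ 2 ≤_) (sym (expand n)) (m≤m+n _ (suc n)))
  where
  expand : ∀ n → suc n * (suc n * 1) ≡ (n + n * (n * 1)) + suc n
  expand = solve-∀

-- Correctness of the exchange procedures

module Machine (n : ℕ) (1≤n : 1 ≤ n) where

  -- Bounds all parameters and array cells: positions and digits are at most `n`, sums and table
  -- indices at most `cap n`, and the table entries exceed their index by at most one. The factor 4
  -- also ensures `4≤B`.
  B : ℕ
  B = 4 * n ^ 2

  W : ℕ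
  W = B ^ maxSize

  private
    instance
      n≢0 : NonZero n
      n≢0 = >-nonZero 1≤n

  n≤n² : n ≤ n ^ 2
  n≤n² = ≤-trans (≤-reflexive (sym (^-identityʳ n))) (^-monoʳ-≤ n (s≤s (z≤n {1})))

  n²≤B : n ^ 2 ≤ B
  n²≤B = m≤m+n _ _

  n≤B : n ≤ B
  n≤B = ≤-trans n≤n² n²≤B

  4≤B : 4 ≤ B
  4≤B = *-monoʳ-≤ 4 (≤-trans 1≤n n≤n²)

  cap≤B : ∀ {i} → i ≤ n → cap i ≤ B
  cap≤B i≤n = ≤-trans (cap-mono i≤n) (≤-trans (cap≤n² n) n²≤B)

  record Memory (f : ℕ → ℕ) (m : Name → Contents) : Set where
    field
      holds  : ∀ q → q < n → m perm (suc q) ≡ suc (f q)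
      tablesP : ∀ r → r ≤ cap n → m 1 r ≡ tableP r
      tablesG : ∀ r → r ≤ cap n → m 2 r ≡ tableG r
      cells≤ : ∀ a i → m a i ≤ B

  open Memory public

  HoldsFn : Contents → (ℕ → ℕ) → Set
  HoldsFn a f = ∀ q → q < n → a (suc q) ≡ suc (f q)

  -- The locals `l` return unchanged, so a command is specified by its effect on the stored
  -- permutation `g`, its outputs `fs` and a time bound `τ`.
  record Result (D : ℕ) (c : Code) (l : Name → ℕ) (m : Name → Contents) (g : ℕ → ℕ) (fs : List (ℕ → ℕ)) (τ : ℕ) : Set where
    constructor result
    field
      {m′} : Name → Contents
      {ts} : List Contents
      {t}  : ℕ
      exec    : Exec W procs D c ⟨ l , m ⟩ ⟨ l , m′ ⟩ ts t
      memory  : Memory g m′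
      outputs : Pointwise HoldsFn ts fs
      t≤      : t ≤ τ

  record Runs (D : ℕ) (c : Code) (l : Name → ℕ) (f g : ℕ → ℕ) (fs : List (ℕ → ℕ)) (τ : ℕ) : Set where
    constructor runs
    field
      run : ∀ {m} → Memory f m → Result D c l m g fs τ

  open Runs public

  LocalsOk : (Name → ℕ) → Set
  LocalsOk l = ∀ x → l x ≤ B

  frameOk : ∀ {vs} → All (_≤ B) vs → LocalsOk (frame vs)
  frameOk = frame-≤ B 4≤B

  bd : ∀ {l m f} → LocalsOk l → Memory f m → Bounded B 4≤B ⟨ l , m ⟩
  bd l≤ M = bounded l≤ (cells≤ M)

  weaken : ∀ {D D′ c l f g fs τ τ′} → D ≤ D′ → τ ≤ τ′ → Runs D c l f g fs τ → Runs D′ c l f g fs τ′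
  weaken D≤ τ≤ (runs r) = runs λ M → let result e M′ out t≤ = r M in result (Exec-mono D≤ e) M′ out (≤-trans t≤ τ≤)

  deeper : ∀ {D D′ c l f g fs τ} → D ≤ D′ → Runs D c l f g fs τ → Runs D′ c l f g fs τ
  deeper D≤ = weaken D≤ ≤-refl

  slower : ∀ {D c l f g fs τ} τ′ {_ : T (τ ≤ᵇ τ′)} → Runs D c l f g fs τ → Runs D c l f g fs τ′
  slower {τ = τ} τ′ {ok} = weaken ≤-refl (≤ᵇ⇒≤ τ τ′ ok)

  respects : ∀ {D c l f g g′ fs τ} → (∀ q → g′ q ≡ g q) → Runs D c l f g fs τ → Runs D c l f g′ fs τ
  respects g′≡g (runs r) = runs λ M → let result e M′ out t≤ = r M in
    result e (record { holds = λ q q<n → trans (holds M′ q q<n) (cong suc (sym (g′≡g q)))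
                     ; tablesP = tablesP M′ ; tablesG = tablesG M′ ; cells≤ = cells≤ M′ }) out t≤

  skip-runs : ∀ {D l f} → Runs D skip l f f [] 1
  skip-runs = runs λ M → result skip M [] ≤-refl

  output-runs : ∀ {D l f} → Runs D output l f f (f ∷ []) 1
  output-runs = runs λ M → result output M (holds M ∷ []) ≤-refl

  seq-runs : ∀ {D c c′ l f g h fs gs τ τ′} → Runs D c l f g fs τ → Runs D c′ l g h gs τ′ →
             Runs D (c ⨾ c′) l f h (fs ++ gs) (τ + τ′)
  seq-runs (runs r) (runs r′) = runs λ M →
    let result e M′ out t≤ = r M
        result e′ M″ out′ t≤′ = r′ M′
    in result (seq e e′) M″ (Pointwise.++⁺ out out′) (+-mono-≤ t≤ t≤′)

  call-runs : ∀ {D l f g fs τ body} p es vs {ok : T (smalls es)} → lookupᵛ procs p ≡ body → LocalsOk l →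
              (∀ {m} → Memory f m → map (eval ⟨ l , m ⟩) es ≡ vs) →
              Runs D body (frame vs) f g fs τ → Runs (suc D) (call p es) l f g fs (suc (sum (map cost es) + τ))
  call-runs {D} p es vs {ok} refl l≤ es≡ (runs r) = runs λ {m} M →
    let result {m′} {ts} {t} e M′ out t≤ = r M
    in result (call (all-fits B 4≤B (bd l≤ M) es {ok})
                (subst (λ vs → Exec W procs D (lookupᵛ procs p) ⟨ frame vs , m ⟩ ⟨ frame vs , m′ ⟩ ts t) (sym (es≡ M)) e))
              M′ out (s≤s (+-monoʳ-≤ (sum (map cost es)) t≤))

  true-runs : ∀ {D l f g fs τ c c′} e v {ok : T (small e)} → LocalsOk l → (∀ m → eval ⟨ l , m ⟩ e ≡ suc v) →
              Runs D c l f g fs τ → Runs D (cond e c c′) l f g fs (suc (cost e + τ))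
  true-runs e v {ok} l≤ e≡ (runs r) = runs λ {m} M →
    let result x M′ out t≤ = r M
    in result (cond-true (fits B 4≤B (bd l≤ M) e {ok}) (λ e≡0 → 1+n≢0 (trans (sym (e≡ m)) e≡0)) x)
              M′ out (s≤s (+-monoʳ-≤ (cost e) t≤))

  false-runs : ∀ {D l f g fs τ c c′} e {ok : T (small e)} → LocalsOk l → (∀ m → eval ⟨ l , m ⟩ e ≡ 0) →
               Runs D c′ l f g fs τ → Runs D (cond e c c′) l f g fs (suc (cost e + τ))
  false-runs e {ok} l≤ e≡ (runs r) = runs λ {m} M →
    let result x M′ out t≤ = r M
    in result (cond-false (fits B 4≤B (bd l≤ M) e {ok}) (e≡ m) x)
              M′ out (s≤s (+-monoʳ-≤ (cost e) t≤))

  update-hit : ∀ (a : Contents) x v → (a [ x ↦ v ]) x ≡ v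
  update-hit a x v rewrite ≡ᵇ-true x = refl

  update-miss : ∀ (a : Contents) {x y} v → x ≢ y → (a [ x ↦ v ]) y ≡ a y
  update-miss a v x≢y rewrite ≡ᵇ-false x≢y = refl

  update-≤ : ∀ {a : Contents} → (∀ i → a i ≤ B) → ∀ x {v} → v ≤ B → ∀ i → (a [ x ↦ v ]) i ≤ B
  update-≤ a≤ x v≤ i with x ≡ᵇ i
  ... | true  = v≤
  ... | false = a≤ i

  updates-≤ : ∀ {m : Name → Contents} {a : Contents} → (∀ a i → m a i ≤ B) → (∀ i → a i ≤ B) → ∀ b c i → (m [ b ↦ a ]) c i ≤ B
  updates-≤ m≤ a≤ b c i with b ≡ᵇ c
  ... | true  = a≤ i
  ... | false = m≤ c i

  exchange₂-runs : ∀ {x y f} → x < n → y < n → f x < n → f y < n →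
                   Runs 0 exchange₂ᶜ (frame (suc x ∷ suc y ∷ suc (f x) ∷ suc (f y) ∷ [])) f (f ∘ swap x y) [] 6
  exchange₂-runs {x} {y} {f} x<n y<n fx<n fy<n = runs λ {m} M →
    let b = bd l≤ M
        m₁≤ : ∀ a i → (m [ perm ↦ (m perm) [ suc x ↦ suc (f y) ] ]) a i ≤ B
        m₁≤ = updates-≤ {m} (cells≤ M) (update-≤ (cells≤ M perm) (suc x) (≤-trans fy<n n≤B)) perm
        b₁ = bounded {B} {4≤B} l≤ m₁≤
    in result (seq (store (fits B 4≤B b (var 0)) (fits B 4≤B b (var 3)))
                   (store (fits B 4≤B b₁ (var 1)) (fits B 4≤B b₁ (var 2))))
      (record
        { holds = new (m perm) (holds M)
        ; tablesP = tablesP M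
        ; tablesG = tablesG M
        ; cells≤ = updates-≤ {_} {((m perm) [ suc x ↦ suc (f y) ]) [ suc y ↦ suc (f x) ]} m₁≤
            (update-≤ (update-≤ (cells≤ M perm) (suc x) (≤-trans fy<n n≤B)) (suc y) (≤-trans fx<n n≤B)) perm })
      [] ≤-refl
    where
    l≤ : LocalsOk (frame (suc x ∷ suc y ∷ suc (f x) ∷ suc (f y) ∷ []))
    l≤ = frameOk (≤-trans x<n n≤B ∷ ≤-trans y<n n≤B ∷ ≤-trans fx<n n≤B ∷ ≤-trans fy<n n≤B ∷ [])
    new : ∀ (a : Contents) → HoldsFn a f → HoldsFn ((a [ suc x ↦ suc (f y) ]) [ suc y ↦ suc (f x) ]) (f ∘ swap x y)
    new a a≡ q q<n with q ≟ y
    ... | yes refl = trans (update-hit a′ (suc q) (suc (f x))) (cong (suc ∘ f) (sym (swap-snd x q)))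
      where a′ = a [ suc x ↦ suc (f q) ]
    ... | no q≢y with q ≟ x
    ...   | yes refl = trans (update-miss (a [ suc q ↦ suc (f y) ]) (suc (f q)) (λ e → q≢y (sym (suc-injective e))))
                        (trans (update-hit a (suc q) (suc (f y))) (cong (suc ∘ f) (sym (swap-fst q y))))
    ...   | no q≢x = trans (update-miss (a [ suc x ↦ suc (f y) ]) (suc (f x)) (λ e → q≢y (sym (suc-injective e))))
                        (trans (update-miss a (suc (f y)) (λ e → q≢x (sym (suc-injective e))))
                        (trans (a≡ q q<n) (cong (suc ∘ f) (sym (swap-other q≢x q≢y)))))

  Range : (ℕ → ℕ) → Set
  Range f = ∀ q → q < n → f q < n

  exchange-runs : ∀ {x y f} → Range f → x < n → y < n → Runs 1 exchangeᶜ (frame (suc x ∷ suc y ∷ [])) f (f ∘ swap x y) [] 13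
  exchange-runs {x} {y} {f} f< x<n y<n =
    call-runs exchange₂ᵖ (var 0 ∷ var 1 ∷ cell perm (var 0) ∷ cell perm (var 1) ∷ []) (suc x ∷ suc y ∷ suc (f x) ∷ suc (f y) ∷ [])
      refl (frameOk (≤-trans x<n n≤B ∷ ≤-trans y<n n≤B ∷ []))
      (λ M → cong₂ (λ v w → suc x ∷ suc y ∷ v ∷ w ∷ []) (holds M x x<n) (holds M y y<n))
      (exchange₂-runs x<n y<n (f< x x<n) (f< y y<n))

  if-true : ∀ {b} → b ≡ true → (if b then 1 else 0) ≡ 1
  if-true refl = refl

  if-false : ∀ {b} → b ≡ false → (if b then 1 else 0) ≡ 0
  if-false refl = refl

  move₂-runs : ∀ {i u p g f} → Range f → i < n → u < n → p ≤ B → g ≤ B → reflect p g u < n →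
               Runs 2 move₂ᶜ (frame (suc i ∷ u ∷ p ∷ g ∷ [])) f (f ∘ swap i (reflect p g u)) [] 30
  move₂-runs {i} {u} {p} {g} {f} f< i<n u<n p≤ g≤ ρ<n = go
    where
    l≤ : LocalsOk (frame (suc i ∷ u ∷ p ∷ g ∷ []))
    l≤ = frameOk (≤-trans i<n n≤B ∷ ≤-trans (<⇒≤ u<n) n≤B ∷ p≤ ∷ g≤ ∷ [])
    args : ∀ {z} → z ≡ suc (reflect p g u) → _≡_ {A = List ℕ} (suc i ∷ z ∷ []) (suc i ∷ suc (reflect p g u) ∷ [])
    args = cong (λ z → suc i ∷ z ∷ [])
    go : Runs 2 move₂ᶜ (frame (suc i ∷ u ∷ p ∷ g ∷ [])) f (f ∘ swap i (reflect p g u)) [] 30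
    go with u <? g
    ... | yes u<g = slower 30 (true-runs (op lt (var 1) (var 3)) 0 l≤ (λ _ → if-true (<ᵇ-true u<g))
      (call-runs exchangeᵖ (var 0 ∷ var 3 ⊖ var 1 ∷ []) (suc i ∷ suc (reflect p g u) ∷ []) refl l≤
        (λ _ → args (trans (+-∸-assoc 1 u<g) (cong suc (sym (reflect-below {p} u<g))))) (exchange-runs f< i<n ρ<n)))
    ... | no u≮g with u <? p
    ...   | yes u<p = slower 30 (false-runs (op lt (var 1) (var 3)) l≤ (λ _ → if-false (<ᵇ-false (≮⇒≥ u≮g)))
      (true-runs (op lt (var 1) (var 2)) 0 l≤ (λ _ → if-true (<ᵇ-true u<p))
      (call-runs exchangeᵖ (var 0 ∷ var 3 ⊕ var 2 ⊖ var 1 ∷ []) (suc i ∷ suc (reflect p g u) ∷ []) refl l≤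
        (λ _ → args (trans (+-∸-assoc 1 (≤-trans u<p (m≤n+m p g))) (cong suc (sym (reflect-mid (≮⇒≥ u≮g) u<p)))))
        (exchange-runs f< i<n ρ<n))))
    ...   | no u≮p = slower 30 (false-runs (op lt (var 1) (var 3)) l≤ (λ _ → if-false (<ᵇ-false (≮⇒≥ u≮g)))
      (false-runs (op lt (var 1) (var 2)) l≤ (λ _ → if-false (<ᵇ-false (≮⇒≥ u≮p)))
      (call-runs exchangeᵖ (var 0 ∷ lit 1 ⊕ var 1 ∷ []) (suc i ∷ suc (reflect p g u) ∷ []) refl l≤
        (λ _ → args (cong suc (sym (reflect-above (≮⇒≥ u≮g) (≮⇒≥ u≮p)))))
        (exchange-runs f< i<n ρ<n))))

  move-runs : ∀ {i r u f} → Range f → suc i < n → u < i → r ≤ cap i →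
              Runs 3 moveᶜ (frame (suc (suc i) ∷ r ∷ u ∷ [])) f (f ∘ swap (suc i) (ρ r u)) [] 40
  -- The memory is taken before the call is analysed, since the bounds on the two table entries are
  -- read off its cells.
  move-runs {i} {r} {u} {f} f< i<n u<i r≤ = runs λ {m} M → run (slower 40
    (call-runs move₂ᵖ (var 0 ∷ var 2 ∷ cell 1 (var 1) ∷ cell 2 (var 1) ∷ []) (suc (suc i) ∷ u ∷ tableP r ∷ tableG r ∷ [])
      refl (frameOk (≤-trans i<n n≤B ∷ ≤-trans r≤n (cap≤B ≤-refl) ∷ ≤-trans (<⇒≤ u<n) n≤B ∷ []))
      (λ M → cong₂ (λ v w → suc (suc i) ∷ u ∷ v ∷ w ∷ []) (tablesP M r r≤n) (tablesG M r r≤n))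
      (move₂-runs f< i<n u<n (subst (_≤ B) (tablesP M r r≤n) (cells≤ M 1 r)) (subst (_≤ B) (tablesG M r r≤n) (cells≤ M 2 r))
        (<-trans (ρ-< {i} r≤ u<i) (<-trans (n<1+n i) i<n))))) M
    where
    i≤n = <⇒≤ (<-trans (n<1+n i) i<n)
    u<n = <-≤-trans u<i i≤n
    r≤n = ≤-trans r≤ (cap-mono i≤n)

  InRange : ∀ {ℓ} → (ℕ → ℕ) → Word ℓ → Set
  InRange ctx v = Range (λ q → ctx (decode v q))

  Range-decode : ∀ {ℓ ctx} (v : Word ℓ) → Range ctx → ℓ ≤ n → Valid v → InRange ctx v
  Range-decode v ctx< ℓ≤n Vv q q<n = ctx< _ (decode-< v Vv ℓ≤n q<n)

  lowest₂-valid : ∀ {i t s r} → t ≤ suc i → s ≤ i → r ≤ cap i → Valid (t ∷ s ∷ lowest i r)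
  lowest₂-valid {i} {r = r} t≤ s≤ r≤ = t≤ , s≤ , lowest-valid i r r≤

  module _ {ctx : ℕ → ℕ} (ctx< : Range ctx) {i} (i<n : suc i < n) where

    at : (t s r : ℕ) → ℕ → ℕ
    at t s r q = ctx (decode (t ∷ s ∷ lowest i r) q)

    at-range : ∀ {t s r} → t ≤ suc i → s ≤ i → r ≤ cap i → Range (at t s r)
    at-range {t} {s} {r} t≤ s≤ r≤ = Range-decode (t ∷ s ∷ lowest i r) ctx< i<n (lowest₂-valid t≤ s≤ r≤)

    -- Each exchange with its tests and calls stays within 80 operations; the 9 are the two failing
    -- comparisons and the `skip` at the end.
    walk-runs : ∀ {r t s t′ s′ k} → r ≤ cap i → s ≤ B → s′ ≤ B → Walk i r t s t′ s′ k →
                Runs (4 + k) walkᶜ (frame (suc (suc i) ∷ r ∷ s ∷ s′ ∷ [])) (at t s r) (at t′ s′ r) [] (9 + k * 80)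
    walk-runs {r} {t} {s} {t′} {s′} {k} r≤ s≤ s′≤ w = go w
      where
      r≤B = ≤-trans r≤ (cap≤B {i} (<⇒≤ (<-trans (n<1+n i) i<n)))
      l≤ : LocalsOk (frame (suc (suc i) ∷ r ∷ s ∷ s′ ∷ []))
      l≤ = frameOk (≤-trans i<n n≤B ∷ r≤B ∷ s≤ ∷ s′≤ ∷ [])
      go : ∀ {t k} → Walk i r t s t′ s′ k →
           Runs (4 + k) walkᶜ (frame (suc (suc i) ∷ r ∷ s ∷ s′ ∷ [])) (at t s r) (at t′ s′ r) [] (9 + k * 80)
      go stop =
        false-runs (op lt (var 3) (var 2)) l≤ (λ _ → if-false (<ᵇ-false {s} ≤-refl))
          (false-runs (op lt (var 2) (var 3)) l≤ (λ _ → if-false (<ᵇ-false {s} ≤-refl)) skip-runs)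
      go {t} (down {s = u} {n = k} t≤i u<i s′≤u w) =
        weaken ≤-refl (cost-≤ k) (true-runs (op lt (var 3) (var 2)) 0 l≤ (λ _ → if-true (<ᵇ-true (s≤s s′≤u)))
          (seq-runs
            (respects {g = at t (suc u) r ∘ swap (suc i) (ρ r u)} (λ q → cong ctx (decode-unit t≤i u<i r≤ q))
              (deeper (s≤s (s≤s (s≤s (s≤s z≤n)))) (call-runs moveᵖ (var 0 ∷ var 1 ∷ var 2 ⊖ lit 1 ∷ []) _ refl l≤ (λ _ → refl)
                (move-runs (at-range (m≤n⇒m≤1+n t≤i) u<i r≤) i<n u<i r≤))))
            (call-runs walkᵖ (var 0 ∷ var 1 ∷ var 2 ⊖ lit 1 ∷ var 3 ∷ []) _ refl l≤ (λ _ → refl)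
              (walk-runs r≤ (≤-trans (n≤1+n u) s≤) s′≤ w))))
        where
        cost-≤ : ∀ k → suc (3 + (46 + (7 + (9 + k * 80)))) ≤ 9 + suc k * 80
        cost-≤ k = +-monoˡ-≤ (k * 80) (≤ᵇ⇒≤ 66 89 tt)
      go {suc t} (up {s = u} {n = k} t≤i u<i u<s′ w) =
        weaken ≤-refl (cost-≤ k) (false-runs (op lt (var 3) (var 2)) l≤ (λ _ → if-false (<ᵇ-false (<⇒≤ u<s′)))
          (true-runs (op lt (var 2) (var 3)) 0 l≤ (λ _ → if-true (<ᵇ-true u<s′))
          (seq-runs
            (respects {g = at (suc t) u r ∘ swap (suc i) (ρ r u)} (λ q → cong ctx (decode-unit′ t≤i u<i r≤ q))
              (deeper (s≤s (s≤s (s≤s (s≤s z≤n)))) (call-runs moveᵖ (var 0 ∷ var 1 ∷ var 2 ∷ []) _ refl l≤ (λ _ → refl)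
                (move-runs (at-range (s≤s t≤i) (<⇒≤ u<i) r≤) i<n u<i r≤))))
            (call-runs walkᵖ (var 0 ∷ var 1 ∷ lit 1 ⊕ var 2 ∷ var 3 ∷ []) _ refl l≤ (λ _ → refl)
              (walk-runs r≤ (≤-trans u<s′ s′≤) s′≤ w)))))
        where
        cost-≤ : ∀ k → suc (3 + suc (3 + (44 + (7 + (9 + k * 80))))) ≤ 9 + suc k * 80
        cost-≤ k = +-monoˡ-≤ (k * 80) (≤ᵇ⇒≤ 68 89 tt)

map-zigzag : ∀ {A B : Set} (f : A → B) (F : ℕ → ℕ → List A) a b →
             zigzag (λ t σ → map f (F t σ)) a b ≡ map f (zigzag F a b)
map-zigzag f F a zero = refl
map-zigzag f F a (suc zero) = sym (trans (map-++ f (F a 2) _) (cong (map f (F a 2) ++_) (reverse-map f (F (suc a) 1))))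
map-zigzag f F a (suc (suc b)) = sym (trans (map-++ f (F a 2) _) (cong (map f (F a 2) ++_)
  (trans (map-++ f (zigzag F (suc (suc a)) b) _) (cong₂ _++_ (sym (map-zigzag f F (suc (suc a)) b)) (reverse-map f (F (suc a) 2))))))

-- Hops between sublists

module Generation (n : ℕ) (1≤n : 1 ≤ n) where

  open Machine n 1≤n

  module _ {ctx : ℕ → ℕ} (ctx< : Range ctx) {i} (i<n : suc i < n) where

    private
      i≤n : i ≤ n
      i≤n = <⇒≤ (<-trans (n<1+n i) i<n)

    walk≤2-runs : ∀ {r t s t′ s′ k} → r ≤ cap i → s ≤ B → s′ ≤ B → Walk i r t s t′ s′ k → k ≤ 2 →
                  Runs 6 walkᶜ (frame (suc (suc i) ∷ r ∷ s ∷ s′ ∷ [])) (at ctx< i<n t s r) (at ctx< i<n t′ s′ r) [] 169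
    walk≤2-runs r≤ s≤ s′≤ w k≤2 = weaken (+-monoʳ-≤ 4 k≤2) (+-monoʳ-≤ 9 (*-monoˡ-≤ 80 k≤2)) (walk-runs ctx< i<n r≤ s≤ s′≤ w)

    shift-runs : ∀ {t s r t′ s′ r′} → t ≤ suc i → t′ ≤ suc i → s ≤ B → s′ ≤ B → Transition i t s r t′ s′ r′ →
                 Runs 7 shiftᶜ (frame (suc i ∷ r ∷ s ∷ r′ ∷ s′ ∷ [])) (at ctx< i<n t s r) (at ctx< i<n t′ s′ r′) [] 300
    shift-runs {t} {s} {r} {t′} {s′} t≤ t′≤ s≤ s′≤ (walk r≤ w k≤2) = slower 300
      (seq-runs (false-runs (op lt (var 1) (var 3)) l≤ (λ _ → if-false (<ᵇ-false {r} ≤-refl)) skip-runs)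
      (seq-runs (call-runs walkᵖ _ (suc (suc i) ∷ r ∷ s ∷ s′ ∷ []) refl l≤
                  (λ _ → cong (λ z → suc (suc i) ∷ r + z ∷ s ∸ z ∷ s′ ∸ z ∷ []) (n∸n≡0 r) ■ cong (λ z → suc (suc i) ∷ z ∷ s ∷ s′ ∷ []) (+-identityʳ r))
                  (walk≤2-runs r≤ s≤ s′≤ w k≤2))
                (false-runs (op lt (var 3) (var 1)) l≤ (λ _ → if-false (<ᵇ-false {r} ≤-refl)) skip-runs)))
      where
      _■_ : {x y z : List ℕ} → x ≡ y → y ≡ z → x ≡ z
      _■_ = trans
      r≤B = ≤-trans r≤ (cap≤B i≤n)
      l≤ : LocalsOk (frame (suc i ∷ r ∷ s ∷ r ∷ s′ ∷ []))
      l≤ = frameOk (≤-trans (<⇒≤ i<n) n≤B ∷ r≤B ∷ s≤ ∷ r≤B ∷ s′≤ ∷ [])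
    shift-runs {t} {suc s} {r} {t′} {s′} t≤ t′≤ s≤ s′≤ (fill 2≤i full s<i w k≤2) = slower 300
      (seq-runs (true-runs (op lt (var 1) (var 3)) 0 l≤ (λ _ → if-true (<ᵇ-true (n<1+n r)))
                  (respects {g = at ctx< i<n t (suc s) r ∘ swap i 0} (λ q → cong (ctx ∘ rot (suc (suc i)) t) (decode-fill′ 2≤i full s<i q))
                    (deeper (s≤s (s≤s z≤n)) (call-runs exchangeᵖ (var 0 ∷ lit 1 ∷ []) (suc i ∷ 1 ∷ []) refl l≤ (λ _ → refl)
                      (exchange-runs (at-range ctx< i<n t≤ s<i r≤) (<-trans (n<1+n i) i<n) (≤-trans z<s i<n))))))
      (seq-runs (call-runs walkᵖ _ (suc (suc i) ∷ suc r ∷ s ∷ s′ ∷ []) refl l≤ (λ _ → args)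
                  (walk≤2-runs (≤-reflexive full) (≤-trans (n≤1+n s) s≤) s′≤ w k≤2))
                (false-runs (op lt (var 3) (var 1)) l≤ (λ _ → if-false (<ᵇ-false (n≤1+n r))) skip-runs)))
      where
      r≤ : r ≤ cap i
      r≤ = ≤-trans (n≤1+n r) (≤-reflexive full)
      1+r≤B = ≤-trans (≤-reflexive full) (cap≤B i≤n)
      l≤ : LocalsOk (frame (suc i ∷ r ∷ suc s ∷ suc r ∷ s′ ∷ []))
      l≤ = frameOk (≤-trans (<⇒≤ i<n) n≤B ∷ ≤-trans (n≤1+n r) 1+r≤B ∷ s≤ ∷ 1+r≤B ∷ s′≤ ∷ [])
      1≡ : suc r ∸ r ≡ 1
      1≡ = m+n∸n≡m 1 r
      0≡ : r ∸ suc r ≡ 0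
      0≡ = m≤n⇒m∸n≡0 (n≤1+n r)
      args : _≡_ {A = List ℕ} (suc (suc i) ∷ r + (suc r ∸ r) ∷ suc s ∸ (suc r ∸ r) ∷ s′ ∸ (r ∸ suc r) ∷ []) (suc (suc i) ∷ suc r ∷ s ∷ s′ ∷ [])
      args rewrite 1≡ | 0≡ | +-comm r 1 = refl
    shift-runs {t} {s} {suc r} {t′} {suc s′} t≤ t′≤ s≤ s′≤ (spill 2≤i full s′<i w k≤2) = slower 300
      (seq-runs (false-runs (op lt (var 1) (var 3)) l≤ (λ _ → if-false (<ᵇ-false (n≤1+n r))) skip-runs)
      (seq-runs (call-runs walkᵖ _ (suc (suc i) ∷ suc r ∷ s ∷ s′ ∷ []) refl l≤ (λ _ → args)
                  (walk≤2-runs (≤-reflexive full) s≤ (≤-trans (n≤1+n s′) s′≤) w k≤2))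
                (true-runs (op lt (var 3) (var 1)) 0 l≤ (λ _ → if-true (<ᵇ-true (n<1+n r)))
                  (respects {g = at ctx< i<n t′ s′ (suc r) ∘ swap i 0} (λ q → cong (ctx ∘ rot (suc (suc i)) t′) (decode-fill 2≤i full s′<i q))
                    (deeper (s≤s (s≤s z≤n)) (call-runs exchangeᵖ (var 0 ∷ lit 1 ∷ []) (suc i ∷ 1 ∷ []) refl l≤ (λ _ → refl)
                      (exchange-runs (at-range ctx< i<n t′≤ (<⇒≤ s′<i) (≤-reflexive full)) (<-trans (n<1+n i) i<n) (≤-trans z<s i<n))))))))
      where
      1+r≤B = ≤-trans (≤-reflexive full) (cap≤B i≤n)
      l≤ : LocalsOk (frame (suc i ∷ suc r ∷ s ∷ r ∷ suc s′ ∷ []))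
      l≤ = frameOk (≤-trans (<⇒≤ i<n) n≤B ∷ 1+r≤B ∷ s≤ ∷ ≤-trans (n≤1+n r) 1+r≤B ∷ s′≤ ∷ [])
      1≡ : suc r ∸ r ≡ 1
      1≡ = m+n∸n≡m 1 r
      0≡ : r ∸ suc r ≡ 0
      0≡ = m≤n⇒m∸n≡0 (n≤1+n r)
      args : _≡_ {A = List ℕ} (suc (suc i) ∷ suc r + (r ∸ suc r) ∷ s ∸ (r ∸ suc r) ∷ suc s′ ∸ (suc r ∸ r) ∷ []) (suc (suc i) ∷ suc r ∷ s ∷ s′ ∷ [])
      args rewrite 1≡ | 0≡ | +-identityʳ r = refl

    top≤i : ∀ q σ → top i (cap i) q σ ≤ i
    top≤i q σ = subst (_≤ i) (sym (trans (min′≡⊓ b (min′ i q)) (cong (b ⊓_) (min′≡⊓ i q))))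
      (≤-trans (m⊓n≤n b (i ⊓ q)) (m⊓n≤m i q))
      where b = bump (q ∸ cap i) σ

    hop-runs : ∀ {t q σ t′ q′ σ′} → t ≤ suc i → t′ ≤ suc i → q ≤ B → q′ ≤ B → σ ≤ B → σ′ ≤ B →
               Link i t q σ t′ q′ σ′ →
               Runs 9 hopᶜ (frame (suc i ∷ cap i ∷ q ∷ σ ∷ q′ ∷ σ′ ∷ []))
                 (λ x → ctx (decode (t ∷ endWord i q σ) x)) (λ x → ctx (decode (t′ ∷ endWord i q′ σ′) x)) [] 500
    hop-runs {t} {q} {σ} {t′} {q′} {σ′} t≤ t′≤ q≤ q′≤ σ≤ σ′≤ l = slower 500
      (call-runs hop₂ᵖ _ (suc i ∷ q ∷ s ∷ q′ ∷ s′ ∷ []) refl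
        (frameOk (j≤B ∷ cap≤B i≤n ∷ q≤ ∷ σ≤ ∷ q′≤ ∷ σ′≤ ∷ [])) (λ _ → refl)
        (call-runs shiftᵖ _ (suc i ∷ q ∸ s ∷ s ∷ q′ ∸ s′ ∷ s′ ∷ []) refl
          (frameOk (j≤B ∷ q≤ ∷ s≤ ∷ q′≤ ∷ s′≤ ∷ [])) (λ _ → refl)
          (shift-runs t≤ t′≤ s≤ s′≤ l)))
      where
      s = top i (cap i) q σ
      s′ = top i (cap i) q′ σ′
      j≤B = ≤-trans (<⇒≤ i<n) n≤B
      s≤ = ≤-trans (top≤i q σ) (≤-trans i≤n n≤B)
      s′≤ = ≤-trans (top≤i q′ σ′) (≤-trans i≤n n≤B)

  -- Traversal in both directions and amortised time

  RunsD : Bool → (D : ℕ) (c : Code) (l : Name → ℕ) (f g : ℕ → ℕ) (fs : List (ℕ → ℕ)) (τ : ℕ) → Set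
  RunsD true  D c l f g fs τ = Runs D c l f g fs τ
  RunsD false D c l f g fs τ = Runs D c l g f (reverse fs) τ

  weakenD : ∀ d {D D′ c l f g fs τ τ′} → D ≤ D′ → τ ≤ τ′ → RunsD d D c l f g fs τ → RunsD d D′ c l f g fs τ′
  weakenD true  = weaken
  weakenD false = weaken

  seqD : ∀ d {D c c′ l f g h fs gs τ τ′} → RunsD d D c l f g fs τ → RunsD d D c′ l g h gs τ′ →
         RunsD d D (c ⨾[ d ] c′) l f h (fs ++ gs) (τ + τ′)
  seqD true r r′ = seq-runs r r′
  seqD false {D} {c} {c′} {l} {f} {h = h} {fs} {gs} {τ} {τ′} r r′ =
    subst₂ (Runs D (c′ ⨾ c) l h f) (sym (reverse-++ fs gs)) (+-comm τ′ τ) (seq-runs r′ r)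

  flipD : ∀ d {D c l f g fs τ} → RunsD (not d) D c l g f fs τ → RunsD d D c l f g (reverse fs) τ
  flipD true r = r
  flipD false {D} {c} {l} {f} {g} {fs} {τ} r = subst (λ fs → Runs D c l g f fs τ) (sym (reverse-involutive fs)) r

  -- In Timed, the budget is K for each output, and k of it is left over.  An
  -- inner node of the recursion has at least two children, and what they leave
  -- over pays for the node.
  K : ℕ
  K = 6000

  record Timed (d : Bool) (D : ℕ) (c : Code) (l : Name → ℕ) (f g : ℕ → ℕ) (fs : List (ℕ → ℕ)) (k : ℕ) : Set where
    constructor timed
    field
      {τ}   : ℕ
      runsD : RunsD d D c l f g fs τ
      τ≤    : τ + k ≤ K * length fs

  deeperT : ∀ {d D D′ c l f g fs k} → D ≤ D′ → Timed d D c l f g fs k → Timed d D′ c l f g fs k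
  deeperT {d} D≤ (timed r τ≤) = timed (weakenD d D≤ ≤-refl r) τ≤

  lessT : ∀ {d D c l f g fs k} k′ → k′ ≤ k → Timed d D c l f g fs k → Timed d D c l f g fs k′
  lessT k′ k′≤k (timed {τ} r τ≤) = timed r (≤-trans (+-monoʳ-≤ τ k′≤k) τ≤)

  -- Pays an overhead `o` out of the reserve `k` and leaves `k′`. All three are concrete numbers in
  -- every use, so evaluation of `≤ᵇ` settles the condition.
  spend : ∀ {τ k X} o k′ → T (k′ + o ≤ᵇ k) → τ + k ≤ X → (o + τ) + k′ ≤ X
  spend {τ} {k} o k′ ok τ≤ = ≤-trans (≤-reflexive (regroup o τ k′)) (≤-trans (+-monoʳ-≤ τ (≤ᵇ⇒≤ (k′ + o) k ok)) τ≤)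
    where
    regroup : ∀ o τ k′ → (o + τ) + k′ ≡ τ + (k′ + o)
    regroup = solve-∀

  -- The heart of the amortisation: two sublists joined by a hop pool their reserves, out of which
  -- the hop is paid.
  seqT : ∀ {d D c c′ c″ l f g h u fs gs k k′} {τ} k″ {_ : T (k″ + τ ≤ᵇ k + k′)} → Timed d D c l f g fs k → RunsD d D c′ l g h [] τ →
         Timed d D c″ l h u gs k′ → Timed d D (c ⨾[ d ] (c′ ⨾[ d ] c″)) l f u (fs ++ gs) k″
  seqT {d} {fs = fs} {gs} {k} {k′} {τ} k″ {ok} (timed {τ₁} r₁ τ₁≤) r (timed {τ₂} r₂ τ₂≤) =
    timed (seqD d {fs = fs} r₁ (seqD d {fs = []} r r₂)) (begin
      τ₁ + (τ + τ₂) + k″       ≡⟨ regroup τ₁ τ τ₂ k″ ⟩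
      (τ₁ + τ₂) + (k″ + τ)     ≤⟨ +-monoʳ-≤ (τ₁ + τ₂) (≤ᵇ⇒≤ (k″ + τ) (k + k′) ok) ⟩
      (τ₁ + τ₂) + (k + k′)     ≡⟨ regroup′ τ₁ τ₂ k k′ ⟩
      (τ₁ + k) + (τ₂ + k′)     ≤⟨ +-mono-≤ τ₁≤ τ₂≤ ⟩
      K * length fs + K * length gs ≡⟨ *-distribˡ-+ K (length fs) (length gs) ⟨
      K * (length fs + length gs)   ≡⟨ cong (K *_) (length-++ fs) ⟨
      K * length (fs ++ gs)    ∎)
    where
    open ≤-Reasoning
    regroup : ∀ a t b k → a + (t + b) + k ≡ (a + b) + (k + t)
    regroup = solve-∀
    regroup′ : ∀ a b k k′ → (a + b) + (k + k′) ≡ (a + k) + (b + k′)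
    regroup′ = solve-∀

  flipT : ∀ {d D c l f g fs k} → Timed (not d) D c l g f fs k → Timed d D c l f g (reverse fs) k
  flipT {d} {fs = fs} (timed r τ≤) = timed (flipD d {fs = fs} r) (≤-trans τ≤ (≤-reflexive (cong (K *_) (sym (length-reverse fs)))))

  callD : ∀ d {D l f g fs τ body} p es vs {ok : T (smalls es)} → lookupᵛ procs p ≡ body → LocalsOk l →
          (∀ {m : Name → Contents} → map (eval ⟨ l , m ⟩) es ≡ vs) →
          RunsD d D body (frame vs) f g fs τ → RunsD d (suc D) (call p es) l f g fs (suc (sum (map cost es)) + τ)
  callD true  p es vs {ok} p≡ l≤ es≡ r = call-runs p es vs {ok} p≡ l≤ (λ _ → es≡) r
  callD false p es vs {ok} p≡ l≤ es≡ r = call-runs p es vs {ok} p≡ l≤ (λ _ → es≡) r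

  callT : ∀ {d D l f g fs k body} k′ p es vs {ok : T (smalls es)} {ok′ : T (k′ + suc (sum (map cost es)) ≤ᵇ k)} →
          lookupᵛ procs p ≡ body → LocalsOk l → (∀ {m : Name → Contents} → map (eval ⟨ l , m ⟩) es ≡ vs) →
          Timed d D body (frame vs) f g fs k → Timed d (suc D) (call p es) l f g fs k′
  callT {d} {fs = fs} {k} k′ p es vs {ok} {ok′} p≡ l≤ es≡ (timed r τ≤) =
    timed (callD d {fs = fs} p es vs {ok} p≡ l≤ es≡ r) (spend (suc (sum (map cost es))) k′ ok′ τ≤)

  trueT : ∀ {d D l f g fs k c c′} k′ e v {ok : T (small e)} {ok′ : T (k′ + suc (cost e) ≤ᵇ k)} →
          LocalsOk l → (∀ m → eval ⟨ l , m ⟩ e ≡ suc v) →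
          Timed d D c l f g fs k → Timed d D (cond e c c′) l f g fs k′
  trueT {true}  k′ e v {ok} {ok′} l≤ e≡ (timed r τ≤) = timed (true-runs e v {ok} l≤ e≡ r) (spend (suc (cost e)) k′ ok′ τ≤)
  trueT {false} k′ e v {ok} {ok′} l≤ e≡ (timed r τ≤) = timed (true-runs e v {ok} l≤ e≡ r) (spend (suc (cost e)) k′ ok′ τ≤)

  falseT : ∀ {d D l f g fs k c c′} k′ e {ok : T (small e)} {ok′ : T (k′ + suc (cost e) ≤ᵇ k)} →
           LocalsOk l → (∀ m → eval ⟨ l , m ⟩ e ≡ 0) →
           Timed d D c′ l f g fs k → Timed d D (cond e c c′) l f g fs k′
  falseT {true}  k′ e {ok} {ok′} l≤ e≡ (timed r τ≤) = timed (false-runs e {ok} l≤ e≡ r) (spend (suc (cost e)) k′ ok′ τ≤)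
  falseT {false} k′ e {ok} {ok′} l≤ e≡ (timed r τ≤) = timed (false-runs e {ok} l≤ e≡ r) (spend (suc (cost e)) k′ ok′ τ≤)

  image : ∀ {ℓ} → (ℕ → ℕ) → Word ℓ → ℕ → ℕ
  image ctx w q = ctx (decode w q)

  -- Bounds on the nesting inside `generateᶜ`, `nodeᶜ` and `zigzagᶜ`. A zigzag of parameter `b`
  -- nests at most `b` calls of itself, and the 11 leaves room for the calls inside a hop.
  depthG depthN : ℕ → ℕ
  depthZ : ℕ → ℕ → ℕ
  depthG zero    = 0
  depthG (suc i) = suc (depthN i)
  depthN i = suc (depthZ i (suc i))
  depthZ i b = b + (11 + depthG i)

  zigzag-lookup : ∀ d → lookupᵛ procs (zigzagᵖ d) ≡ zigzagᶜ d
  zigzag-lookup true  = refl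
  zigzag-lookup false = refl

  node-lookup : ∀ d → lookupᵛ procs (nodeᵖ d) ≡ nodeᶜ d
  node-lookup true  = refl
  node-lookup false = refl

  generate-lookup : ∀ d → lookupᵛ procs (generateᵖ d) ≡ generateᶜ d
  generate-lookup true  = refl
  generate-lookup false = refl

  -- `ctx` is the action of the higher digits on the values, which stays the same while the sublist
  -- is generated.
  Generates′ : ℕ → Set
  Generates′ i = ∀ {d m σ ctx} → Range ctx → End σ → m ≤ cap (suc i) → suc i ≤ n →
    Timed d (depthG i) (generateᶜ d) (frame (suc i ∷ m ∷ cap (suc i) ∷ σ ∷ []))
      (image ctx (endWord i m 0)) (image ctx (endWord i m σ)) (map (image ctx) (words i m σ)) 5000

  End≤2 : ∀ {σ} → End σ → σ ≤ 2
  End≤2 one = s≤s z≤n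
  End≤2 two = ≤-refl

  hopArgs : (q σ q′ σ′ : Expr) → List Expr
  hopArgs t σ t′ σ′ = var 0 ∷ var 2 ⊖ (var 0 ⊖ lit 1) ∷ var 1 ⊖ t ∷ σ ∷ var 1 ⊖ t′ ∷ σ′ ∷ []

  cheap : List Expr → Bool
  cheap es = smalls es ∧ (suc (sum (map cost es)) ≤ᵇ 100)

  module Node {i m} (x : Inner i m) (i<n : suc (suc i) ≤ n) {ctx} (ctx< : Range ctx) (generates : Generates′ i) where

    open Inner x

    P : ℕ → ℕ → ℕ → ℕ
    P t σ = image ctx (t ∷ endWord i (m ∸ t) σ)

    outs : ℕ → ℕ → List (ℕ → ℕ)
    outs t σ = map (image ctx) (child i m t σ)

    m≤B : m ≤ B
    m≤B = ≤-trans (<⇒≤ m<) (cap≤B i<n)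

    j≤B : j ≤ B
    j≤B = ≤-trans (<⇒≤ i<n) n≤B

    c≤B : c ≤ B
    c≤B = cap≤B (<⇒≤ i<n)

    2≤B : 2 ≤ B
    2≤B = ≤-trans (s≤s (s≤s z≤n)) 4≤B

    ctx-rot< : ∀ t → t ≤ h → Range (ctx ∘ rot (suc (suc i)) t)
    ctx-rot< t t≤h = λ q q<n → ctx< _ (rot-range q q<n)
      where
      t≤ : t ≤ suc (suc i)
      t≤ = m≤n⇒m≤1+n (≤-trans t≤h h≤j)
      rot-range : ∀ q → q < n → rot (suc (suc i)) t q < n
      rot-range q q<n with q <? suc (suc i)
      ... | yes q< = <-≤-trans (rot-< t≤ q<) i<n
      ... | no q≮ = subst (_< n) (sym (rot-hi t≤ (≮⇒≥ q≮))) q<n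

    module _ {vs : List ℕ} (vs≤ : All (_≤ B) vs) where

      private
        l : Name → ℕ
        l = frame (j ∷ m ∷ c ∷ vs)

        l≤ : LocalsOk l
        l≤ = frameOk (j≤B ∷ m≤B ∷ c≤B ∷ vs≤)

      generateAt-timed : ∀ {d t σ} te σe {ok : T (smalls (var 0 ∷ var 1 ⊖ te ∷ var 2 ∷ σe ∷ []))}
                         {ok′ : T (4900 + suc (sum (map cost (var 0 ∷ var 1 ⊖ te ∷ var 2 ∷ σe ∷ []))) ≤ᵇ 5000)} →
                         (∀ m → eval ⟨ l , m ⟩ te ≡ t) → (∀ m → eval ⟨ l , m ⟩ σe ≡ σ) → End σ → lo ≤ t → t ≤ h →
                         Timed d (suc (depthG i)) (generateAt d te σe) l (P t 0) (P t σ) (outs t σ) 4900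
      generateAt-timed {d} {t} {σ} te σe {ok} {ok′} te≡ σe≡ e lo≤t t≤h =
        callT 4900 (generateᵖ d) (var 0 ∷ var 1 ⊖ te ∷ var 2 ∷ σe ∷ []) (j ∷ m ∸ t ∷ c ∷ σ ∷ []) {ok} {ok′} (generate-lookup d) l≤
          (λ {M} → cong₂ (λ t σ → j ∷ m ∸ t ∷ c ∷ σ ∷ []) (te≡ M) (σe≡ M))
          (subst (λ fs → Timed d (depthG i) (generateᶜ d) (frame (j ∷ m ∸ t ∷ c ∷ σ ∷ [])) (P t 0) (P t σ) fs 5000) (map-∘ (words i (m ∸ t) σ))
            (generates {d} {m ∸ t} {σ} {ctx ∘ rot (suc (suc i)) t} (ctx-rot< t t≤h) e (m∸t≤c lo≤t) (<⇒≤ i<n)))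

      hopAt-runs : ∀ d {t σ t′ σ′} te σe te′ σe′ {ok : T (cheap (hopArgs te σe te′ σe′))} {ok′ : T (cheap (hopArgs te′ σe′ te σe))} →
                   (∀ m → eval ⟨ l , m ⟩ te ≡ t) → (∀ m → eval ⟨ l , m ⟩ σe ≡ σ) →
                   (∀ m → eval ⟨ l , m ⟩ te′ ≡ t′) → (∀ m → eval ⟨ l , m ⟩ σe′ ≡ σ′) →
                   σ ≤ 2 → σ′ ≤ 2 → t ≤ h → t′ ≤ h →
                   Linked₂ i t (m ∸ t) σ t′ (m ∸ t′) σ′ →
                   RunsD d 10 (hopAt d te σe te′ σe′) l (P t σ) (P t′ σ′) [] 600
      hopAt-runs d {t} {σ} {t′} {σ′} te σe te′ σe′ {ok} {ok′} te≡ σe≡ te′≡ σe′≡ σ≤ σ′≤ t≤h t′≤h lk = go d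
        where
        one-way : ∀ {t σ t′ σ′} te σe te′ σe′ → T (cheap (hopArgs te σe te′ σe′)) →
                  (∀ m → eval ⟨ l , m ⟩ te ≡ t) → (∀ m → eval ⟨ l , m ⟩ σe ≡ σ) →
                  (∀ m → eval ⟨ l , m ⟩ te′ ≡ t′) → (∀ m → eval ⟨ l , m ⟩ σe′ ≡ σ′) →
                  σ ≤ 2 → σ′ ≤ 2 → t ≤ h → t′ ≤ h → Link i t (m ∸ t) σ t′ (m ∸ t′) σ′ →
                  Runs 10 (call hopᵖ (hopArgs te σe te′ σe′)) l (P t σ) (P t′ σ′) [] 600
        one-way {t} {σ} {t′} {σ′} te σe te′ σe′ ok te≡ σe≡ te′≡ σe′≡ σ≤ σ′≤ t≤h t′≤h lk =
          weaken ≤-refl (+-monoˡ-≤ 500 (≤ᵇ⇒≤ (suc (sum (map cost (hopArgs te σe te′ σe′)))) 100 (∧-snd {smalls (hopArgs te σe te′ σe′)} ok)))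
            (call-runs hopᵖ (hopArgs te σe te′ σe′) (j ∷ cap i ∷ m ∸ t ∷ σ ∷ m ∸ t′ ∷ σ′ ∷ []) {∧-fst ok} refl l≤ (λ {M} _ → args M)
              (hop-runs ctx< i<n (≤-trans t≤h h≤j) (≤-trans t′≤h h≤j) (≤-trans (m∸n≤m m t) m≤B) (≤-trans (m∸n≤m m t′) m≤B)
                (≤-trans σ≤ 2≤B) (≤-trans σ′≤ 2≤B) lk))
          where
          args : ∀ M → map (eval ⟨ l , M ⟩) (hopArgs te σe te′ σe′) ≡ j ∷ cap i ∷ m ∸ t ∷ σ ∷ m ∸ t′ ∷ σ′ ∷ []
          args M rewrite te≡ M | σe≡ M | te′≡ M | σe′≡ M | m+n∸m≡n i (cap i) = refl
        go : ∀ d → RunsD d 10 (hopAt d te σe te′ σe′) l (P t σ) (P t′ σ′) [] 600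
        go true  = one-way te σe te′ σe′ ok te≡ σe≡ te′≡ σe′≡ σ≤ σ′≤ t≤h t′≤h (forth lk)
        go false = one-way te′ σe′ te σe ok′ te′≡ σe′≡ te≡ σe≡ σ′≤ σ≤ t′≤h t≤h (back lk)

    -- A single child leaves less than a node owes to its parent; two children leave enough to pay
    -- for the node as well. The surplus of longer zigzags is dropped, so that the bound does not
    -- depend on their length.
    slack : ℕ → ℕ
    slack zero    = 4800
    slack (suc b) = 7000

    4800≤slack : ∀ b → 4800 ≤ slack b
    4800≤slack zero    = ≤-refl
    4800≤slack (suc b) = ≤ᵇ⇒≤ 4800 7000 tt

    finalσ≤2 : ∀ a b → finalσ a b ≤ 2
    finalσ≤2 a zero    = s≤s z≤n
    finalσ≤2 a (suc b) = z≤n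

    finalT≤h : ∀ a b → a + b ≡ h → finalT a b ≤ h
    finalT≤h a zero    a≡h = ≤-reflexive (trans (sym (+-identityʳ a)) a≡h)
    finalT≤h a (suc b) sum≡h = subst (suc a ≤_) (trans (sym (+-suc a b)) sum≡h) (m≤m+n (suc a) b)

    zigzag-timed : ∀ {d} a b → lo ≤ a → a + b ≡ h →
                   Timed d (depthZ i b) (zigzagᶜ d) (frame (j ∷ m ∷ c ∷ a ∷ b ∷ []))
                     (P a 0) (P (finalT a b) (finalσ a b)) (zigzag outs a b) (slack b)
    zigzag-timed {d} a zero lo≤a a≡h =
      trueT 4800 (op eq (var 4) (lit 0)) 0 (frameOk (j≤B ∷ m≤B ∷ c≤B ∷ a≤B ∷ z≤n ∷ [])) (λ _ → refl)
        (deeperT (+-monoˡ-≤ (depthG i) (s≤s (z≤n {10}))) (generateAt-timed (a≤B ∷ z≤n ∷ []) (var 3) (lit 1) (λ _ → refl) (λ _ → refl) one lo≤a a≤h))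
      where
      a≤h : a ≤ h
      a≤h = ≤-reflexive (trans (sym (+-identityʳ a)) a≡h)
      a≤B = ≤-trans a≤h (≤-trans h≤m m≤B)
    zigzag-timed {d} a (suc zero) lo≤a sum≡h =
      falseT 7000 (op eq (var 4) (lit 0)) l≤ (λ _ → refl)
        (trueT 7500 (op eq (var 4) (lit 1)) 0 l≤ (λ _ → refl)
          (seqT 9000 (deeperT dep (generateAt-timed vs≤ (var 3) (lit 2) (λ _ → refl) (λ _ → refl) two lo≤a (<⇒≤ a<h)))
            (weakenD d dep′ ≤-refl (hopAt-runs vs≤ d (var 3) (lit 2) (lit 1 ⊕ var 3) (lit 1) (λ _ → refl) (λ _ → refl) (λ _ → refl) (λ _ → refl)
              ≤-refl (s≤s z≤n) (<⇒≤ a<h) a<h (hop₂₁ lo≤a a<h)))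
            (flipT (deeperT dep (generateAt-timed vs≤ (lit 1 ⊕ var 3) (lit 1) (λ _ → refl) (λ _ → refl) one (m≤n⇒m≤1+n lo≤a) a<h)))))
      where
      a<h : suc a ≤ h
      a<h = ≤-reflexive (trans (+-comm 1 a) sum≡h)
      vs≤ = ≤-trans (<⇒≤ a<h) (≤-trans h≤m m≤B) ∷ ≤-trans (s≤s z≤n) 4≤B ∷ []
      l≤ = frameOk (j≤B ∷ m≤B ∷ c≤B ∷ vs≤)
      dep : suc (depthG i) ≤ depthZ i 1
      dep = +-monoˡ-≤ (depthG i) (s≤s (z≤n {11}))
      dep′ : 10 ≤ depthZ i 1
      dep′ = ≤-trans (≤ᵇ⇒≤ 10 12 tt) (m≤m+n 12 (depthG i))
    zigzag-timed {d} a (suc (suc b)) lo≤a sum≡h =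
      falseT 7000 (op eq (var 4) (lit 0)) l≤ (λ _ → refl)
        (falseT 7500 (op eq (var 4) (lit 1)) l≤ (λ _ → refl)
          (seqT 10000 (deeperT dep (generateAt-timed vs≤ (var 3) (lit 2) (λ _ → refl) (λ _ → refl) two lo≤a (<⇒≤ (<⇒≤ a<h))))
            (weakenD d dep′ ≤-refl (hopAt-runs vs≤ d (var 3) (lit 2) (lit 2 ⊕ var 3) (lit 0) (λ _ → refl) (λ _ → refl) (λ _ → refl) (λ _ → refl)
              ≤-refl z≤n (<⇒≤ (<⇒≤ a<h)) a<h (hop₂₀ lo≤a a<h)))
            (seqT 9000
              (deeperT (n≤1+n _) (callT 4700 (zigzagᵖ d) (var 0 ∷ var 1 ∷ var 2 ∷ lit 2 ⊕ var 3 ∷ var 4 ⊖ lit 2 ∷ []) (j ∷ m ∷ c ∷ suc (suc a) ∷ b ∷ [])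
                (zigzag-lookup d) l≤ refl
                (lessT 4800 (4800≤slack b) (zigzag-timed {d} (suc (suc a)) b (m≤n⇒m≤1+n (m≤n⇒m≤1+n lo≤a)) sum≡h′))))
              (weakenD d dep′ ≤-refl (hopAt-runs vs≤ d (op lt (lit 2) (var 4) ⊕ (lit 2 ⊕ var 3)) (op eq (var 4) (lit 2)) (lit 1 ⊕ var 3) (lit 2)
                (λ _ → finalT≡ b) (λ _ → finalσ≡ b) (λ _ → refl) (λ _ → refl)
                (finalσ≤2 (suc (suc a)) b) ≤-refl (finalT≤h (suc (suc a)) b sum≡h′) (<⇒≤ a<h)
                -- `hopFinal` leads from `suc a` to the end of the inner zigzag, and the list runs
                -- the other way.
                (links (back hf) (forth hf))))
              (flipT (deeperT dep (generateAt-timed vs≤ (lit 1 ⊕ var 3) (lit 2) (λ _ → refl) (λ _ → refl) two (m≤n⇒m≤1+n lo≤a) (<⇒≤ a<h)))))))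
      where
      sum≡h′ : suc (suc a) + b ≡ h
      sum≡h′ = trans (sym (trans (+-suc a (suc b)) (cong suc (+-suc a b)))) sum≡h
      a<h : suc (suc a) ≤ h
      a<h = subst (suc (suc a) ≤_) sum≡h′ (m≤m+n _ b)
      hf = hopFinal b lo≤a sum≡h′
      h≤B = ≤-trans h≤m m≤B
      vs≤ : All (_≤ B) (a ∷ suc (suc b) ∷ [])
      vs≤ = ≤-trans (<⇒≤ (<⇒≤ a<h)) h≤B ∷ ≤-trans (subst (suc (suc b) ≤_) sum≡h (m≤n+m (suc (suc b)) a)) h≤B ∷ []
      l≤ = frameOk (j≤B ∷ m≤B ∷ c≤B ∷ vs≤)
      dep : suc (depthG i) ≤ depthZ i (suc (suc b))
      dep = ≤-trans (+-monoˡ-≤ (depthG i) (s≤s (z≤n {10}))) (m≤n+m (11 + depthG i) (suc (suc b)))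
      dep′ : 10 ≤ depthZ i (suc (suc b))
      dep′ = ≤-trans (≤-trans (≤ᵇ⇒≤ 10 11 tt) (m≤m+n 11 (depthG i))) (m≤n+m (11 + depthG i) (suc (suc b)))
      finalT≡ : ∀ b → ⟦ 2 < suc (suc b) ⟧ + suc (suc a) ≡ finalT (suc (suc a)) b
      finalT≡ zero    = refl
      finalT≡ (suc b) = refl
      finalσ≡ : ∀ b → (if suc (suc b) ≡ᵇ 2 then 1 else 0) ≡ finalσ (suc (suc a)) b
      finalσ≡ zero    = refl
      finalσ≡ (suc b) = refl

-- The recursion over nodes and leaves

module Main (n : ℕ) (1≤n : 1 ≤ n) where

  open Machine n 1≤n
  open Generation n 1≤n

  retarget : ∀ {d D c l f f′ g g′ fs fs′ k} → f ≡ f′ → g ≡ g′ → fs ≡ fs′ → Timed d D c l f g fs k → Timed d D c l f′ g′ fs′ k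
  retarget refl refl refl r = r

  module _ {i m} (x : Inner i m) (i<n : suc (suc i) ≤ n) {ctx} (ctx< : Range ctx) (generates : Generates′ i) where

    open Inner x
    open Node x i<n ctx< generates

    finalP : ∀ a b → 0 < b → P (finalT a b) (finalσ a b) ≡ P (suc a) 0
    finalP a (suc b) _ = refl

    7000≤slack : ∀ {b} → 0 < b → 7000 ≤ slack b
    7000≤slack {suc b} _ = ≤-refl

    node-timed : ∀ {d σ} → End σ →
                 Timed d (depthN i) (nodeᶜ d) (frame (j ∷ m ∷ c ∷ σ ∷ []))
                   (image ctx (endWord j m 0)) (image ctx (endWord j m σ)) (map (image ctx) (words j m σ)) 6700
    node-timed {d} {σ} e = go (words-branches x e)
      where
      σ≤B = ≤-trans (End≤2 e) 2≤B
      l≤ = frameOk (j≤B ∷ m≤B ∷ c≤B ∷ σ≤B ∷ [])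
      start≡ : ∀ {t} → lo ≡ t → P t 0 ≡ image ctx (endWord j m 0)
      start≡ refl = cong (image ctx) (sym (endWord-point n x i<n 0 ≤-refl top-0))
      end≡ : ∀ {a b s} → 0 < b → suc a ≡ s → lo ≤ s → top j c m σ ≡ s → P (finalT a b) (finalσ a b) ≡ image ctx (endWord j m σ)
      end≡ {a} {b} b>0 refl lo≤s top≡ = trans (finalP a b b>0) (cong (image ctx) (sym (endWord-point n x i<n σ lo≤s top≡)))
      zigzag≤ : ∀ a b → a + b ≡ h → depthZ i b ≤ depthZ i j
      zigzag≤ a b sum≡h = +-monoˡ-≤ (11 + depthG i) (≤-trans (subst (b ≤_) sum≡h (m≤n+m b a)) h≤j)
      go : ∀ {ws} → Branches x σ ws → Timed d (depthN i) (nodeᶜ d) (frame (j ∷ m ∷ c ∷ σ ∷ []))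
             (image ctx (endWord j m 0)) (image ctx (endWord j m σ)) (map (image ctx) ws) 6700
      go (plain top≡ refl) =
        falseT 6700 (topᵉ (var 0) (var 2) (var 1) (var 3) ⊖ (lit 1 ⊕ (var 1 ⊖ var 2))) l≤
          (λ _ → trans (cong (_∸ suc lo) top≡) (n∸n≡0 (suc lo)))
          (retarget (start≡ refl) (end≡ (m<n⇒0<n∸m lo<h) refl (n≤1+n lo) top≡) (map-zigzag (image ctx) (child i m) lo (h ∸ lo))
              (callT 6900 (zigzagᵖ d) (var 0 ∷ var 1 ∷ var 2 ∷ var 1 ⊖ var 2 ∷ minᵉ (var 0) (var 1) ⊖ (var 1 ⊖ var 2) ∷ [])
                (j ∷ m ∷ c ∷ lo ∷ h ∸ lo ∷ []) (zigzag-lookup d) l≤ refl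
                (lessT 7000 (7000≤slack (m<n⇒0<n∸m lo<h)) (deeperT (zigzag≤ lo (h ∸ lo) lo+) (zigzag-timed lo (h ∸ lo) ≤-refl lo+)))))
        where
        lo+ : lo + (h ∸ lo) ≡ h
        lo+ = m+[n∸m]≡n (<⇒≤ lo<h)
      go (extra lo≡0 top≡ 2≤h refl) =
        trueT 6700 (topᵉ (var 0) (var 2) (var 1) (var 3) ⊖ (lit 1 ⊕ (var 1 ⊖ var 2))) 0 l≤
          (λ _ → cong₂ (λ s l → s ∸ suc l) top≡ lo≡0)
          (retarget (start≡ lo≡0) (end≡ (m<n⇒0<n∸m 2≤h) refl (≤-trans (≤-reflexive lo≡0) z≤n) top≡)
              (trans (cong (outs 0 1 ++_) (map-zigzag (image ctx) (child i m) 1 (h ∸ 1))) (sym (map-++ (image ctx) (child i m 0 1) _)))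
              (seqT 8000
                (deeperT dep (generateAt-timed (σ≤B ∷ []) (lit 0) (lit 1) (λ _ → refl) (λ _ → refl) one (≤-reflexive lo≡0) z≤n))
                (weakenD d dep′ ≤-refl (hopAt-runs (σ≤B ∷ []) d (lit 0) (lit 1) (lit 1) (lit 0) (λ _ → refl) (λ _ → refl) (λ _ → refl) (λ _ → refl)
                  (s≤s z≤n) z≤n z≤n (<⇒≤ 2≤h) (hop₁₀ (≤-reflexive lo≡0) (<⇒≤ 2≤h))))
                (callT 6900 (zigzagᵖ d) (var 0 ∷ var 1 ∷ var 2 ∷ lit 1 ∷ minᵉ (var 0) (var 1) ⊖ lit 1 ∷ [])
                  (j ∷ m ∷ c ∷ 1 ∷ h ∸ 1 ∷ []) (zigzag-lookup d) l≤ refl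
                  (lessT 7000 (7000≤slack (m<n⇒0<n∸m 2≤h)) (deeperT (zigzag≤ 1 (h ∸ 1) 1+) (zigzag-timed 1 (h ∸ 1) (≤-trans (≤-reflexive lo≡0) z≤n) 1+))))))
        where
        1+ : 1 + (h ∸ 1) ≡ h
        1+ = m+[n∸m]≡n (<⇒≤ 2≤h)
        dep : suc (depthG i) ≤ depthN i
        dep = s≤s (≤-trans (m≤n+m (depthG i) 11) (m≤n+m (11 + depthG i) j))
        dep′ : 10 ≤ depthN i
        dep′ = ≤-trans (≤-trans (≤ᵇ⇒≤ 10 11 tt) (m≤m+n 11 (depthG i))) (≤-trans (m≤n+m (11 + depthG i) j) (n≤1+n _))

  output-timed : ∀ d {D l f} → Timed d D output l f f (f ∷ []) 5900
  output-timed true  = timed output-runs (≤ᵇ⇒≤ 5901 6000 tt)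
  output-timed false = timed output-runs (≤ᵇ⇒≤ 5901 6000 tt)

  singleton-timed : ∀ d {D l ℓ ctx} {v w : Word ℓ} {ws} → w ≡ v → ws ≡ v ∷ [] →
                    Timed d D output l (image ctx v) (image ctx w) (map (image ctx) ws) 5900
  singleton-timed d refl refl = output-timed d

  -- A leaf spends only a few operations of the budget of its output. An inner node is left with
  -- 6700 by its children, which covers the call of `nodeᶜ` and the two tests before it down to the
  -- 5000 promised to the parent.
  generate-timed : ∀ i → Generates′ i
  generate-timed zero {d} {zero} {σ} {ctx} ctx< e _ 1≤n =
    trueT 5000 (op eq (var 1) (lit 0)) 0 (frameOk (≤-trans 1≤n n≤B ∷ z≤n ∷ z≤n ∷ ≤-trans (End≤2 e) (≤-trans (s≤s (s≤s z≤n)) 4≤B) ∷ []))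
      (λ _ → refl) (singleton-timed d {ctx = ctx} (endWord-zero 0 σ) refl)
  generate-timed (suc i) {d} {m} {σ} {ctx} ctx< e m≤ i<n = go (kind i m≤)
    where
    l≤ = frameOk (≤-trans i<n n≤B ∷ ≤-trans m≤ (cap≤B i<n) ∷ cap≤B i<n ∷ ≤-trans (End≤2 e) (≤-trans (s≤s (s≤s z≤n)) 4≤B) ∷ [])
    go : Kind i m → Timed d (depthG (suc i)) (generateᶜ d) (frame (suc (suc i) ∷ m ∷ cap (suc (suc i)) ∷ σ ∷ []))
           (image ctx (endWord (suc i) m 0)) (image ctx (endWord (suc i) m σ)) (map (image ctx) (words (suc i) m σ)) 5000
    go (empty refl) = trueT 5000 (op eq (var 1) (lit 0)) 0 l≤ (λ _ → refl)
      (singleton-timed d {ctx = ctx} (endWord-zero (suc i) σ) (words-empty (suc i) σ))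
    go (filled refl) = falseT 5000 (op eq (var 1) (lit 0)) l≤ (λ _ → refl)
      (trueT 5500 (op eq (var 1) (var 2)) 0 l≤ (λ _ → if-true (≡ᵇ-true m))
        (singleton-timed d {ctx = ctx} (endWord-full (suc i) σ) (words-full (suc i) σ)))
    go (inner x) = falseT 5000 (op eq (var 1) (lit 0)) l≤ (λ _ → if-false (≡ᵇ-false (>⇒≢ (Inner.m>0 x))))
      (falseT 5500 (op eq (var 1) (var 2)) l≤ (λ _ → if-false (≡ᵇ-false (<⇒≢ (Inner.m< x))))
        (callT 6000 (nodeᵖ d) (var 0 ⊖ lit 1 ∷ var 1 ∷ var 2 ⊖ (var 0 ⊖ lit 1) ∷ var 3 ∷ []) (suc i ∷ m ∷ cap (suc i) ∷ σ ∷ [])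
          (node-lookup d) l≤ (cong (λ c → suc i ∷ m ∷ c ∷ σ ∷ []) (m+n∸m≡n (suc i) (cap (suc i))))
          (node-timed x i<n ctx< (generate-timed i) e)))

-- Initialisation of the tables and of the first permutation

tableP≤ : ∀ r → tableP r ≤ suc r
tableG≤ : ∀ r → tableG r ≤ r
tableP≤ zero = ≤-refl
tableP≤ (suc r) with table r | tableP≤ r
... | p , zero  | p≤ = s≤s p≤
... | p , suc g | p≤ = m≤n⇒m≤1+n p≤
tableG≤ zero = z≤n
tableG≤ (suc r) with table r | tableP≤ r | tableG≤ r
... | zero , zero   | _  | _  = z≤n
... | suc p , zero  | p≤ | _  = m≤n⇒m≤1+n (s≤s⁻¹ p≤)
... | p , suc g     | _  | g≤ = m≤n⇒m≤1+n (≤-trans (n≤1+n g) g≤)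

cap-formula : ∀ n → (n * (n ∸ 1)) / 2 ≡ cap n
cap-formula zero = refl
cap-formula (suc n) = trans (cong (_/ 2) (sym (double n))) (m*n/n≡m (cap (suc n)) 2)
  where
  step′ : ∀ n c → (suc n + c) * 2 ≡ c * 2 + (suc n + suc n)
  step′ = solve-∀
  step″ : ∀ n → suc n * n + (suc n + suc n) ≡ suc (suc n) * suc n
  step″ = solve-∀
  double : ∀ n → cap (suc n) * 2 ≡ suc n * n
  double zero = refl
  double (suc n) = trans (step′ n (cap (suc n))) (trans (cong (_+ (suc n + suc n)) (double n)) (step″ n))

module Initialisation (n : ℕ) (1≤n : 1 ≤ n) where

  open Machine n 1≤n
  open Generation n 1≤n
  open Main n 1≤n

  r+2≤B : ∀ {r} → r ≤ cap n → suc (suc r) ≤ B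
  r+2≤B r≤ = ≤-trans (s≤s (s≤s (≤-trans r≤ (cap≤n² n))))
    (≤-trans (+-monoˡ-≤ (n ^ 2) (*-monoʳ-≤ 2 (≤-trans 1≤n n≤n²))) (≤-trans (≤-reflexive (three (n ^ 2))) (m≤n+m (3 * n ^ 2) (n ^ 2))))
    where
    three : ∀ x → 2 * x + x ≡ 3 * x
    three = solve-∀

  record Tables (r : ℕ) (m : Name → Contents) : Set where
    field
      P≡ : ∀ q → q < r → m 1 q ≡ tableP q
      G≡ : ∀ q → q < r → m 2 q ≡ tableG q
      values≤ : ∀ a i → m a i ≤ B

  open Tables

  extendTable : ∀ {a : Contents} {r} (t : ℕ → ℕ) → (∀ q → q < r → a q ≡ t q) → ∀ q → q < suc r → (a [ r ↦ t r ]) q ≡ t q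
  extendTable {a} {r} t a≡ q q<1+r with q ≟ r
  ... | yes refl = update-hit a q (t q)
  ... | no q≢r = trans (update-miss a (t r) (q≢r ∘ sym)) (a≡ q (≤∧≢⇒< (s≤s⁻¹ q<1+r) q≢r))

  TableResult : (rem r p g : ℕ) (m : Name → Contents) → Set
  TableResult rem r p g m = ∃[ m′ ] ∃[ t ]
    Exec W procs rem fillTableᶜ ⟨ frame (r ∷ p ∷ g ∷ rem ∷ []) , m ⟩ ⟨ frame (r ∷ p ∷ g ∷ rem ∷ []) , m′ ⟩ [] t
    × Tables (suc (cap n)) m′ × t ≤ 50 * suc rem

  -- Stated for arbitrary `p` and `g`, so that the two cases of `nextTable` are matched on a
  -- variable instead of the table entry `tableG r`.
  continue : ∀ {r rem m m′ t} p g → Bounded B 4≤B ⟨ frame (r ∷ p ∷ g ∷ suc rem ∷ []) , m ⟩ →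
             let p′ = proj₁ (nextTable (p , g)); g′ = proj₂ (nextTable (p , g)) in
             Exec W procs rem fillTableᶜ ⟨ frame (suc r ∷ p′ ∷ g′ ∷ rem ∷ []) , m ⟩ ⟨ frame (suc r ∷ p′ ∷ g′ ∷ rem ∷ []) , m′ ⟩ [] t →
             ∃[ τ ] Exec W procs (suc rem)
               (cond (op eq (var 2) (lit 0))
                 (call fillTableᵖ (lit 1 ⊕ var 0 ∷ lit 1 ⊕ var 1 ∷ var 1 ⊖ lit 1 ∷ var 3 ⊖ lit 1 ∷ []))
                 (call fillTableᵖ (lit 1 ⊕ var 0 ∷ var 1 ∷ var 2 ⊖ lit 1 ∷ var 3 ⊖ lit 1 ∷ [])))
               ⟨ frame (r ∷ p ∷ g ∷ suc rem ∷ []) , m ⟩ ⟨ frame (r ∷ p ∷ g ∷ suc rem ∷ []) , m′ ⟩ [] τ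
             × τ ≤ 18 + t
  continue {t = t} p zero b x = _ ,
    cond-true (fits B 4≤B b (op eq (var 2) (lit 0))) (λ ())
      (call (all-fits B 4≤B b (lit 1 ⊕ var 0 ∷ lit 1 ⊕ var 1 ∷ var 1 ⊖ lit 1 ∷ var 3 ⊖ lit 1 ∷ [])) x) ,
    +-monoˡ-≤ t (≤ᵇ⇒≤ 17 18 tt)
  continue {t = t} p (suc g) b x = _ ,
    cond-false (fits B 4≤B b (op eq (var 2) (lit 0))) refl
      (call (all-fits B 4≤B b (lit 1 ⊕ var 0 ∷ var 1 ∷ var 2 ⊖ lit 1 ∷ var 3 ⊖ lit 1 ∷ [])) x) ,
    +-monoˡ-≤ t (≤ᵇ⇒≤ 15 18 tt)

  fillTable-exec : ∀ rem {r m} → rem + r ≡ cap n → Tables r m → TableResult rem r (tableP r) (tableG r) m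
  fillTable-exec rem {r} {m} sum≡ M = go rem sum≡
    where
    p g : ℕ
    p = tableP r
    g = tableG r
    r≤ : r ≤ cap n
    r≤ = subst (r ≤_) sum≡ (m≤n+m r rem)
    n≤ : ∀ {x} → x ≤ suc (suc r) → x ≤ B
    n≤ x≤ = ≤-trans x≤ (r+2≤B r≤)
    l≤ : ∀ {rem} → rem ≤ cap n → LocalsOk (frame (r ∷ p ∷ g ∷ rem ∷ []))
    l≤ rem≤ = frameOk (n≤ (≤-trans (n≤1+n r) (n≤1+n _)) ∷ n≤ (≤-trans (tableP≤ r) (n≤1+n _)) ∷ n≤ (≤-trans (tableG≤ r) (≤-trans (n≤1+n r) (n≤1+n _)))
      ∷ ≤-trans rem≤ (cap≤B ≤-refl) ∷ [])
    m₁ m₂ : Name → Contents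
    m₁ = m [ 1 ↦ (m 1) [ r ↦ p ] ]
    m₂ = m₁ [ 2 ↦ (m₁ 2) [ r ↦ g ] ]
    m₁≤ : ∀ a i → m₁ a i ≤ B
    m₁≤ = updates-≤ {m} (values≤ M) (update-≤ (values≤ M 1) r (n≤ (≤-trans (tableP≤ r) (n≤1+n _)))) 1
    M₂ : Tables (suc r) m₂
    M₂ = record
      { P≡ = extendTable {m 1} tableP (P≡ M)
      ; G≡ = extendTable {m 2} tableG (G≡ M)
      ; values≤ = updates-≤ {m₁} m₁≤ (update-≤ (m₁≤ 2) r (n≤ (≤-trans (tableG≤ r) (≤-trans (n≤1+n r) (n≤1+n _))))) 2 }
    stores : ∀ {D rem c m′ ts t} → rem ≤ cap n → Exec W procs D c ⟨ frame (r ∷ p ∷ g ∷ rem ∷ []) , m₂ ⟩ ⟨ frame (r ∷ p ∷ g ∷ rem ∷ []) , m′ ⟩ ts t →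
             Exec W procs D (store 1 (var 0) (var 1) ⨾ store 2 (var 0) (var 2) ⨾ c)
               ⟨ frame (r ∷ p ∷ g ∷ rem ∷ []) , m ⟩ ⟨ frame (r ∷ p ∷ g ∷ rem ∷ []) , m′ ⟩ ts (3 + (3 + t))
    stores {rem = rem} rem≤ x =
      let b = bounded {B} {4≤B} (l≤ rem≤) (values≤ M)
          b₁ = bounded {B} {4≤B} (l≤ rem≤) m₁≤
      in seq (store (fits B 4≤B b (var 0)) (fits B 4≤B b (var 1)))
        (seq (store (fits B 4≤B b₁ (var 0)) (fits B 4≤B b₁ (var 2))) x)
    go : ∀ rem → rem + r ≡ cap n → TableResult rem r p g m
    go zero sum≡ = m₂ , _ ,
      stores z≤n (cond-true (fits B 4≤B (bounded {B} {4≤B} (l≤ z≤n) (values≤ M₂)) (op eq (var 3) (lit 0))) (λ ()) skip) ,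
      subst (λ c → Tables (suc c) m₂) sum≡ M₂ , ≤ᵇ⇒≤ 11 50 tt
    go (suc rem) sum≡ with fillTable-exec rem {suc r} {m₂} (trans (+-suc rem r) sum≡) M₂
    ... | m′ , t , x , M′ , t≤ = m′ , _ ,
      stores rem<
        (cond-false (fits B 4≤B b (op eq (var 3) (lit 0))) refl (proj₁ (proj₂ next))) ,
      M′ , τ≤
      where
      rem< : suc rem ≤ cap n
      rem< = subst (suc rem ≤_) sum≡ (m≤m+n (suc rem) r)
      b : Bounded B 4≤B ⟨ frame (r ∷ p ∷ g ∷ suc rem ∷ []) , m₂ ⟩
      b = bounded (l≤ rem<) (values≤ M₂)
      t+≤ : ∀ o → o ≤ 50 → o + t ≤ 50 * suc (suc rem)
      t+≤ o o≤ = ≤-trans (+-mono-≤ o≤ t≤) (≤-reflexive (sym (*-suc 50 (suc rem))))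
      next = continue {r} {rem} {m₂} {m′} {t} p g b x
      τ≤ : 3 + (3 + suc (3 + proj₁ next)) ≤ 50 * suc (suc rem)
      τ≤ = ≤-trans (+-monoʳ-≤ 10 (proj₂ (proj₂ next))) (t+≤ 28 (≤ᵇ⇒≤ 28 50 tt))

  module _ (k : ℕ) (k≤ : k ≤ cap n) where

    record Partial (u : ℕ) (m : Name → Contents) : Set where
      field
        holds′ : ∀ q → q < u → m perm (suc q) ≡ suc (ρ k q)
        tables : Tables (suc (cap n)) m

    open Partial

    PermResult : (rem u : ℕ) (m : Name → Contents) → Set
    PermResult rem u m = ∃[ m′ ] ∃[ t ]
      Exec W procs rem fillPermᶜ ⟨ frame (u ∷ tableP k ∷ tableG k ∷ rem ∷ []) , m ⟩ ⟨ frame (u ∷ tableP k ∷ tableG k ∷ rem ∷ []) , m′ ⟩ [] t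
      × Memory (ρ k) m′ × t ≤ 50 * suc rem

    fillPerm-exec : ∀ rem {u m} → suc rem + u ≡ n → Partial u m → PermResult rem u m
    fillPerm-exec rem {u} {m} sum≡ M = go rem sum≡
      where
      p g : ℕ
      p = tableP k
      g = tableG k
      u<n : u < n
      u<n = subst (u <_) sum≡ (s≤s (m≤n+m u rem))
      l≤ : ∀ {rem} → rem ≤ n → LocalsOk (frame (u ∷ p ∷ g ∷ rem ∷ []))
      l≤ rem≤ = frameOk (≤-trans (<⇒≤ u<n) n≤B ∷ ≤-trans (tableP≤ k) (≤-trans (n≤1+n _) (r+2≤B k≤))
        ∷ ≤-trans (tableG≤ k) (≤-trans k≤ (cap≤B ≤-refl)) ∷ ≤-trans rem≤ n≤B ∷ [])
      m₁ : Name → Contents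
      m₁ = m [ perm ↦ (m perm) [ suc u ↦ suc (ρ k u) ] ]
      M₁ : Partial (suc u) m₁
      M₁ = record
        { holds′ = new (m perm) (holds′ M)
        ; tables = record
          { P≡ = P≡ (tables M) ; G≡ = G≡ (tables M)
          ; values≤ = updates-≤ {m} (values≤ (tables M)) (update-≤ (values≤ (tables M) perm) (suc u) (≤-trans (ρ-< {n} k≤ u<n) n≤B)) perm } }
        where
        new : ∀ (a : Contents) → (∀ q → q < u → a (suc q) ≡ suc (ρ k q)) →
              ∀ q → q < suc u → (a [ suc u ↦ suc (ρ k u) ]) (suc q) ≡ suc (ρ k q)
        new a a≡ q q<1+u with q ≟ u
        ... | yes refl = update-hit a (suc q) (suc (ρ k q))
        ... | no q≢u = trans (update-miss a (suc (ρ k u)) (q≢u ∘ sym ∘ suc-injective)) (a≡ q (≤∧≢⇒< (s≤s⁻¹ q<1+u) q≢u))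
      storeAt : ∀ {D rem} v → suc (ρ k u) ≡ eval ⟨ frame (u ∷ p ∷ g ∷ rem ∷ []) , m ⟩ v → {ok : T (small v)} → rem ≤ n →
                Exec W procs D (store perm (lit 1 ⊕ var 0) v) ⟨ frame (u ∷ p ∷ g ∷ rem ∷ []) , m ⟩ ⟨ frame (u ∷ p ∷ g ∷ rem ∷ []) , m₁ ⟩ [] (suc (3 + cost v))
      storeAt {D} {rem} v v≡ {ok} rem≤ = subst
        (λ w → Exec W procs D (store perm (lit 1 ⊕ var 0) v) ⟨ frame (u ∷ p ∷ g ∷ rem ∷ []) , m ⟩
                 ⟨ frame (u ∷ p ∷ g ∷ rem ∷ []) , m [ perm ↦ (m perm) [ suc u ↦ w ] ] ⟩ [] (suc (3 + cost v)))
        (sym v≡) (store (fits B 4≤B b (lit 1 ⊕ var 0)) (fits B 4≤B b v {ok}))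
        where b = bounded {B} {4≤B} (l≤ rem≤) (values≤ (tables M))
      first : ∀ {D} rem → rem ≤ n → Σ[ τ ∈ ℕ ] τ ≤ 20 ×
        Exec W procs D (cond (op lt (var 0) (var 2)) (store perm (lit 1 ⊕ var 0) (var 2 ⊖ var 0))
                       (cond (op lt (var 0) (var 1)) (store perm (lit 1 ⊕ var 0) (var 2 ⊕ var 1 ⊖ var 0))
                                                     (store perm (lit 1 ⊕ var 0) (lit 1 ⊕ var 0))))
             ⟨ frame (u ∷ p ∷ g ∷ rem ∷ []) , m ⟩ ⟨ frame (u ∷ p ∷ g ∷ rem ∷ []) , m₁ ⟩ [] τ
      first rem rem≤ = branch (u <? g) (u <? p)
        where
        b = bounded {B} {4≤B} (l≤ rem≤) (values≤ (tables M))
        f₁ = fits B 4≤B b (op lt (var 0) (var 2))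
        f₂ = fits B 4≤B b (op lt (var 0) (var 1))
        branch : Dec (u < g) → Dec (u < p) → _
        branch (yes u<g) _ = 11 , ≤ᵇ⇒≤ 11 20 tt ,
          cond-true f₁ (λ e → 1+n≢0 (trans (sym (if-true (<ᵇ-true u<g))) e))
            (storeAt (var 2 ⊖ var 0) (trans (cong suc (reflect-below {p} u<g)) (sym (+-∸-assoc 1 u<g))) rem≤)
        branch (no u≮g) (yes u<p) = 17 , ≤ᵇ⇒≤ 17 20 tt ,
          cond-false f₁ (if-false (<ᵇ-false (≮⇒≥ u≮g))) (cond-true f₂ (λ e → 1+n≢0 (trans (sym (if-true (<ᵇ-true u<p))) e))
            (storeAt (var 2 ⊕ var 1 ⊖ var 0) (trans (cong suc (reflect-mid (≮⇒≥ u≮g) u<p)) (sym (+-∸-assoc 1 (≤-trans u<p (m≤n+m p g))))) rem≤))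
        branch (no u≮g) (no u≮p) = 15 , ≤ᵇ⇒≤ 15 20 tt ,
          cond-false f₁ (if-false (<ᵇ-false (≮⇒≥ u≮g))) (cond-false f₂ (if-false (<ᵇ-false (≮⇒≥ u≮p)))
            (storeAt (lit 1 ⊕ var 0) (cong suc (reflect-above (≮⇒≥ u≮g) (≮⇒≥ u≮p))) rem≤))
      go : ∀ rem → suc rem + u ≡ n → PermResult rem u m
      go zero sum≡ with first zero z≤n
      ... | τ , τ≤ , x = m₁ , _ ,
        seq x (cond-true (fits B 4≤B (bounded {B} {4≤B} (l≤ z≤n) (values≤ (tables M₁))) (op eq (var 3) (lit 0))) (λ ()) skip) ,
        record { holds = λ q q<n → holds′ M₁ q (subst (q <_) (sym sum≡) q<n)
               ; tablesP = λ r r≤ → P≡ (tables M₁) r (s≤s r≤)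
               ; tablesG = λ r r≤ → G≡ (tables M₁) r (s≤s r≤)
               ; cells≤ = values≤ (tables M₁) } ,
        ≤-trans (+-monoˡ-≤ 5 τ≤) (≤ᵇ⇒≤ 25 50 tt)
      go (suc rem) sum≡ with fillPerm-exec rem {suc u} {m₁} (trans (cong suc (+-suc rem u)) sum≡) M₁ | first {suc rem} (suc rem) rem≤
        where
        rem≤ : suc rem ≤ n
        rem≤ = ≤-trans (n≤1+n _) (subst (suc (suc rem) ≤_) sum≡ (m≤m+n (suc (suc rem)) u))
      ... | m′ , t , x , M′ , t≤ | τ , τ≤ , y = m′ , _ ,
        seq y (cond-false (fits B 4≤B b (op eq (var 3) (lit 0))) refl
          (call (all-fits B 4≤B b (lit 1 ⊕ var 0 ∷ var 1 ∷ var 2 ∷ var 3 ⊖ lit 1 ∷ [])) x)) ,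
        M′ , (begin
          τ + suc (3 + suc (8 + t)) ≤⟨ +-monoˡ-≤ (suc (3 + suc (8 + t))) τ≤ ⟩
          33 + t                    ≤⟨ +-mono-≤ (≤ᵇ⇒≤ 33 50 tt) t≤ ⟩
          50 + 50 * suc rem         ≡⟨ *-suc 50 (suc rem) ⟨
          50 * suc (suc rem)        ∎)
        where
        open ≤-Reasoning
        b : Bounded B 4≤B ⟨ frame (u ∷ p ∷ g ∷ suc rem ∷ []) , m₁ ⟩
        b = bounded (l≤ (≤-trans (n≤1+n _) (subst (suc (suc rem) ≤_) sum≡ (m≤m+n (suc (suc rem)) u)))) (values≤ (tables M₁))

-- Polynomial word size and total time

^-distribˡ-* : ∀ x y k → (x * y) ^ k ≡ x ^ k * y ^ k
^-distribˡ-* x y zero    = refl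
^-distribˡ-* x y (suc k) = trans (cong (x * y *_) (^-distribˡ-* x y k)) (regroup x y (x ^ k) (y ^ k))
  where
  regroup : ∀ x y a b → x * y * (a * b) ≡ (x * a) * (y * b)
  regroup = solve-∀

-- Separates the constant factor of the word size from the power of `n`, as the theorem demands
-- constants independent of `n` and `k`.
polynomial-wordSize : ∀ n e → (4 * n ^ 2) ^ e ≡ 4 ^ e * n ^ (2 * e)
polynomial-wordSize n e = trans (^-distribˡ-* 4 (n ^ 2) e) (cong (4 ^ e *_) (^-*-assoc n 2 e))

module Run (n : ℕ) (1≤n : 1 ≤ n) (i k : ℕ) (1+i≡n : suc i ≡ n) (k≤ : k ≤ cap n) where

  open Machine n 1≤n
  open Generation n 1≤n
  open Main n 1≤n
  open Initialisation n 1≤n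
  open Timed

  -- The step from level `i` to `suc i` adds `14 + i` nested calls, so the depth is quadratic in the
  -- number of points and below the word size.
  depthG≤ : ∀ i → suc (depthG i) ≤ 16 * (suc i * suc i)
  depthG≤ zero    = s≤s z≤n
  depthG≤ (suc i) = ≤-trans (≤-reflexive (expand i (depthG i))) (≤-trans (+-monoʳ-≤ (14 + i) (depthG≤ i))
    (≤-trans (m≤m+n _ (34 + 31 * i)) (≤-reflexive (square i))))
    where
    expand : ∀ i d → suc (suc (suc (suc i + (11 + d)))) ≡ (14 + i) + suc d
    expand = solve-∀
    square : ∀ i → ((14 + i) + 16 * (suc i * suc i)) + (34 + 31 * i) ≡ 16 * (suc (suc i) * suc (suc i))
    square = solve-∀

  B≤W : B ≤ W
  B≤W = ≤-trans (≤-reflexive (sym (^-identityʳ B))) (B^-mono B 4≤B {1} {maxSize} (≤ᵇ⇒≤ 1 64 tt))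

  depth≤W : suc (depthG i) ≤ W
  depth≤W = ≤-trans (depthG≤ i) (≤-trans (≤-reflexive (cong (λ n → 16 * (n * n)) 1+i≡n))
    (≤-trans (subst (16 * (n * n) ≤_) (square (n * n)) (m≤m*n (16 * (n * n)) (n * n) {{>-nonZero (*-mono-≤ 1≤n 1≤n)}}))
      (≤-trans (≤-reflexive (cong (λ x → (4 * x) * ((4 * x) * 1)) (cong (n *_) (sym (*-identityʳ n)))))
        (B^-mono B 4≤B {2} {maxSize} (≤ᵇ⇒≤ 2 64 tt)))))
    where
    square : ∀ x → 16 * x * x ≡ (4 * x) * ((4 * x) * 1)
    square = solve-∀

  start : ℕ → ℕ
  start = image (λ q → q) (endWord i k 0)

  start≡ρ : ∀ q → start q ≡ ρ k q
  start≡ρ q = trans (cong (λ w → decode w q) (endWord-0 i (subst (λ n → k ≤ cap n) (sym 1+i≡n) k≤)))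
                    (decode-lowest (suc i) k q (subst (λ n → k ≤ cap n) (sym 1+i≡n) k≤))

  locals₀ : Name → ℕ
  locals₀ = frame (n ∷ k ∷ [])

  locals₀≤ : LocalsOk locals₀
  locals₀≤ = frameOk (n≤B ∷ ≤-trans k≤ (cap≤B ≤-refl) ∷ [])

  generation : Timed true (suc (depthG i)) (call (generateᵖ true) (var 0 ∷ var 1 ∷ capᵉ ∷ lit 1 ∷ [])) locals₀
                 start (image (λ q → q) (endWord i k 1)) (map (image (λ q → q)) (words i k 1)) 4900
  generation = callT 4900 (generateᵖ true) (var 0 ∷ var 1 ∷ capᵉ ∷ lit 1 ∷ []) (suc i ∷ k ∷ cap (suc i) ∷ 1 ∷ []) refl locals₀≤
    (cong₂ (λ n c → n ∷ k ∷ c ∷ 1 ∷ []) (sym 1+i≡n) (trans (cap-formula n) (cong cap (sym 1+i≡n))))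
    (generate-timed i {true} {k} {1} {λ q → q} (λ _ q<n → q<n) one (subst (λ n → k ≤ cap n) (sym 1+i≡n) k≤) (≤-reflexive 1+i≡n))

  Outcome : Set
  Outcome = ∃[ s ] ∃[ ts ] ∃[ t ] Exec (4 ^ maxSize * n ^ (2 * maxSize)) procs (4 ^ maxSize * n ^ (2 * maxSize))
      (Program.main program) (initial (n ∷ k ∷ [])) s ts t
    × Pointwise HoldsFn ts (map (image (λ q → q)) (words i k 1)) × t ≤ 6000 * (length (words i k 1) + n ^ 2)

  outcome : Outcome
  outcome =
    let m₀ = λ _ _ → 0
        b₀ = bounded {B} {4≤B} {⟨ locals₀ , m₀ ⟩} locals₀≤ (λ _ _ → z≤n)
        m₁ , t₁ , x₁ , M₁ , t₁≤ = fillTable-exec (cap n) {0} {m₀} (+-identityʳ (cap n))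
          (record { P≡ = λ _ () ; G≡ = λ _ () ; values≤ = λ _ _ → z≤n })
        b₁ = bounded {B} {4≤B} {⟨ locals₀ , m₁ ⟩} locals₀≤ (Tables.values≤ M₁)
        m₂ , t₂ , x₂ , M₂ , t₂≤ = fillPerm-exec k k≤ (n ∸ 1) {0} {m₁} (trans (+-identityʳ _) (m+[n∸m]≡n 1≤n))
          (record { holds′ = λ _ () ; tables = M₁ })
        M₂′ = record { holds = λ q q<n → trans (holds M₂ q q<n) (cong suc (sym (start≡ρ q)))
                     ; tablesP = tablesP M₂ ; tablesG = tablesG M₂ ; cells≤ = cells≤ M₂ }
        result {m₃} {ts} {t₃} x₃ _ out t₃≤ = run (runsD generation) M₂′
    in ⟨ locals₀ , m₃ ⟩ , ts , suc (10 + t₁) + (suc (8 + t₂) + t₃) ,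
      subst (λ W → Exec W procs W (Program.main program) (initial (n ∷ k ∷ [])) ⟨ locals₀ , m₃ ⟩ ts (suc (10 + t₁) + (suc (8 + t₂) + t₃))) (polynomial-wordSize n maxSize)
      (seq (Exec-mono (≤-trans (≤-trans (n≤1+n _) (r+2≤B ≤-refl)) B≤W)
            (call (all-fits B 4≤B b₀ (lit 0 ∷ lit 1 ∷ lit 0 ∷ capᵉ ∷ []))
              (subst (λ c → Exec W procs (cap n) fillTableᶜ ⟨ frame (0 ∷ 1 ∷ 0 ∷ c ∷ []) , m₀ ⟩ ⟨ frame (0 ∷ 1 ∷ 0 ∷ c ∷ []) , m₁ ⟩ [] t₁)
                (sym (cap-formula n)) x₁)))
      (seq (Exec-mono (≤-trans (≤-reflexive (m+[n∸m]≡n 1≤n)) (≤-trans n≤B B≤W))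
            (call (all-fits B 4≤B b₁ (lit 0 ∷ cell 1 (var 1) ∷ cell 2 (var 1) ∷ var 0 ⊖ lit 1 ∷ []))
              (subst₂ (λ p g → Exec W procs (n ∸ 1) fillPermᶜ ⟨ frame (0 ∷ p ∷ g ∷ n ∸ 1 ∷ []) , m₁ ⟩ ⟨ frame (0 ∷ p ∷ g ∷ n ∸ 1 ∷ []) , m₂ ⟩ [] t₂)
                (sym (Tables.P≡ M₁ k (s≤s k≤))) (sym (Tables.G≡ M₁ k (s≤s k≤))) x₂)))
           (Exec-mono depth≤W x₃))) ,
      out , total t₁≤ (≤-trans t₂≤ (≤-reflexive (cong (50 *_) (m+[n∸m]≡n 1≤n)))) (≤-trans (+-monoˡ-≤ 4900 t₃≤) (τ≤ generation))
    where
    len = length (words i k 1)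
    total : ∀ {t₁ t₂ t₃} → t₁ ≤ 50 * suc (cap n) → t₂ ≤ 50 * n → t₃ + 4900 ≤ 6000 * length (map (image (λ q → q)) (words i k 1)) →
            suc (10 + t₁) + (suc (8 + t₂) + t₃) ≤ 6000 * (len + n ^ 2)
    total {t₁} {t₂} {t₃} t₁≤ t₂≤ t₃≤ = begin
      suc (10 + t₁) + (suc (8 + t₂) + t₃)
        ≡⟨ regroup t₁ t₂ t₃ ⟩
      t₃ + (t₁ + t₂ + 20)
        ≤⟨ +-mono-≤ (≤-trans (m≤m+n t₃ 4900) t₃≤) (+-mono-≤ (+-mono-≤
             (≤-trans t₁≤ (*-monoʳ-≤ 50 (+-mono-≤ (≤-trans 1≤n n≤n²) (cap≤n² n)))) (≤-trans t₂≤ (*-monoʳ-≤ 50 n≤n²)))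
             (*-monoʳ-≤ 20 (≤-trans 1≤n n≤n²))) ⟩
      6000 * length (map (image (λ q → q)) (words i k 1)) + (50 * (n ^ 2 + n ^ 2) + 50 * n ^ 2 + 20 * n ^ 2)
        ≤⟨ +-monoʳ-≤ (6000 * length (map (image (λ q → q)) (words i k 1))) (≤-trans (≤-reflexive (collect (n ^ 2))) (*-monoˡ-≤ (n ^ 2) (≤ᵇ⇒≤ 170 6000 tt))) ⟩
      6000 * length (map (image (λ q → q)) (words i k 1)) + 6000 * n ^ 2
        ≡⟨ cong (λ l → 6000 * l + 6000 * n ^ 2) (length-map (image (λ q → q)) (words i k 1)) ⟩
      6000 * len + 6000 * n ^ 2
        ≡⟨ *-distribˡ-+ 6000 len (n ^ 2) ⟨
      6000 * (len + n ^ 2) ∎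
      where
      open ≤-Reasoning
      regroup : ∀ a b c → suc (10 + a) + (suc (8 + b) + c) ≡ c + (a + b + 20)
      regroup = solve-∀
      collect : ∀ x → 50 * (x + x) + 50 * x + 20 * x ≡ 170 * x
      collect = solve-∀

module _ {i : ℕ} (1≤n : 1 ≤ suc i) where

  open Machine (suc i) 1≤n

  holds-permutations : ∀ {k ts} {ws : List (Word (suc i))} (ok : All (IsWord k) ws) →
                       Pointwise HoldsFn ts (map (λ w → decode w) ws) → Pointwise Holds ts (toPermutations ok)
  holds-permutations [] [] = []
  holds-permutations (_∷_ {x = w} (Vw , _) ok) (h ∷ hs) =
    (λ q → trans (h (toℕ q) (toℕ<n q)) (cong suc (sym (toPermutation-represents w Vw q)))) ∷ holds-permutations ok hs

mainTheorem3 : Σ[ P ∈ Program ] Σ[ C ∈ ℕ ] Σ[ D ∈ ℕ ] Σ[ d ∈ ℕ ]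
    (∀ (n k : ℕ) → 1 ≤ n → k ≤ (n * (n ∸ 1)) / 2 →
    Σ[ πs ∈ List (Permutation′ n) ] Σ[ t ∈ ℕ ]
    (Generates P (D * n ^ d) (n ∷ k ∷ []) πs t
    × ListsMajorIndex k πs
    × Linked (DifferByTranspositions 3) πs
    × t ≤ C * (majCount n k + n ^ 2)))
-- The constant 6000 is the budget `K` per output, which also covers the quadratic initialisation;
-- the next two are the factor and the exponent of `B ^ maxSize` for `B` equal to `4 * n ^ 2`.
mainTheorem3 = program , 6000 , 4 ^ maxSize , 2 * maxSize , generates
  where
  generates : ∀ (n k : ℕ) → 1 ≤ n → k ≤ (n * (n ∸ 1)) / 2 →
    Σ[ πs ∈ List (Permutation′ n) ] Σ[ t ∈ ℕ ]
    (Generates program (4 ^ maxSize * n ^ (2 * maxSize)) (n ∷ k ∷ []) πs t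
    × ListsMajorIndex k πs
    × Linked (DifferByTranspositions 3) πs
    × t ≤ 6000 * (majCount n k + n ^ 2))
  generates (suc i) k 1≤n k≤ =
    let s , ts , t , x , out , t≤ = Run.outcome (suc i) 1≤n i k refl k≤cap
    in πs , t ,
      (s , ts , x , holds-permutations 1≤n ok out) ,
      lists ,
      toPermutations-linked ok (words-path (suc i) i ≤-refl one k≤cap) ,
      ≤-trans t≤ (*-monoʳ-≤ 6000 (+-monoˡ-≤ (suc i ^ 2) (≤-trans (≤-reflexive (sym (length-toPermutations ok))) (length≤majCount lists))))
    where
    k≤cap : k ≤ cap (suc i)
    k≤cap = ≤-trans k≤ (≤-reflexive (cap-formula (suc i)))
    ok = words-sound i one k≤cap
    πs = toPermutations ok
    lists : ListsMajorIndex k πs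
    lists = record
      { exactly  = toPermutations-exactly ok (words-complete i one k≤cap)
      ; distinct = toPermutations-distinct ok (words-unique i one k≤cap) }
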